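{- Let $m \geq 1$ and $n \geq 2m$ be integers, and let $n_0$ be the integer attached to $n$ as defined in the context. The set $\tilde{J}(n,m)$, regarded as a subset of the $(n-1)$-dimensional Euclidean space $H_{n,m}=\{(x_1,\dots,x_n)\in\mathbb{R}^n : \sum_i x_i=m\}\simeq\mathbb{R}^{n-1}$, is not maximal as an $m$-distance set in $H_{n,m}$ if and only if $$n>n_0\qquad\text{and}\qquad 3n_0-\frac{n_0^2}{n}\leq 4m .$$ Furthermore, if the pair $(n,m)$ satisfies these two conditions, then each vector $x$ of the following set can be added to $\tilde{J}(n,m)$ while maintaining $m$-distance (i.e. $\tilde{J}(n,m)\cup\{x\}$ is an $m$-distance set): $$\begin{cases}\left(\left(\frac{n_0}{n}\right)^{n-n_0+m},\ \left(-1+\frac{n_0}{n}\right)^{n_0-m}\right)^P & \text{if } m<n_0,\\[4pt] \left(\left(\frac{m}{n}\right)^n\right) & \text{if } m=n_0,\\[4pt] \left(\left(1+\frac{n_0}{n}\right)^{m-n_0},\ \left(\frac{n_0}{n}\right)^{n+n_0-m}\right)^P & \text{if } m>n_0.\end{cases}$$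
   Context: Notation: $(a_1^{r_1},\dots,a_t^{r_t})^P$ denotes the set of all vectors obtained by permuting the coordinates of the vector in which $a_i$ occurs $r_i$ times; inside the parentheses exponents are multiplicities, not powers. $((a)^n)$ is the (set consisting of the) constant vector $(a,\dots,a)\in\mathbb{R}^n$. $\tilde{J}(n,m)=(1^m,0^{n-m})^P\subset\mathbb{R}^n$ is the set of all $0/1$ vectors of length $n$ with exactly $m$ ones (the representation of the Johnson graph $J(n,m)$). It lies in the hyperplane $H_{n,m}=\{\sum_i x_i=m\}$, which is identified with $\mathbb{R}^{n-1}$. A finite subset of a Euclidean space is an $s$-distance set if exactly $s$ distinct values occur as Euclidean distances between distinct points of it. For $n\ge 2m$, $\tilde J(n,m)$ is an $m$-distance set. An $s$-distance set is maximal in a given space if no other $s$-distance set in that space contains it. Definition of $n_0$: write $n=2^{e_0}\prod_{i>0}p_i^{e_i}$ with distinct odd primes $p_i$ and exponents $e_i\ge 0$. Then $$n_0=\prod_{i>0}p_i^{\lceil e_i/2\rceil}\ \text{ if } e_0=0,\qquad n_0=2^{\lceil (e_0+1)/2\rceil}\prod_{i>0}p_i^{\lceil e_i/2\rceil}\ \text{ if } e_0>0 .$$ -}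

module Defs where

open import Algebra.Bundles.Raw using (RawRing)
import Algebra.Definitions.RawMonoid as RawMonoidDefinitions
open import Data.Integer.Base using (+_)
open import Data.List.Base as List using (List; []; _∷_)
import Data.List.Membership.Setoid as SetoidMembership
import Data.List.Relation.Binary.Permutation.Setoid as SetoidPermutation
open import Data.Nat.Base as ℕ using (ℕ; zero; suc)
import Data.Nat.Properties as ℕ
open import Data.Nat.ListAction using (product)
open import Data.Nat.Primality.Factorisation using (factors; factorise)
open import Data.Product.Base using (_×_; _,_; ∃; ∃-syntax; Σ-syntax; ∃₂)
open import Data.Rational.Base as ℚ using (ℚ; 0ℚ; 1ℚ; ½; ∣_∣; _<_)
import Data.Rational.Properties as ℚ
open import Data.Rational.Solver using (module +-*-Solver)
open import Data.Vec.Functional using (Vector; toList)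
import Data.Vec.Functional.Relation.Binary.Equality.Setoid as VectorEquality
open import Function.Bundles using (_⇔_)
open import Function.Definitions using (Injective)
open import Level using (0ℓ)
open import Relation.Binary.Bundles using (Setoid)
open import Relation.Binary.PropositionalEquality
  using (_≡_; refl; sym; trans; cong; cong₂; subst)
open import Relation.Nullary.Decidable using (¬?)
open import Relation.Nullary.Negation using (¬_)
open import Relation.Unary using (Pred; _∈_; _∉_; _⊆_; _≐_; _∪_)

0<½* : ∀ {ε} → 0ℚ < ε → 0ℚ < ½ ℚ.* ε
0<½* {ε} 0<ε =
  ℚ.positive⁻¹ (½ ℚ.* ε) {{ℚ.pos*pos⇒pos ½ ε {{ℚ.positive 0<ε}}}}

½+½ : ∀ ε → ½ ℚ.* ε ℚ.+ ½ ℚ.* ε ≡ ε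
½+½ ε = trans (sym (ℚ.*-distribʳ-+ ε ½ ½)) (ℚ.*-identityˡ ε)

∣p-q∣≡∣q-p∣ : ∀ p q → ∣ p ℚ.- q ∣ ≡ ∣ q ℚ.- p ∣
∣p-q∣≡∣q-p∣ p q = trans (sym (ℚ.∣-p∣≡∣p∣ (p ℚ.- q)))
  (cong ∣_∣ (solve 2 (λ a b → :- (a :- b) := b :- a) refl p q))
  where open +-*-Solver

-- |a| and |b| small imply |a + b| small; the sum is given up to equality.
halves : ∀ {ε} a b {c} → a ℚ.+ b ≡ c →
         ∣ a ∣ < ½ ℚ.* ε → ∣ b ∣ < ½ ℚ.* ε → ∣ c ∣ < ε
halves {ε} a b refl a< b< = subst (∣ a ℚ.+ b ∣ <_) (½+½ ε)
  (ℚ.≤-<-trans (ℚ.∣p+q∣≤∣p∣+∣q∣ a b) (ℚ.+-mono-< a< b<))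

∣p-p∣<ε : ∀ {ε} p → 0ℚ < ε → ∣ p ℚ.- p ∣ < ε
∣p-p∣<ε {ε} p 0<ε =
  subst (λ q → ∣ q ∣ < ε) (sym (ℚ.+-inverseʳ p)) 0<ε

-- The modulus used for products: if |a| < A and |b| < ε/(2A), then
-- |a b| < ε/2.
module Scale {A ε : ℚ} (0<A : 0ℚ < A) (0<ε : 0ℚ < ε) where
  instance
    A-pos : ℚ.Positive A
    A-pos = ℚ.positive 0<A

    A-nonZero : ℚ.NonZero A
    A-nonZero = ℚ.pos⇒nonZero A

  δ : ℚ
  δ = ℚ.1/ A ℚ.* (½ ℚ.* ε)

  0<δ : 0ℚ < δ
  0<δ = ℚ.positive⁻¹ δ
    {{ℚ.pos*pos⇒pos (ℚ.1/ A) {{ℚ.1/pos⇒pos A}} (½ ℚ.* ε) {{ℚ.positive (0<½* 0<ε)}}}}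

  small : ∀ a b → ∣ a ∣ < A → ∣ b ∣ < δ → ∣ a ℚ.* b ∣ < ½ ℚ.* ε
  small a b a< b< = subst (_< ½ ℚ.* ε) (sym (ℚ.∣p*q∣≡∣p∣*∣q∣ a b))
    (ℚ.≤-<-trans
      (ℚ.*-monoʳ-≤-nonNeg ∣ b ∣ {{ℚ.∣-∣-nonNeg b}} (ℚ.<⇒≤ a<))
      (subst (A ℚ.* ∣ b ∣ <_) Aδ≡ (ℚ.*-monoʳ-<-pos A b<)))
    where
    Aδ≡ : A ℚ.* δ ≡ ½ ℚ.* ε
    Aδ≡ = trans (sym (ℚ.*-assoc A (ℚ.1/ A) (½ ℚ.* ε)))
      (trans (cong (ℚ._* (½ ℚ.* ε)) (ℚ.*-inverseʳ A)) (ℚ.*-identityˡ (½ ℚ.* ε)))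

-- The real numbers, as Cauchy sequences of rationals with setoid equality.
-- The modulus is part of the data, so no choice principle is involved.

Cauchy : (ℕ → ℚ) → Set
Cauchy a = ∀ ε → 0ℚ < ε →
  ∃[ N ] (∀ j k → N ℕ.≤ j → N ℕ.≤ k → ∣ a j ℚ.- a k ∣ < ε)

record ℝ : Set where
  constructor mkℝ
  field
    seq    : ℕ → ℚ
    cauchy : Cauchy seq

open ℝ public

infix  4 _≃_ _≤_
infixl 6 _+_ _-_
infixl 7 _*_
infix  8 -_

_≃_ : ℝ → ℝ → Set
x ≃ y = ∀ ε → 0ℚ < ε →
  ∃[ N ] (∀ k → N ℕ.≤ k → ∣ seq x k ℚ.- seq y k ∣ < ε)

_≤_ : ℝ → ℝ → Set
x ≤ y = ∀ ε → 0ℚ < ε →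
  ∃[ N ] (∀ k → N ℕ.≤ k → seq x k < seq y k ℚ.+ ε)

≃-setoid : Setoid 0ℓ 0ℓ
≃-setoid = record
  { Carrier       = ℝ
  ; _≈_           = _≃_
  ; isEquivalence = record
    { refl  = λ {x} ε 0<ε → 0 , λ k _ → ∣p-p∣<ε (seq x k) 0<ε
    ; sym   = λ {x} {y} x≃y ε 0<ε → let N , h = x≃y ε 0<ε in
        N , λ k N≤k → subst (_< ε) (∣p-q∣≡∣q-p∣ (seq x k) (seq y k)) (h k N≤k)
    ; trans = λ {x} {y} {z} x≃y y≃z ε 0<ε →
        let M , h = x≃y (½ ℚ.* ε) (0<½* 0<ε)
            N , i = y≃z (½ ℚ.* ε) (0<½* 0<ε)
        in M ℕ.⊔ N , λ k N≤k →
          halves (seq x k ℚ.- seq y k) (seq y k ℚ.- seq z k)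
            (telescope (seq x k) (seq y k) (seq z k))
            (h k (ℕ.m⊔n≤o⇒m≤o M N N≤k)) (i k (ℕ.m⊔n≤o⇒n≤o M N N≤k))
    }
  }
  where
  open +-*-Solver
  telescope : ∀ a b c → (a ℚ.- b) ℚ.+ (b ℚ.- c) ≡ a ℚ.- c
  telescope = solve 3 (λ a b c → (a :- b) :+ (b :- c) := a :- c) refl

fromℚ : ℚ → ℝ
fromℚ q = mkℝ (λ _ → q) (λ ε 0<ε → 0 , λ _ _ _ _ → ∣p-p∣<ε q 0<ε)

fromℕ : ℕ → ℝ
fromℕ k = fromℚ (+ k ℚ./ 1)

0ℝ 1ℝ : ℝ
0ℝ = fromℚ 0ℚ
1ℝ = fromℚ 1ℚ

_+_ : ℝ → ℝ → ℝ
x + y = mkℝ (λ k → seq x k ℚ.+ seq y k) λ ε 0<ε →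
  let M , h = cauchy x (½ ℚ.* ε) (0<½* 0<ε)
      N , i = cauchy y (½ ℚ.* ε) (0<½* 0<ε)
  in M ℕ.⊔ N , λ j k N≤j N≤k →
    halves (seq x j ℚ.- seq x k) (seq y j ℚ.- seq y k)
      (interchange (seq x j) (seq x k) (seq y j) (seq y k))
      (h j k (ℕ.m⊔n≤o⇒m≤o M N N≤j) (ℕ.m⊔n≤o⇒m≤o M N N≤k))
      (i j k (ℕ.m⊔n≤o⇒n≤o M N N≤j) (ℕ.m⊔n≤o⇒n≤o M N N≤k))
  where
  open +-*-Solver
  interchange : ∀ a b c d → (a ℚ.- b) ℚ.+ (c ℚ.- d) ≡ (a ℚ.+ c) ℚ.- (b ℚ.+ d)
  interchange = solve 4
    (λ a b c d → (a :- b) :+ (c :- d) := (a :+ c) :- (b :+ d)) refl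

-_ : ℝ → ℝ
- x = mkℝ (λ k → ℚ.- seq x k) λ ε 0<ε →
  let N , h = cauchy x ε 0<ε
  in N , λ j k N≤j N≤k →
    subst (λ q → ∣ q ∣ < ε) (negate (seq x j) (seq x k)) (h k j N≤k N≤j)
  where
  open +-*-Solver
  negate : ∀ a b → b ℚ.- a ≡ ℚ.- a ℚ.- ℚ.- b
  negate = solve 2 (λ a b → b :- a := :- a :- :- b) refl

_-_ : ℝ → ℝ → ℝ
x - y = x + - y

bounded : ∀ x → ∃₂ λ B N → 0ℚ < B × (∀ k → N ℕ.≤ k → ∣ seq x k ∣ < B)
bounded x =
  let N , h = cauchy x 1ℚ (ℚ.positive⁻¹ 1ℚ)
      a     = seq x N
  in 1ℚ ℚ.+ ∣ a ∣ , N ,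
     ℚ.+-mono-<-≤ (ℚ.positive⁻¹ 1ℚ) (ℚ.0≤∣p∣ a) ,
     λ k N≤k → subst (λ q → ∣ q ∣ < 1ℚ ℚ.+ ∣ a ∣) (cancel (seq x k) a)
       (ℚ.≤-<-trans (ℚ.∣p+q∣≤∣p∣+∣q∣ (seq x k ℚ.- a) a)
         (ℚ.+-mono-<-≤ (h k N N≤k ℕ.≤-refl) (ℚ.≤-refl {∣ a ∣})))
  where
  open +-*-Solver
  cancel : ∀ p q → (p ℚ.- q) ℚ.+ q ≡ p
  cancel = solve 2 (λ p q → (p :- q) :+ q := p) refl

_*_ : ℝ → ℝ → ℝ
x * y = mkℝ (λ k → seq x k ℚ.* seq y k) λ ε 0<ε →
  let A , K , 0<A , x<A = bounded x
      B , L , 0<B , y<B = bounded y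
      module X = Scale 0<A 0<ε
      module Y = Scale 0<B 0<ε
      M , h = cauchy y X.δ X.0<δ
      N , i = cauchy x Y.δ Y.0<δ
      KL = K ℕ.⊔ L
      MN = M ℕ.⊔ N
  in KL ℕ.⊔ MN , λ j k j≥ k≥ →
    let j≥KL = ℕ.m⊔n≤o⇒m≤o KL MN j≥
        k≥KL = ℕ.m⊔n≤o⇒m≤o KL MN k≥
        j≥MN = ℕ.m⊔n≤o⇒n≤o KL MN j≥
        k≥MN = ℕ.m⊔n≤o⇒n≤o KL MN k≥
    in halves
      (seq x j ℚ.* (seq y j ℚ.- seq y k)) (seq y k ℚ.* (seq x j ℚ.- seq x k))
      (leibniz (seq x j) (seq x k) (seq y j) (seq y k))
      (X.small (seq x j) _ (x<A j (ℕ.m⊔n≤o⇒m≤o K L j≥KL))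
        (h j k (ℕ.m⊔n≤o⇒m≤o M N j≥MN) (ℕ.m⊔n≤o⇒m≤o M N k≥MN)))
      (Y.small (seq y k) _ (y<B k (ℕ.m⊔n≤o⇒n≤o K L k≥KL))
        (i j k (ℕ.m⊔n≤o⇒n≤o M N j≥MN) (ℕ.m⊔n≤o⇒n≤o M N k≥MN)))
  where
  open +-*-Solver
  leibniz : ∀ a b c d → a ℚ.* (c ℚ.- d) ℚ.+ d ℚ.* (a ℚ.- b) ≡ a ℚ.* c ℚ.- b ℚ.* d
  leibniz = solve 4
    (λ a b c d → a :* (c :- d) :+ d :* (a :- b) := a :* c :- b :* d) refl

ℝ-rawRing : RawRing 0ℓ 0ℓ
ℝ-rawRing = record
  { Carrier = ℝ
  ; _≈_     = _≃_
  ; _+_     = _+_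
  ; _*_     = _*_
  ; -_      = -_
  ; 0#      = 0ℝ
  ; 1#      = 1ℝ
  }

open RawMonoidDefinitions (RawRing.+-rawMonoid ℝ-rawRing) public using (sum)
open VectorEquality ≃-setoid public using (_≋_; ≋-setoid)

Point : ℕ → Set
Point = Vector ℝ

PointSet : ℕ → Set₁
PointSet n = Pred (Point n) 0ℓ

Finite : ∀ {n} → PointSet n → Set
Finite {n} X = Σ[ xs ∈ List (Point n) ] (∀ x → x ∈ X ⇔ x ∈ₗ xs)
  where open SetoidMembership (≋-setoid n) renaming (_∈_ to _∈ₗ_)

-- d = sqrt (Σᵢ (xᵢ - yᵢ)²), the square root being the non-negative real with
-- the given square.
IsDistance : ∀ {n} → Point n → Point n → ℝ → Set
IsDistance x y d = 0ℝ ≤ d × d * d ≃ sum (λ i → (x i - y i) * (x i - y i))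

-- The family d lists, without repetition, exactly the distances between
-- distinct points of X.
IsDistanceSet : ∀ {n} → ℕ → PointSet n → Set
IsDistanceSet s X = Finite X × Σ[ d ∈ Vector ℝ s ]
  ( Injective _≡_ _≃_ d
  × (∀ i → ∃₂ λ x y → x ∈ X × y ∈ X × ¬ (x ≋ y) × IsDistance x y (d i))
  × (∀ x y → x ∈ X → y ∈ X → ¬ (x ≋ y) → ∃[ i ] IsDistance x y (d i)))

IsMaximalIn : ∀ {n} → PointSet n → ℕ → PointSet n → Set₁
IsMaximalIn {n} H s X = X ⊆ H × IsDistanceSet s X ×
  ¬ (Σ[ Y ∈ PointSet n ] (Y ⊆ H × IsDistanceSet s Y × X ⊆ Y × ¬ (Y ≐ X)))

-- (a₁^r₁ , … , aₜ^rₜ)ᴾ for the list (a₁ , r₁) ∷ … ∷ (aₜ , rₜ) ∷ []; the set is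
-- empty unless the multiplicities add up to n.
_ᴾ : ∀ {n} → List (ℝ × ℕ) → PointSet n
(blocks ᴾ) x = toList x ↭ List.concatMap (λ (a , r) → List.replicate r a) blocks
  where open SetoidPermutation ≃-setoid using (_↭_)

J̃ : (n m : ℕ) → PointSet n
J̃ n m = ((1ℝ , m) ∷ (0ℝ , n ℕ.∸ m) ∷ []) ᴾ

Hyperplane : (n m : ℕ) → PointSet n
Hyperplane n m x = sum x ≃ fromℕ m

multiplicity : (p n : ℕ) → .{{ℕ.NonZero n}} → ℕ
multiplicity p n = List.length (List.filter (p ℕ.≟_) (factors (factorise n)))

oddPrimeDivisors : (n : ℕ) → .{{ℕ.NonZero n}} → List ℕ
oddPrimeDivisors n =
  List.filter (λ p → ¬? (p ℕ.≟ 2)) (List.deduplicate ℕ._≟_ (factors (factorise n)))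

n₀ : (n : ℕ) → .{{ℕ.NonZero n}} → ℕ
n₀ n = twoPart (multiplicity 2 n)
  ℕ.* product (List.map (λ p → p ℕ.^ ℕ.⌈ multiplicity p n /2⌉) (oddPrimeDivisors n))
  where
  twoPart : ℕ → ℕ
  twoPart zero       = 1
  twoPart e₀@(suc _) = 2 ℕ.^ ℕ.⌈ e₀ ℕ.+ 1 /2⌉

ExtensionCondition : (n m : ℕ) → .{{ℕ.NonZero n}} → Set
ExtensionCondition n m = n ℕ.> n₀ n
  × + (3 ℕ.* n₀ n) ℚ./ 1 ℚ.- + (n₀ n ℕ.^ 2) ℚ./ n ℚ.≤ + (4 ℕ.* m) ℚ./ 1

CanBeAdded : (n m : ℕ) → Point n → Set
CanBeAdded n m x = x ∈ Hyperplane n m × x ∉ J̃ n m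
  × IsDistanceSet m (J̃ n m ∪ (_≋ x))

-- A larger m-distance set Y realises exactly the distances √2, √4, …, √(2m), because the m
-- distances of J̃(n,m) already use up those of Y.  Let x be a point of Y outside J̃(n,m).  The
-- squared distances from x to two vertices whose supports differ by one swap differ by an even
-- integer, so the coordinates of x differ by integers: xᵢ = a + yᵢ with y integral, n a = t,
-- 0 ≤ t < n and Σ y = m - t.  The squared distance from x to the vertex s is E(s) - w, where
-- E(s) = Σ (yᵢ - sᵢ)² and n w = t², and parity forces w ≡ t (mod 2).  A number t admits such a w
-- exactly when n₀ divides it.  Bounding E(s) below by linear forms in y and s, for supports
-- squeezed between {yᵢ < 0} and {yᵢ ≤ 0}, gives t > 0 and 3 t - t²/n ≤ 4 m; as 3 t - t²/n
-- increases on [n₀ , n], the same inequality holds for n₀.  Conversely, t = n₀ with y in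
-- {-1 , 0}ⁿ or {0 , 1}ⁿ satisfies all the constraints.

module Submission where

open import Algebra.Bundles using (CommutativeRing)
import Algebra.Definitions.RawMonoid as RawMonoidDefinitions
import Algebra.Solver.Ring as RingSolver
import Algebra.Solver.Ring.AlmostCommutativeRing as ACR
open import Data.Bool.Base using (Bool; true; false; not; if_then_else_)
open import Data.Empty using (⊥; ⊥-elim)
open import Data.Fin.Base using (Fin; zero; suc; toℕ; fromℕ<; punchOut)
import Data.Fin.Properties as Fin
open import Data.Integer.Base as ℤ using (ℤ; +_; +[1+_]; 0ℤ; 1ℤ)
open import Data.Integer.DivMod using (_%ℕ_; _/ℕ_; n%ℕd<d; a≡a%ℕn+[a/ℕn]*n)
import Data.Integer.Properties as ℤ
import Data.Integer.Tactic.RingSolver as ℤSolver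
open import Data.List.Base using (List; []; _∷_; _++_; deduplicate; filter; length; map; replicate)
open import Data.List.Membership.Propositional using (find; lose)
open import Data.List.Membership.Propositional.Properties
  using (∈-map⁺; ∈-filter⁺; ∈-filter⁻; ∈-deduplicate⁺; ∈-deduplicate⁻)
open import Data.List.Properties using (filter-accept; filter-reject)
open import Data.List.Relation.Binary.Permutation.Homogeneous as Permutation using (Permutation)
open import Data.List.Relation.Binary.Pointwise.Base using (Pointwise; []; _∷_)
open import Data.List.Relation.Unary.All as All using (All; []; _∷_)
open import Data.List.Relation.Unary.AllPairs using ([]; _∷_)
open import Data.List.Relation.Unary.Any as Any using (Any; here; there)
import Data.List.Relation.Unary.Any.Properties as Any
open import Data.List.Relation.Unary.Unique.Propositional using (Unique)
import Data.List.Relation.Unary.Unique.Propositional.Properties as Unique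
open import Data.Maybe.Base using (Maybe; just; nothing)
open import Data.Nat.Base as ℕ using (ℕ; zero; suc; NonZero; z≤n; s≤s)
import Data.Nat.Divisibility as ℕ
import Data.Nat.Properties as ℕ
import Data.Nat.Tactic.RingSolver as ℕSolver
open import Data.Product.Base using (_×_; _,_; ∃-syntax; ∃₂; proj₁; proj₂)
open import Data.Rational.Base as ℚ using (ℚ; mkℚ; 0ℚ; 1ℚ; ½; _/_; toℚᵘ)
import Data.Rational.Properties as ℚ
import Data.Rational.Solver as ℚSolver
open import Data.Rational.Unnormalised.Base as ℚᵘ using (mkℚᵘ; *≡*; *≤*; *<*)
import Data.Rational.Unnormalised.Properties as ℚᵘ
open import Data.Sum.Base using (inj₁; inj₂; [_,_]′)
open import Data.Vec.Functional using (Vector; tail; toList; updateAt) renaming (_∷_ to _∷ᵥ_)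
open import Data.Vec.Functional.Properties using (updateAt-updates)
open import Function.Base using (_∘_; const; id)
open import Function.Bundles using (_⇔_; mk⇔; Equivalence)
open import Function.Definitions using (Injective)
open import Level using (0ℓ; _⊔_)
open import Relation.Binary.Bundles using (Setoid)
open import Relation.Binary.PropositionalEquality as ≡
  using (_≡_; _≢_; _≗_; cong; cong₂; subst; subst₂)
open import Relation.Nullary.Decidable
  using (Dec; does; proof; yes; no; ¬?; dec-true; decidable-stable; _×-dec_)
open import Relation.Nullary.Negation using (¬_; contradiction)
open import Relation.Nullary.Reflects using (Reflects; invert)
open import Relation.Unary using (_∈_; _⊆_; _≐_; _∪_)

open RawMonoidDefinitions ℤ.+-0-rawMonoid using () renaming (sum to ∑)

-- The parity condition rests on u² and u having the same parity: E(s) is congruent to Σ (y - s) = -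
-- t modulo 2, and E(s) - w is even, so w and t agree modulo 2. Since w = t²/n is an integer, the
-- rational condition turns into 3 t ≤ 4 m + w, an inequality in ℕ. The main obstacle is
-- constructive. Equality of reals is undecidable, so neither membership in J̃(n,m) nor the number
-- of coordinates equal to a given value can be tested. Coordinates therefore carry Boolean labels,
-- a point outside J̃(n,m) is only known not to be a vertex, and necessity is proved as a
-- refutation, which suffices because the condition itself is decidable. The algebra is carried out
-- over an abstract commutative ring with a map from ℤ, where equations between integers can be
-- pulled back by injectivity and no Cauchy sequence has to be inspected.

injective⇒hit : ∀ {n} {f : Fin n → Fin n} → Injective _≡_ _≡_ f → ∀ j → ∃[ i ] f i ≡ j
injective⇒hit {suc n} {f} f-inj j with Fin.any? (λ i → f i Fin.≟ j)
... | yes hit = hit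
-- Pigeonhole: if `j` were missed, `punchOut` at `j` would turn `f` into an injection into a set
-- with one element less.
... | no miss = contradiction (Fin.injective⇒≤ {f = λ i → punchOut (miss ∘ (i ,_) ∘ ≡.sym)}
  (λ {i} {i′} → f-inj ∘ Fin.punchOut-injective (miss ∘ (i ,_) ∘ ≡.sym) (miss ∘ (i′ ,_) ∘ ≡.sym))) ℕ.1+n≰n

-- Arithmetic of n₀: prime exponents and admissible pairs

module NumberTheory where

  open import Data.List.Membership.Propositional using () renaming (_∈_ to _∈ₗ_)
  open import Data.List.Relation.Unary.Unique.DecPropositional.Properties ℕ._≟_ using (deduplicate-!)
  open import Data.Nat.Base hiding (parity)
  open import Data.Nat.Divisibility
  open import Data.Nat.ListAction using (product)
  open import Data.Nat.ListAction.Properties using (∈⇒∣product)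
  open import Data.Nat.Primality
    using (Prime; euclidsLemma; prime⇒nonZero; prime⇒nonTrivial; prime⇒irreducible; prime[2])
  open import Data.Nat.Primality.Factorisation using (PrimeFactorisation; factors; factorise)
  open import Data.Nat.Properties
  open import Defs using (n₀; multiplicity; oddPrimeDivisors)
  open ≡ using (refl; sym; trans)
  open ℕSolver using (solve-∀)

  -- `multiplicity` with the list of prime factors made a variable, so that induction on the list is
  -- possible; at the factorisation of n the two agree by computation.
  count : ℕ → List ℕ → ℕ
  count p = length ∘ filter (p ≟_)

  count-≡ : ∀ p l → count p (p ∷ l) ≡ suc (count p l)
  count-≡ p l = cong length (filter-accept (p ≟_) refl)

  count-≢ : ∀ {p q} l → p ≢ q → count p (q ∷ l) ≡ count p l
  count-≢ {p} l p≢q = cong length (filter-reject (p ≟_) p≢q)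

  prime∤prime : ∀ {p q} → Prime p → Prime q → p ≢ q → p ∤ q
  prime∤prime pp pq p≢q p∣q with prime⇒irreducible pq p∣q
  ... | inj₁ refl = contradiction (prime⇒nonTrivial pp) λ ()
  ... | inj₂ p≡q  = p≢q p≡q

  -- Euclid's lemma for prime powers: no factor `p` can come from `q`, so they are stripped from `u`
  -- one at a time.
  ∣*∧∤⇒∣ : ∀ {p} q {u} → Prime p → p ∤ q → ∀ a → p ^ a ∣ q * u → p ^ a ∣ u
  ∣*∧∤⇒∣ q {u} pp p∤q zero    _ = 1∣ u
  ∣*∧∤⇒∣ {p} q {u} pp p∤q (suc a) d
    with euclidsLemma q u pp (m*n∣⇒m∣ p (p ^ a) d)
  ... | inj₁ p∣q = contradiction p∣q p∤q
  ... | inj₂ (divides u′ refl) = subst (p ^ suc a ∣_) (*-comm p u′)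
    (*-monoʳ-∣ p (∣*∧∤⇒∣ q pp p∤q a (*-cancelˡ-∣ p {{prime⇒nonZero pp}}
      (subst (p ^ suc a ∣_) (rearrange q u′ p) d))))
    where
    rearrange : ∀ q u p → q * (u * p) ≡ p * (q * u)
    rearrange = solve-∀

  ^∣*⇒∣ : ∀ {p q} b {u} → Prime p → Prime q → p ≢ q →
          ∀ a → p ^ a ∣ q ^ b * u → p ^ a ∣ u
  ^∣*⇒∣ {p} zero    {u} pp pq p≢q a d = subst (p ^ a ∣_) (*-identityˡ u) d
  ^∣*⇒∣ {p} {q} (suc b) {u} pp pq p≢q a d = ^∣*⇒∣ b pp pq p≢q a
    (∣*∧∤⇒∣ q pp (prime∤prime pp pq p≢q) a (subst (p ^ a ∣_) (*-assoc q (q ^ b) u) d))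

  count-∣ : ∀ p l → p ^ count p l ∣ product l
  count-∣ p []      = ∣-refl
  count-∣ p (q ∷ l) with p ≟ q
  ... | yes refl = subst (λ e → p ^ e ∣ product (p ∷ l)) (sym (count-≡ p l)) (*-monoʳ-∣ p (count-∣ p l))
  ... | no p≢q   = subst (λ e → p ^ e ∣ product (q ∷ l)) (sym (count-≢ l p≢q)) (∣n⇒∣m*n q (count-∣ p l))

  -- Divisibility is checked prime by prime. Dividing `K` by the head `p` preserves the hypothesis:
  -- the exponent at `p` drops by one on both sides, and at any other prime the removed factor is
  -- coprime.
  product-∣ : ∀ {l K} → All Prime l → (∀ {p} → Prime p → p ^ count p l ∣ K) → product l ∣ K
  product-∣ {[]}    {K} _          _ = 1∣ K
  product-∣ {p ∷ l} (pp ∷ pl) h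
    with m*n∣⇒m∣ p (p ^ count p l) (subst (λ e → p ^ e ∣ _) (count-≡ p l) (h pp))
  ... | divides K refl = subst (p * product l ∣_) (*-comm p K) (*-monoʳ-∣ p (product-∣ pl h′))
    where
    h′ : ∀ {q} → Prime q → q ^ count q l ∣ K
    h′ {q} pq with q ≟ p
    ... | yes refl = *-cancelˡ-∣ p {{prime⇒nonZero pp}}
      (subst₂ _∣_ (cong (p ^_) (count-≡ p l)) (*-comm K p) (h pp))
    ... | no q≢p = ∣*∧∤⇒∣ p pq (prime∤prime pq pp q≢p) (count q l)
      (subst₂ _∣_ (cong (q ^_) (count-≢ l q≢p)) (*-comm K p) (h pq))

  -- Powers of distinct primes are coprime, so the later ones still divide the quotient of `t` by
  -- the first.
  product-^-∣ : ∀ (e : ℕ → ℕ) {ps t} → Unique ps → All Prime ps →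
                All (λ p → p ^ e p ∣ t) ps → product (map (λ p → p ^ e p) ps) ∣ t
  product-^-∣ e {t = t} [] [] [] = 1∣ t
  product-^-∣ e {p ∷ ps} (p≢ ∷ u) (pp ∷ pps) (divides t refl ∷ ds) =
    subst (product (map (λ p → p ^ e p) (p ∷ ps)) ∣_) (*-comm (p ^ e p) t) (*-monoʳ-∣ (p ^ e p)
      (product-^-∣ e u pps (All.zipWith (λ {q} ((p≢q , pq) , d) →
        ^∣*⇒∣ (e p) pq pp (p≢q ∘ sym) (e q) (subst (q ^ e q ∣_) (*-comm t (p ^ e p)) d))
        (All.zip (p≢ , pps) , ds))))

  -- Each factor `p` of `t` accounts for two in the square, so `e` is lowered by two at a time; a
  -- single remaining one still costs a whole factor, hence the rounding up.
  ^∣square⇒^∣ : ∀ {p} → Prime p → ∀ e {t} → p ^ e ∣ t * t → p ^ ⌈ e /2⌉ ∣ t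
  ^∣square⇒^∣ pp zero {t} _ = 1∣ t
  ^∣square⇒^∣ {p} pp (suc zero) {t} d = subst (_∣ t) (sym (*-identityʳ p))
    ([ id , id ]′ (euclidsLemma t t pp (m*n∣⇒m∣ p 1 d)))
  ^∣square⇒^∣ {p} pp (suc (suc e)) {t} d
    with [ id , id ]′ (euclidsLemma t t pp (m*n∣⇒m∣ p (p ^ suc e) d))
  ... | divides u refl = subst (p ^ ⌈ 2 + e /2⌉ ∣_) (*-comm p u) (*-monoʳ-∣ p
    (^∣square⇒^∣ pp e (*-cancelˡ-∣ p {{prime⇒nonZero pp}} (*-cancelˡ-∣ p {{prime⇒nonZero pp}}
      (subst (p ^ (2 + e) ∣_) (rearrange u p) d)))))
    where
    rearrange : ∀ u p → (u * p) * (u * p) ≡ p * (p * (u * u))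
    rearrange = solve-∀

  ≤⌈/2⌉+⌈/2⌉ : ∀ e → e ≤ ⌈ e /2⌉ + ⌈ e /2⌉
  ≤⌈/2⌉+⌈/2⌉ e = subst (_≤ ⌈ e /2⌉ + ⌈ e /2⌉) (⌊n/2⌋+⌈n/2⌉≡n e)
    (+-monoˡ-≤ ⌈ e /2⌉ (⌊n/2⌋≤⌈n/2⌉ e))

  ^∣square : ∀ p e {t} → p ^ ⌈ e /2⌉ ∣ t → p ^ e ∣ t * t
  ^∣square p e d = ∣-trans
    (subst (p ^ e ∣_) (^-distribˡ-+-* p ⌈ e /2⌉ ⌈ e /2⌉) (^-mono-∣ p (≤⌈/2⌉+⌈/2⌉ e)))
    (*-pres-∣ d d)
    where
    ^-mono-∣ : ∀ p {a b} → a ≤ b → p ^ a ∣ p ^ b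
    ^-mono-∣ p {a} {b} a≤b = subst (λ c → p ^ a ∣ p ^ c) (m+[n∸m]≡n a≤b)
      (subst (p ^ a ∣_) (sym (^-distribˡ-+-* p a (b ∸ a))) (m∣m*n (p ^ (b ∸ a))))

  -- A copy, accessible by name, of the function local to `n₀`. The two agree by computation once
  -- the exponent is `zero` or a successor.
  twoPart : ℕ → ℕ
  twoPart zero    = 1
  twoPart (suc e) = 2 ^ ⌈ suc e + 1 /2⌉

  n₀-unfold : ∀ n .{{_ : NonZero n}} → n₀ n ≡ twoPart (multiplicity 2 n)
    * product (map (λ p → p ^ ⌈ multiplicity p n /2⌉) (oddPrimeDivisors n))
  n₀-unfold n with multiplicity 2 n
  ... | zero  = refl
  ... | suc _ = refl

  twoPart-pos : ∀ {e} → 0 < e → twoPart e ≡ 2 ^ ⌈ suc e /2⌉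
  twoPart-pos {suc e} _ = cong (λ k → 2 ^ ⌈ k /2⌉) (+-comm (suc e) 1)

  2∣n+n : ∀ n → 2 ∣ n + n
  2∣n+n n = divides n (trans (cong (λ k → n + k) (sym (+-identityʳ n))) (*-comm 2 n))

  2∣n+n*n : ∀ n → 2 ∣ n + n * n
  2∣n+n*n zero    = 2 ∣0
  2∣n+n*n (suc n) = subst (2 ∣_) (rearrange n) (∣m∣n⇒∣m+n (2∣n+n*n n) (2∣n+n (suc n)))
    where
    rearrange : ∀ n → n + n * n + (suc n + suc n) ≡ suc n + suc n * suc n
    rearrange = solve-∀

  2∤⇒2∣1+ : ∀ n → 2 ∤ n → 2 ∣ 1 + n
  2∤⇒2∣1+ zero          2∤n = contradiction (2 ∣0) 2∤n
  2∤⇒2∣1+ (suc zero)    2∤n = ∣-refl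
  2∤⇒2∣1+ (suc (suc n)) 2∤n = ∣m∣n⇒∣m+n ∣-refl (2∤⇒2∣1+ n (2∤n ∘ ∣m∣n⇒∣m+n ∣-refl))

  -- Encodes w = t²/n without division, together with the parity that makes E(s) - w even.
  record Admissible (n t w : ℕ) : Set where
    constructor admissible
    field
      square : n * w ≡ t * t
      parity : 2 ∣ t + w

  module _ (n : ℕ) .{{_ : NonZero n}} where

    private
      fs  = factors (factorise n)
      ps  = oddPrimeDivisors n
      e   = λ p → multiplicity p n
      odd = product (map (λ p → p ^ ⌈ e p /2⌉) ps)
      pfs : All Prime fs
      pfs = PrimeFactorisation.factorsPrime (factorise n)
      n≡  = PrimeFactorisation.isFactorisation (factorise n)

      ^e∣n : ∀ p → p ^ e p ∣ n
      ^e∣n p = subst (p ^ e p ∣_) (sym n≡) (count-∣ p fs)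

      ps-prime : All Prime ps
      ps-prime = All.tabulate λ p∈ → All.lookup pfs
        (∈-deduplicate⁻ _≟_ fs (proj₁ (∈-filter⁻ (λ p → ¬? (p ≟ 2)) p∈)))

      ps-odd : All (2 ≢_) ps
      ps-odd = All.tabulate λ p∈ 2≡p → proj₂ (∈-filter⁻ (λ p → ¬? (p ≟ 2)) {xs = deduplicate _≟_ fs} p∈) (sym 2≡p)

      ps-unique : Unique ps
      ps-unique = Unique.filter⁺ (λ p → ¬? (p ≟ 2)) (deduplicate-! fs)

      0<count⇒∈ : ∀ p l → 0 < count p l → p ∈ₗ l
      0<count⇒∈ p (q ∷ l) 0< with p ≟ q
      ... | yes refl = here refl
      ... | no  p≢q  = there (0<count⇒∈ p l (subst (0 <_) (count-≢ l p≢q) 0<))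

      ^⌈e/2⌉∣odd : ∀ p → p ≢ 2 → p ^ ⌈ e p /2⌉ ∣ odd
      ^⌈e/2⌉∣odd p p≢2 with e p in eq
      ... | zero  = 1∣ odd
      ... | suc k = ∈⇒∣product (subst (λ k → p ^ ⌈ k /2⌉ ∈ₗ map (λ p → p ^ ⌈ e p /2⌉) ps) eq
        (∈-map⁺ (λ p → p ^ ⌈ e p /2⌉) (∈-filter⁺ (λ p → ¬? (p ≟ 2)) (∈-deduplicate⁺ _≟_
          (0<count⇒∈ p fs (subst (0 <_) (sym eq) z<s))) p≢2)))

      ^⌈e/2⌉∣n₀ : ∀ p → p ≢ 2 → p ^ ⌈ e p /2⌉ ∣ n₀ n
      ^⌈e/2⌉∣n₀ p p≢2 = subst (p ^ ⌈ e p /2⌉ ∣_) (sym (n₀-unfold n))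
        (∣n⇒∣m*n (twoPart (e 2)) (^⌈e/2⌉∣odd p p≢2))

      2∣n⇒0<e₂ : 2 ∣ n → 0 < e 2
      2∣n⇒0<e₂ 2∣n = go fs pfs (subst (2 ∣_) n≡ 2∣n)
        where
        go : ∀ l → All Prime l → 2 ∣ product l → 0 < count 2 l
        go [] [] 2∣1 = contradiction (∣1⇒≡1 2∣1) λ ()
        go (q ∷ l) (pq ∷ pl) d with 2 ≟ q
        ... | yes refl = subst (0 <_) (sym (count-≡ 2 l)) z<s
        ... | no 2≢q with euclidsLemma q (product l) prime[2] d
        ... | inj₁ 2∣q = contradiction 2∣q (prime∤prime prime[2] pq 2≢q)
        ... | inj₂ 2∣l = subst (0 <_) (sym (count-≢ l 2≢q)) (go l pl 2∣l)

      twoPart∣n₀ : twoPart (e 2) ∣ n₀ n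
      twoPart∣n₀ = subst (twoPart (e 2) ∣_) (sym (n₀-unfold n)) (m∣m*n odd)

      even-twoPart : 2 ∣ n → 2 ^ ⌈ suc (e 2) /2⌉ ∣ n₀ n
      even-twoPart 2∣n = subst (_∣ n₀ n) (twoPart-pos (2∣n⇒0<e₂ 2∣n)) twoPart∣n₀

      -- For even `n` an admissible t is even, hence so is w, and then t² = n w is divisible by 2n
      -- and not merely by n. This is the origin of the exponent e₀ + 1: it is the exponent of 2 in
      -- 2n.
      2n∣n₀² : 2 ∣ n → 2 * n ∣ n₀ n * n₀ n
      2n∣n₀² 2∣n = subst (λ k → 2 * k ∣ n₀ n * n₀ n) (sym n≡) (product-∣ (prime[2] ∷ pfs) h)
        where
        h : ∀ {p} → Prime p → p ^ count p (2 ∷ fs) ∣ n₀ n * n₀ n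
        h {p} pp with p ≟ 2
        ... | yes refl = subst (λ k → 2 ^ k ∣ n₀ n * n₀ n) (sym (count-≡ 2 fs))
          (^∣square 2 (suc (e 2)) (even-twoPart 2∣n))
        ... | no p≢2 = subst (λ k → p ^ k ∣ n₀ n * n₀ n) (sym (count-≢ fs p≢2))
          (^∣square p (e p) (^⌈e/2⌉∣n₀ p p≢2))

      odd⇒e₂≡0 : 2 ∤ n → e 2 ≡ 0
      odd⇒e₂≡0 2∤n with e 2 | ^e∣n 2
      ... | zero  | _ = refl
      ... | suc k | d = contradiction (m*n∣⇒m∣ 2 (2 ^ k) d) 2∤n

      odd⇒n∣n₀² : 2 ∤ n → n ∣ n₀ n * n₀ n
      odd⇒n∣n₀² 2∤n = subst (_∣ n₀ n * n₀ n) (sym n≡) (product-∣ pfs h)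
        where
        h : ∀ {p} → Prime p → p ^ e p ∣ n₀ n * n₀ n
        h {p} pp with p ≟ 2
        ... | no p≢2 = ^∣square p (e p) (^⌈e/2⌉∣n₀ p p≢2)
        ... | yes refl = subst (λ k → 2 ^ k ∣ n₀ n * n₀ n) (sym (odd⇒e₂≡0 2∤n)) (1∣ (n₀ n * n₀ n))

    n₀-admissible : ∃[ w ] Admissible n (n₀ n) w
    n₀-admissible with 2 ∣? n
    ... | yes 2∣n with 2n∣n₀² 2∣n
    ...   | divides w eq = w * 2 , admissible
      (trans (rearrange n w) (sym eq))
      -- `⌈ suc e /2⌉` computes to `suc ⌊ e /2⌋`, which exposes a factor 2 of n₀.
      (∣m∣n⇒∣m+n (m*n∣⇒m∣ 2 (2 ^ ⌊ e 2 /2⌋) (even-twoPart 2∣n)) (n∣m*n w))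
      where
      rearrange : ∀ n w → n * (w * 2) ≡ w * (2 * n)
      rearrange = solve-∀
    n₀-admissible | no 2∤n with odd⇒n∣n₀² 2∤n
    ... | divides w eq = w , admissible nw≡ parity
      where
      t   = n₀ n
      nw≡ = trans (*-comm n w) (sym eq)
      -- t + w ≡ (t + t²) + (1 + n) w - 2 t², as t² = n w
      parity : 2 ∣ t + w
      parity = ∣m+n∣m⇒∣n
        (subst (2 ∣_) (rearrange t w n)
          (∣m∣n⇒∣m+n (2∣n+n*n t) (∣m⇒∣m*n w (2∤⇒2∣1+ n 2∤n))))
        (subst (λ k → 2 ∣ k + n * w) nw≡ (2∣n+n (n * w)))
        where
        rearrange : ∀ t w n → t + t * t + (1 + n) * w ≡ t * t + n * w + (t + w)
        rearrange = solve-∀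

    -- n₀ is a product of powers of distinct primes, so each can be found in `t` separately. For odd
    -- primes n ∣ t² is enough; the prime 2 also uses the parity of `t + w`.
    admissible⇒n₀∣ : ∀ {t w} → Admissible n t w → n₀ n ∣ t
    admissible⇒n₀∣ {t} {w} (admissible nw≡t² 2∣t+w) = subst (_∣ t) (sym (n₀-unfold n)) n₀∣t
      where
      n∣t² : n ∣ t * t
      n∣t² = divides w (trans (sym nw≡t²) (*-comm n w))

      odd-part : ∀ p → Prime p → p ^ ⌈ e p /2⌉ ∣ t
      odd-part p pp = ^∣square⇒^∣ pp (e p) (∣-trans (^e∣n p) n∣t²)

      odd∣ : All (λ p → p ^ ⌈ e p /2⌉ ∣ t) ps
      odd∣ = All.map (odd-part _) ps-prime

      n₀∣t : twoPart (e 2) * odd ∣ t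
      n₀∣t with e 2 | ^e∣n 2
      ... | zero  | _ = subst (_∣ t) (sym (*-identityˡ odd)) (product-^-∣ (λ p → ⌈ e p /2⌉) ps-unique ps-prime odd∣)
      ... | suc k | d with ^∣square⇒^∣ prime[2] (suc k + 1) {t} 2^∣t²
        where
        2∣n : 2 ∣ n
        2∣n = m*n∣⇒m∣ 2 (2 ^ k) (∣-trans d ∣-refl)

        2∣t : 2 ∣ t
        2∣t = [ id , id ]′ (euclidsLemma t t prime[2] (∣-trans 2∣n n∣t²))

        -- Since `t` is even, so is `w`; in n w = t² this contributes one factor 2 beyond those of
        -- `n`.
        2^∣t² : 2 ^ (suc k + 1) ∣ t * t
        2^∣t² = subst₂ _∣_ (sym (^-distribˡ-+-* 2 (suc k) 1)) nw≡t²
          (*-pres-∣ d (∣m+n∣m⇒∣n 2∣t+w 2∣t))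
      ... | divides u refl = subst (2 ^ ⌈ suc k + 1 /2⌉ * odd ∣_) (*-comm _ u)
        (*-monoʳ-∣ (2 ^ ⌈ suc k + 1 /2⌉) (product-^-∣ (λ p → ⌈ e p /2⌉) ps-unique ps-prime
          (All.zipWith (λ {p} ((2≢p , pp) , d) → ^∣*⇒∣ ⌈ suc k + 1 /2⌉ pp prime[2] (2≢p ∘ sym) ⌈ e p /2⌉
              (subst (p ^ ⌈ e p /2⌉ ∣_) (*-comm u _) d))
            (All.zip (ps-odd , ps-prime) , odd∣))))

    -- Zero divides only zero, so one positive admissible number suffices: t = 2n with w = 4n.
    0<n₀ : 0 < n₀ n
    0<n₀ = n≢0⇒n>0 λ n₀≡0 → 2n≢0 (0∣⇒≡0 (subst (_∣ n * 2) n₀≡0 (admissible⇒n₀∣ 2n-admissible)))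
      where
      2n≢0 : n * 2 ≢ 0
      2n≢0 = ≢-nonZero⁻¹ (n * 2) {{m*n≢0 n 2}}
      2n-admissible : Admissible n (n * 2) (n * 4)
      2n-admissible = admissible (rearrange n) (∣m∣n⇒∣m+n (n∣m*n n) (divides (n * 2) (rearrange′ n)))
        where
        rearrange : ∀ n → n * (n * 4) ≡ n * 2 * (n * 2)
        rearrange = solve-∀
        rearrange′ : ∀ n → n * 4 ≡ n * 2 * 2
        rearrange′ = solve-∀

open NumberTheory public using (Admissible; admissible; n₀-admissible; admissible⇒n₀∣; 0<n₀)

-- Integer vectors, supports, and bounds for E(s)

module IntegerVectors where

  open import Data.Integer.Base hiding (suc; pred; NonZero)
  open import Data.Integer.Properties
  open import Defs using (n₀)
  open ≡ using (refl; sym; trans; module ≡-Reasoning)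
  open ℤSolver using (solve-∀)

  private variable
    n m k : ℕ

  𝟙 : Bool → ℤ
  𝟙 b = if b then 1ℤ else 0ℤ

  card : Vector Bool n → ℕ
  card {zero}  s = 0
  card {suc n} s = (if s zero then suc else id) (card (tail s))

  ∑𝟙≡card : (s : Vector Bool n) → ∑ (𝟙 ∘ s) ≡ + card s
  ∑𝟙≡card {zero}  s = refl
  ∑𝟙≡card {suc n} s with s zero
  ... | true  = cong (λ i → 1ℤ + i) (∑𝟙≡card (tail s))
  ... | false = trans (+-identityˡ _) (∑𝟙≡card (tail s))

  _⊆ᵇ_ : Vector Bool n → Vector Bool n → Set
  a ⊆ᵇ b = ∀ i → a i ≡ true → b i ≡ true

  card-≤ : (a b : Vector Bool n) → a ⊆ᵇ b → card a ℕ.≤ card b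
  card-≤ {zero}  a b a⊆b = z≤n
  card-≤ {suc n} a b a⊆b with a zero | b zero | a⊆b zero
  ... | true  | true  | _ = s≤s (card-≤ (tail a) (tail b) (a⊆b ∘ suc))
  ... | true  | false | p = contradiction (p refl) λ ()
  ... | false | true  | _ = ℕ.m≤n⇒m≤1+n (card-≤ (tail a) (tail b) (a⊆b ∘ suc))
  ... | false | false | _ = card-≤ (tail a) (tail b) (a⊆b ∘ suc)

  -- A greedy choice from the left: a coordinate of `b` outside `a` is left out as long as the
  -- remaining part of `b` can still supply `k` elements.
  interpolate : (a b : Vector Bool n) → a ⊆ᵇ b → card a ℕ.≤ k → k ℕ.≤ card b →
                ∃[ s ] a ⊆ᵇ s × s ⊆ᵇ b × card s ≡ k
  interpolate {zero} a b a⊆b _ z≤n = (λ ()) , (λ ()) , (λ ()) , refl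
  interpolate {suc n} {k} a b a⊆b a≤k k≤b = go (a zero) (b zero) refl refl a≤k k≤b
    where
    a′ = tail a
    b′ = tail b

    cons : ∀ x {j} → (a zero ≡ true → x ≡ true) → (x ≡ true → b zero ≡ true) →
           card a′ ℕ.≤ j → j ℕ.≤ card b′ →
           (if x then suc else id) j ≡ k →
           ∃[ s ] a ⊆ᵇ s × s ⊆ᵇ b × card s ≡ k
    cons x ax xb a≤ ≤b eq with s , a⊆s , s⊆b , ∣s∣ ← interpolate a′ b′ (a⊆b ∘ suc) a≤ ≤b =
      x ∷ᵥ s , (λ { zero → ax ; (suc i) → a⊆s i }) , (λ { zero → xb ; (suc i) → s⊆b i })
      , trans (cong (if x then suc else id) ∣s∣) eq

    go : ∀ x y → a zero ≡ x → b zero ≡ y →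
         (if x then suc else id) (card a′) ℕ.≤ k →
         k ℕ.≤ (if y then suc else id) (card b′) →
         ∃[ s ] a ⊆ᵇ s × s ⊆ᵇ b × card s ≡ k
    go true false a₀ b₀ _ _ = contradiction (trans (sym b₀) (a⊆b zero a₀)) λ ()
    go true true a₀ b₀ (s≤s a≤) (s≤s ≤b) = cons true (λ _ → refl) (λ _ → b₀) a≤ ≤b refl
    go false false a₀ b₀ a≤ ≤b =
      cons false (λ a₁ → trans (sym a₀) a₁) (λ ()) a≤ ≤b refl
    go false true a₀ b₀ a≤ ≤b with card b′ ℕ.<? k
    ... | no b≮k = cons false (λ a₁ → trans (sym a₀) a₁) (λ ()) a≤ (ℕ.≮⇒≥ b≮k) refl
    -- Here k is exactly one more than the size of the rest of `b`, so this coordinate and all of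
    -- that rest are taken.
    ... | yes b<k = cons true (λ _ → refl) (λ _ → b₀) (card-≤ a′ b′ (a⊆b ∘ suc)) ℕ.≤-refl
      (ℕ.≤-antisym b<k ≤b)

  card-∅ : card {n} (const false) ≡ 0
  card-∅ {zero}  = refl
  card-∅ {suc n} = card-∅ {n}

  card-full : card {n} (const true) ≡ n
  card-full {zero}  = refl
  card-full {suc n} = cong suc (card-full {n})

  subset-⊆ : (b : Vector Bool n) → k ℕ.≤ card b → ∃[ s ] s ⊆ᵇ b × card s ≡ k
  subset-⊆ {n} b k≤b =
    let s , _ , s⊆b , ∣s∣ = interpolate (const false) b (λ _ ()) (subst (ℕ._≤ _) (sym (card-∅ {n})) z≤n) k≤b
    in s , s⊆b , ∣s∣

  subset-⊇ : (a : Vector Bool n) → card a ℕ.≤ k → k ℕ.≤ n → ∃[ s ] a ⊆ᵇ s × card s ≡ k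
  subset-⊇ {n} a a≤k k≤n =
    let s , a⊆s , _ , ∣s∣ = interpolate a (const true) (λ _ _ → refl) a≤k (subst (_ ℕ.≤_) (sym (card-full {n})) k≤n)
    in s , a⊆s , ∣s∣

  -- The common shape of all estimates of E(s): a pointwise bound by a linear form in vectors whose
  -- sums are known. Forms in fewer vectors are padded with the zero vector.
  ∑-≥-linear : ∀ α β γ δ (x y z f : Vector ℤ n) {X Y Z} → ∑ x ≡ X → ∑ y ≡ Y → ∑ z ≡ Z →
    (∀ i → α * x i + β * y i + γ * z i + δ ≤ f i) →
    α * X + β * Y + γ * Z + δ * + n ≤ ∑ f
  ∑-≥-linear {zero} α β γ δ x y z f refl refl refl h = ≤-reflexive (vanish α β γ δ)
    where
    vanish : ∀ α β γ δ → α * 0ℤ + β * 0ℤ + γ * 0ℤ + δ * 0ℤ ≡ 0ℤ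
    vanish = solve-∀
  ∑-≥-linear {suc n} α β γ δ x y z f refl refl refl h = subst (_≤ ∑ f)
    (regroup α β γ δ (x zero) (y zero) (z zero) (∑ (tail x)) (∑ (tail y)) (∑ (tail z)) (+ n))
    (+-mono-≤ (h zero) (∑-≥-linear α β γ δ (tail x) (tail y) (tail z) (tail f) refl refl refl (h ∘ suc)))
    where
    regroup : ∀ α β γ δ x₀ y₀ z₀ x y z n →
      α * x₀ + β * y₀ + γ * z₀ + δ + (α * x + β * y + γ * z + δ * n) ≡
      α * (x₀ + x) + β * (y₀ + y) + γ * (z₀ + z) + δ * (1ℤ + n)
    regroup = solve-∀

  ∑-neg : (f : Vector ℤ n) → ∑ (λ i → - f i) ≡ - ∑ f
  ∑-neg {zero}  f = refl
  ∑-neg {suc n} f = trans (cong (λ i → - f zero + i) (∑-neg (tail f))) (sym (neg-distrib-+ (f zero) (∑ (tail f))))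

  ∑-≤-linear : ∀ α β γ δ (x y z f : Vector ℤ n) {X Y Z} → ∑ x ≡ X → ∑ y ≡ Y → ∑ z ≡ Z →
    (∀ i → f i ≤ α * x i + β * y i + γ * z i + δ) →
    ∑ f ≤ α * X + β * Y + γ * Z + δ * + n
  ∑-≤-linear {n} α β γ δ x y z f {X} {Y} {Z} ∑x ∑y ∑z h = neg-cancel-≤ (subst₂ _≤_
    (negate α β γ δ X Y Z (+ n)) (∑-neg f)
    (∑-≥-linear (- α) (- β) (- γ) (- δ) x y z (λ i → - f i) ∑x ∑y ∑z
      λ i → subst (_≤ - f i) (sym (negate₁ α β γ δ (x i) (y i) (z i))) (neg-mono-≤ (h i))))
    where
    negate : ∀ α β γ δ x y z n → - α * x + - β * y + - γ * z + - δ * n ≡ - (α * x + β * y + γ * z + δ * n)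
    negate = solve-∀
    negate₁ : ∀ α β γ δ x y z → - α * x + - β * y + - γ * z + - δ ≡ - (α * x + β * y + γ * z + δ)
    negate₁ = solve-∀

  ∑-zeros : ∑ {n} (const 0ℤ) ≡ 0ℤ
  ∑-zeros {zero}  = refl
  ∑-zeros {suc n} = trans (+-identityˡ _) (∑-zeros {n})

  sqDist : Vector ℤ n → Vector Bool n → ℤ
  sqDist y s = ∑ λ i → (y i - 𝟙 (s i)) * (y i - 𝟙 (s i))

  -- Linear arithmetic by certificates: an inequality holds because the difference of its sides
  -- equals, by the ring solver, a combination built with `⊕` and `⊛` from nonnegative terms. A
  -- contradiction is such a combination that evaluates to a negative literal, see `absurd`.
  by-difference : ∀ {a b c} → 0ℤ ≤ c → b - a ≡ c → a ≤ b
  by-difference 0≤c eq = 0≤i-j⇒j≤i (subst (0ℤ ≤_) (sym eq) 0≤c)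

  0≤* : ∀ {a b} → 0ℤ ≤ a → 0ℤ ≤ b → 0ℤ ≤ a * b
  0≤* (+≤+ {n = a} _) (+≤+ {n = b} _) = subst (0ℤ ≤_) (pos-* a b) (+≤+ z≤n)

  infixl 6 _⊕_
  _⊕_ : ∀ {a b} → 0ℤ ≤ a → 0ℤ ≤ b → 0ℤ ≤ a + b
  _⊕_ = +-mono-≤

  infixr 7 _⊛_
  _⊛_ : ∀ k {a} → 0ℤ ≤ a → 0ℤ ≤ + k * a
  k ⊛ 0≤a = 0≤* {+ k} (+≤+ z≤n) 0≤a

  gap : ∀ {a b} → a ≤ b → 0ℤ ≤ b - a
  gap = i≤j⇒0≤j-i

  absurd : ∀ {a k} → 0ℤ ≤ a → a ≡ -[1+ k ] → ⊥
  absurd 0≤a refl with () ← 0≤a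

  0≤u²+u : ∀ u → 0ℤ ≤ u * u + u
  0≤u²+u (+ u)    = 0≤* {+ u} {+ u} (+≤+ z≤n) (+≤+ z≤n) ⊕ +≤+ z≤n
  0≤u²+u -[1+ u ] = subst (0ℤ ≤_) (rearrange (+ u)) (0≤* {1ℤ + + u} {+ u} (+≤+ z≤n) (+≤+ z≤n))
    where
    rearrange : ∀ u → (1ℤ + u) * u ≡ (- (1ℤ + u)) * (- (1ℤ + u)) + - (1ℤ + u)
    rearrange = solve-∀

  does-true : ∀ {P : Set} (P? : Dec P) → does P? ≡ true → P
  does-true {P} P? eq = invert (subst (Reflects P) eq (proof P?))

  does-false : ∀ {P : Set} (P? : Dec P) → does P? ≡ false → ¬ P
  does-false {P} P? eq = invert (subst (Reflects P) eq (proof P?))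

  -- In each case below the difference of the two sides is, up to nonnegative linear terms, a
  -- product of two consecutive integers.
  cover-pointwise : ∀ y s z → (z ≡ true → s ≡ true) → (z ≡ true → y ≤ 0ℤ) → (z ≡ false → 1ℤ ≤ y) →
    - + 3 * y + - + 1 * 𝟙 s + - + 2 * 𝟙 z + + 4 ≤ (y - 𝟙 s) * (y - 𝟙 s)
  cover-pointwise y false true  z⇒s _ _ = contradiction (z⇒s refl) λ ()
  cover-pointwise y true  true  _ _ _ = by-difference (0≤u²+u y) (eq y)
    where
    eq : ∀ y → (y - 1ℤ) * (y - 1ℤ) - (- + 3 * y + - + 1 * 1ℤ + - + 2 * 1ℤ + + 4) ≡ y * y + y
    eq = solve-∀
  cover-pointwise y true  false _ _ 1≤ = by-difference (0≤u²+u (y - 1ℤ) ⊕ 2 ⊛ gap (1≤ refl)) (eq y)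
    where
    eq : ∀ y → (y - 1ℤ) * (y - 1ℤ) - (- + 3 * y + - + 1 * 1ℤ + - + 2 * 0ℤ + + 4)
         ≡ (y - 1ℤ) * (y - 1ℤ) + (y - 1ℤ) + + 2 * (y - 1ℤ)
    eq = solve-∀
  cover-pointwise y false false _ _ 1≤ = by-difference (0≤u²+u (y - 1ℤ) ⊕ 4 ⊛ gap (1≤ refl)) (eq y)
    where
    eq : ∀ y → (y - 0ℤ) * (y - 0ℤ) - (- + 3 * y + - + 1 * 0ℤ + - + 2 * 0ℤ + + 4)
         ≡ (y - 1ℤ) * (y - 1ℤ) + (y - 1ℤ) + + 4 * (y - 1ℤ)
    eq = solve-∀

  -- With Σ y = m - t and m ones in `s`, the form sums to 2 m + t, which exceeds w + 2 m as soon as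
  -- w < t.
  neg-pointwise : ∀ y s → (s ≡ true → y ≤ - 1ℤ) →
    - + 1 * y + + 3 * 𝟙 s + 0ℤ * 0ℤ + 0ℤ ≤ (y - 𝟙 s) * (y - 𝟙 s)
  neg-pointwise y false _ = by-difference (0≤u²+u y) (eq y)
    where
    eq : ∀ y → (y - 0ℤ) * (y - 0ℤ) - (- + 1 * y + + 3 * 0ℤ + 0ℤ * 0ℤ + 0ℤ) ≡ y * y + y
    eq = solve-∀
  neg-pointwise y true y≤ = by-difference (0≤u²+u (- 1ℤ - y) ⊕ 2 ⊛ gap (y≤ refl)) (eq y)
    where
    eq : ∀ y → (y - 1ℤ) * (y - 1ℤ) - (- + 1 * y + + 3 * 1ℤ + 0ℤ * 0ℤ + 0ℤ)
         ≡ (- 1ℤ - y) * (- 1ℤ - y) + (- 1ℤ - y) + + 2 * (- 1ℤ - y)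
    eq = solve-∀

  -- The source of the constants 3 and 4: the form sums to 3 t - 2 m, and comparison with w + 2 m
  -- gives 3 t ≤ 4 m + w. It is exact when y takes the values 0 and -1 on `s` and vanishes off `s`,
  -- as it may for the vectors used in the converse.
  split-pointwise : ∀ y s → (s ≡ true → y ≤ 0ℤ) → (s ≡ false → 0ℤ ≤ y) →
    - + 3 * y + + 1 * 𝟙 s + 0ℤ * 0ℤ + 0ℤ ≤ (y - 𝟙 s) * (y - 𝟙 s)
  split-pointwise y true y≤ _ = by-difference (0≤u²+u y) (eq y)
    where
    eq : ∀ y → (y - 1ℤ) * (y - 1ℤ) - (- + 3 * y + + 1 * 1ℤ + 0ℤ * 0ℤ + 0ℤ) ≡ y * y + y
    eq = solve-∀
  split-pointwise y false _ ≤y = by-difference (0≤u²+u y ⊕ 2 ⊛ ≤y refl) (eq y)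
    where
    eq : ∀ y → (y - 0ℤ) * (y - 0ℤ) - (- + 3 * y + + 1 * 0ℤ + 0ℤ * 0ℤ + 0ℤ) ≡ y * y + y + + 2 * y
    eq = solve-∀

  nonpos-pointwise : ∀ y s → (s ≡ true → y ≤ 0ℤ) →
    + 1 * (y * y) + + 1 * 𝟙 s + 0ℤ * 0ℤ + 0ℤ ≤ (y - 𝟙 s) * (y - 𝟙 s)
  nonpos-pointwise y true y≤ = by-difference (2 ⊛ gap (y≤ refl)) (eq y)
    where
    eq : ∀ y → (y - 1ℤ) * (y - 1ℤ) - (+ 1 * (y * y) + + 1 * 1ℤ + 0ℤ * 0ℤ + 0ℤ) ≡ + 2 * (0ℤ - y)
    eq = solve-∀
  nonpos-pointwise y false _ = ≤-reflexive (eq y)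
    where
    eq : ∀ y → + 1 * (y * y) + + 1 * 0ℤ + 0ℤ * 0ℤ + 0ℤ ≡ (y - 0ℤ) * (y - 0ℤ)
    eq = solve-∀

  ⊇pos-pointwise : ∀ y s → (s ≡ false → y ≤ 0ℤ) →
    (y - 𝟙 s) * (y - 𝟙 s) ≤ + 1 * (y * y) + - + 2 * y + + 1 * 𝟙 s + 0ℤ
  ⊇pos-pointwise y true  _  = ≤-reflexive (eq y)
    where
    eq : ∀ y → (y - 1ℤ) * (y - 1ℤ) ≡ + 1 * (y * y) + - + 2 * y + + 1 * 1ℤ + 0ℤ
    eq = solve-∀
  ⊇pos-pointwise y false y≤ = by-difference (2 ⊛ gap (y≤ refl)) (eq y)
    where
    eq : ∀ y → + 1 * (y * y) + - + 2 * y + + 1 * 0ℤ + 0ℤ - (y - 0ℤ) * (y - 0ℤ) ≡ + 2 * (0ℤ - y)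
    eq = solve-∀

  ⊆pos-pointwise : ∀ y s → (s ≡ true → 1ℤ ≤ y) →
    (y - 𝟙 s) * (y - 𝟙 s) ≤ + 1 * (y * y) + - + 1 * 𝟙 s + 0ℤ * 0ℤ + 0ℤ
  ⊆pos-pointwise y false _ = ≤-reflexive (eq y)
    where
    eq : ∀ y → (y - 0ℤ) * (y - 0ℤ) ≡ + 1 * (y * y) + - + 1 * 0ℤ + 0ℤ * 0ℤ + 0ℤ
    eq = solve-∀
  ⊆pos-pointwise y true 1≤ = by-difference (2 ⊛ gap (1≤ refl)) (eq y)
    where
    eq : ∀ y → + 1 * (y * y) + - + 1 * 1ℤ + 0ℤ * 0ℤ + 0ℤ - (y - 1ℤ) * (y - 1ℤ) ≡ + 2 * (y - 1ℤ)
    eq = solve-∀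

  not-true : ∀ {a b} → (a ≡ true → b ≡ true) → b ≡ false → a ≡ false
  not-true {false} _ _ = refl
  not-true {true}  f b≡false = contradiction (trans (sym (f refl)) b≡false) λ ()

  -- Consequences of 2 ≤ E(s) - w ≤ 2 m holding for all supports

  module _ {n m : ℕ} (y : Vector ℤ n) (t w : ℕ) (2m≤n : 2 ℕ.* m ℕ.≤ n) (w≤t : w ℕ.≤ t)
    (∑y : ∑ y ≡ + m - + t)
    (far  : ∀ s → card s ≡ m → + w + + 2 ≤ sqDist y s)
    (near : ∀ s → card s ≡ m → sqDist y s ≤ + w + + 2 * + m)
    where

    private
      isNonpos isNeg isPos : Vector Bool n
      isNonpos i = does (y i ≤? 0ℤ)
      isNeg i = does (y i <? 0ℤ)
      isPos i = does (1ℤ ≤? y i)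

      m≤n : m ℕ.≤ n
      m≤n = ℕ.≤-trans (ℕ.m≤m+n m (m ℕ.+ 0)) 2m≤n

      2m≤n′ : + 2 * + m ≤ + n
      2m≤n′ = subst (_≤ + n) (pos-* 2 m) (+≤+ 2m≤n)

      ∑𝟙≡m : (s : Vector Bool n) → card s ≡ m → ∑ (𝟙 ∘ s) ≡ + m
      ∑𝟙≡m s ∣s∣ = trans (∑𝟙≡card s) (cong +_ ∣s∣)

      zeros : Vector ℤ n
      zeros = const 0ℤ

      <m⇒ : ∀ {c} → c ℕ.< m → + c ≤ + m - 1ℤ
      <m⇒ {c} c<m = by-difference (gap (+≤+ c<m)) (eq (+ c) (+ m))
        where
        eq : ∀ c m → m - 1ℤ - c ≡ m - (1ℤ + c)
        eq = solve-∀

    -- Otherwise a support containing every nonpositive coordinate exists, and the many coordinates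
    -- y ≥ 1 outside it make E(s) too large. How many there are is controlled by n ≥ 2 m.
    card-nonpos≥m : m ℕ.≤ card isNonpos
    card-nonpos≥m with m ℕ.≤? card isNonpos
    ... | yes m≤ = m≤
    ... | no m≰ with s , z⊆s , ∣s∣ ← subset-⊇ isNonpos (ℕ.<⇒≤ (ℕ.≰⇒> m≰)) m≤n =
      -- With c nonpositive coordinates the bound reads 4 n + 3 t ≤ w + 6 m + 2 c. Using c ≤ m - 1
      -- and 2 m ≤ n it becomes 3 t + 2 ≤ w, against w ≤ t.
      ⊥-elim (absurd (gap (≤-trans lower (near s ∣s∣)) ⊕ 4 ⊛ gap 2m≤n′ ⊕ 2 ⊛ gap (<m⇒ (ℕ.≰⇒> m≰))
                     ⊕ gap (+≤+ w≤t) ⊕ 2 ⊛ +≤+ {n = t} z≤n)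
        (eq (+ n) (+ m) (+ t) (+ w) (+ card isNonpos)))
      where
      lower : - + 3 * (+ m - + t) + - + 1 * + m + - + 2 * + card isNonpos + + 4 * + n ≤ sqDist y s
      lower = ∑-≥-linear (- + 3) (- + 1) (- + 2) (+ 4) y (𝟙 ∘ s) (𝟙 ∘ isNonpos) _
        ∑y (∑𝟙≡m s ∣s∣) (∑𝟙≡card isNonpos) λ i →
          cover-pointwise (y i) (s i) (isNonpos i) (z⊆s i)
            (does-true (y i ≤? 0ℤ)) (λ e → i<j⇒suc[i]≤j (≰⇒> (does-false (y i ≤? 0ℤ) e)))
      eq : ∀ n m t w c →
        (w + + 2 * m) - (- + 3 * (m - t) + - + 1 * m + - + 2 * c + + 4 * n)
        + + 4 * (n - + 2 * m) + + 2 * (m - 1ℤ - c) + (t - w) + + 2 * t ≡ - + 2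
      eq = solve-∀

    private
      neg⊆nonpos : isNeg ⊆ᵇ isNonpos
      neg⊆nonpos i e = dec-true (y i ≤? 0ℤ) (<⇒≤ (does-true (y i <? 0ℤ) e))

      Q : ℤ
      Q = ∑ λ i → y i * y i

      -- A support inside the nonpositive coordinates is far away: each of its m ones adds at least
      -- 1 to y².
      Q-upper : Q + + m ≤ + w + + 2 * + m
      Q-upper with s , s⊆ , ∣s∣ ← subset-⊆ isNonpos card-nonpos≥m =
        subst (_≤ _) (eq Q (+ m) (+ n)) (≤-trans
          (∑-≥-linear (+ 1) (+ 1) 0ℤ 0ℤ (λ i → y i * y i) (𝟙 ∘ s) zeros _ refl (∑𝟙≡m s ∣s∣) (∑-zeros {n})
            λ i → nonpos-pointwise (y i) (s i) (does-true (y i ≤? 0ℤ) ∘ s⊆ i))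
          (near s ∣s∣))
        where
        eq : ∀ Q m n → + 1 * Q + + 1 * m + 0ℤ * 0ℤ + 0ℤ * n ≡ Q + m
        eq = solve-∀

      -- A support comparable with the set of positive coordinates is near: since Σ y = m when t =
      -- 0, its E(s) is at most Q - m, whether it contains that set or is contained in it.
      Q-lower : t ≡ 0 → + w + + 2 ≤ Q - + m
      Q-lower refl with card isPos ℕ.≤? m
      ... | yes ≤m with s , ⊆s , ∣s∣ ← subset-⊇ isPos ≤m m≤n =
        subst (_ ≤_) (eq Q (+ m) (+ n)) (≤-trans (far s ∣s∣)
          (∑-≤-linear (+ 1) (- + 2) (+ 1) 0ℤ (λ i → y i * y i) y (𝟙 ∘ s) _ refl ∑y (∑𝟙≡m s ∣s∣)
            λ i → ⊇pos-pointwise (y i) (s i) λ e → ≮⇒≥ λ 0<y →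
              does-false (1ℤ ≤? y i) (not-true (⊆s i) e) (i<j⇒suc[i]≤j 0<y)))
        where
        eq : ∀ Q m n → + 1 * Q + - + 2 * (m - 0ℤ) + + 1 * m + 0ℤ * n ≡ Q - m
        eq = solve-∀
      ... | no ≰m with s , s⊆ , ∣s∣ ← subset-⊆ isPos (ℕ.<⇒≤ (ℕ.≰⇒> ≰m)) =
        subst (_ ≤_) (eq Q (+ m) (+ n)) (≤-trans (far s ∣s∣)
          (∑-≤-linear (+ 1) (- + 1) 0ℤ 0ℤ (λ i → y i * y i) (𝟙 ∘ s) zeros _ refl (∑𝟙≡m s ∣s∣) (∑-zeros {n})
            λ i → ⊆pos-pointwise (y i) (s i) (does-true (1ℤ ≤? y i) ∘ s⊆ i)))
        where
        eq : ∀ Q m n → + 1 * Q + - + 1 * m + 0ℤ * 0ℤ + 0ℤ * n ≡ Q - m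
        eq = solve-∀

    -- For t = 0 the bounds Q ≤ w + m and Q ≥ w + m + 2 collide. This case has to be excluded
    -- because n₀ ∣ t gives n₀ ≤ t only for nonzero t.
    t≢0 : t ≢ 0
    t≢0 t≡0 = absurd (gap Q-upper ⊕ gap (Q-lower t≡0)) (eq Q (+ m) (+ w))
      where
      eq : ∀ Q m w → (w + + 2 * m) - (Q + m) + ((Q - m) - (w + + 2)) ≡ - + 2
      eq = solve-∀

    -- The counterpart of `card-nonpos≥m`: together they leave room for a support between the
    -- negative and the nonpositive coordinates.
    card-neg<m : w ℕ.< t → card isNeg ℕ.< m
    card-neg<m w<t with card isNeg ℕ.<? m
    ... | yes <m = <m
    ... | no ≮m with s , s⊆ , ∣s∣ ← subset-⊆ isNeg (ℕ.≮⇒≥ ≮m) =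
      ⊥-elim (absurd (gap (≤-trans lower (near s ∣s∣)) ⊕ gap (+≤+ w<t)) (eq (+ m) (+ n) (+ t) (+ w)))
      where
      lower : - + 1 * (+ m - + t) + + 3 * + m + 0ℤ * 0ℤ + 0ℤ * + n ≤ sqDist y s
      lower = ∑-≥-linear (- + 1) (+ 3) 0ℤ 0ℤ y (𝟙 ∘ s) zeros _ ∑y (∑𝟙≡m s ∣s∣) (∑-zeros {n}) λ i →
        neg-pointwise (y i) (s i) (i<j⇒i≤pred[j] ∘ does-true (y i <? 0ℤ) ∘ s⊆ i)
      eq : ∀ m n t w → (w + + 2 * m) - (- + 1 * (m - t) + + 3 * m + 0ℤ * 0ℤ + 0ℤ * n) + (t - (1ℤ + w)) ≡ - + 1
      eq = solve-∀

    3t≤4m+w : w ℕ.< t → + 3 * + t ≤ + 4 * + m + + w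
    3t≤4m+w w<t with s , ⊆s , s⊆ , ∣s∣ ← interpolate isNeg isNonpos neg⊆nonpos
                       (ℕ.<⇒≤ (card-neg<m w<t)) card-nonpos≥m =
      by-difference (gap (≤-trans lower (near s ∣s∣))) (eq (+ m) (+ n) (+ t) (+ w))
      where
      lower : - + 3 * (+ m - + t) + + 1 * + m + 0ℤ * 0ℤ + 0ℤ * + n ≤ sqDist y s
      lower = ∑-≥-linear (- + 3) (+ 1) 0ℤ 0ℤ y (𝟙 ∘ s) zeros _ ∑y (∑𝟙≡m s ∣s∣) (∑-zeros {n}) λ i →
        split-pointwise (y i) (s i) (does-true (y i ≤? 0ℤ) ∘ s⊆ i)
          (λ e → ≮⇒≥ (does-false (y i <? 0ℤ) (not-true (⊆s i) e)))
      eq : ∀ m n t w → + 4 * m + w - + 3 * t ≡ (w + + 2 * m) - (- + 3 * (m - t) + + 1 * m + 0ℤ * 0ℤ + 0ℤ * n)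
      eq = solve-∀

  ∑-minus : (y z : Vector ℤ n) → ∑ (λ i → y i - z i) ≡ ∑ y - ∑ z
  ∑-minus {zero}  y z = refl
  ∑-minus {suc n} y z = trans (cong (λ w → y zero - z zero + w) (∑-minus (tail y) (tail z)))
    (regroup (y zero) (z zero) (∑ (tail y)) (∑ (tail z)))
    where
    regroup : ∀ y z Y Z → y - z + (Y - Z) ≡ y + Y - (z + Z)
    regroup = solve-∀

  ∑-const-+ : ∀ {n} q (y : Vector ℤ n) → ∑ (λ i → q + y i) ≡ q * + n + ∑ y
  ∑-const-+ {zero}  q y = sym (trans (+-identityʳ _) (*-zeroʳ q))
  ∑-const-+ {suc n} q y = trans (cong (λ z → q + y zero + z) (∑-const-+ q (tail y)))
    (regroup q (y zero) (+ n) (∑ (tail y)))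
    where
    regroup : ∀ q y₀ n Y → q + y₀ + (q * n + Y) ≡ q * (1ℤ + n) + (y₀ + Y)
    regroup = solve-∀

  card-add : (s : Vector Bool n) (i : Fin n) → card (updateAt s i (const true)) ℕ.≤ suc (card s)
  card-add {suc n} s zero with s zero
  ... | true  = ℕ.n≤1+n _
  ... | false = ℕ.≤-refl
  card-add {suc n} s (suc i) with s zero
  ... | true  = s≤s (card-add (tail s) i)
  ... | false = card-add (tail s) i

  add-⊇ : (s : Vector Bool n) (i j : Fin n) → s j ≡ true → updateAt s i (const true) j ≡ true
  add-⊇ s zero    zero    sⱼ = refl
  add-⊇ s zero    (suc j) sⱼ = sⱼ
  add-⊇ s (suc i) zero    sⱼ = sⱼ
  add-⊇ s (suc i) (suc j) sⱼ = add-⊇ (tail s) i j sⱼ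

  even-u²+u : ∀ u → ∃[ h ] u * u + u ≡ + 2 * h
  even-u²+u (+ zero)     = 0ℤ , refl
  even-u²+u (+ suc u)    = let h , eq = even-u²+u (+ u) in h + (1ℤ + + u) ,
    trans (expand (+ u)) (trans (cong (_+ + 2 * (1ℤ + + u)) eq) (sym (*-distribˡ-+ (+ 2) h (1ℤ + + u))))
    where
    expand : ∀ u → (1ℤ + u) * (1ℤ + u) + (1ℤ + u) ≡ u * u + u + + 2 * (1ℤ + u)
    expand = solve-∀
  even-u²+u -[1+ zero ]  = 0ℤ , refl
  even-u²+u -[1+ suc u ] = let h , eq = even-u²+u -[1+ u ] in h + (1ℤ + + u) ,
    trans (expand (+ u)) (trans (cong (_+ + 2 * (1ℤ + + u)) eq) (sym (*-distribˡ-+ (+ 2) h (1ℤ + + u))))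
    where
    expand : ∀ u → - (1ℤ + (1ℤ + u)) * - (1ℤ + (1ℤ + u)) + - (1ℤ + (1ℤ + u))
                 ≡ - (1ℤ + u) * - (1ℤ + u) + - (1ℤ + u) + + 2 * (1ℤ + u)
    expand = solve-∀

  -- Each u² + u is even for u = yᵢ - sᵢ, so E(s) and Σ y - card s have the same parity.
  sqDist-parity : (y : Vector ℤ n) (s : Vector Bool n) →
                  ∃[ h ] sqDist y s + (∑ y - + card s) ≡ + 2 * h
  sqDist-parity {zero}  y s = 0ℤ , refl
  sqDist-parity {suc n} y s =
    let h , eq = even-u²+u (y zero - 𝟙 (s zero))
        H , Eq = sqDist-parity (tail y) (tail s)
        u      = y zero - 𝟙 (s zero)
    in h + H , (begin
      u * u + sqDist (tail y) (tail s) + (∑ y - + card s)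
        ≡⟨ cong (λ c → u * u + sqDist (tail y) (tail s) + (∑ y - c)) (∑𝟙≡card s) ⟨
      u * u + sqDist (tail y) (tail s) + (∑ y - ∑ (𝟙 ∘ s))
        ≡⟨ regroup (y zero) (𝟙 (s zero)) (sqDist (tail y) (tail s)) (∑ (tail y)) (∑ (𝟙 ∘ tail s)) ⟩
      (u * u + u) + (sqDist (tail y) (tail s) + (∑ (tail y) - ∑ (𝟙 ∘ tail s)))
        ≡⟨ cong (λ c → (u * u + u) + (sqDist (tail y) (tail s) + (∑ (tail y) - c))) (∑𝟙≡card (tail s)) ⟩
      (u * u + u) + (sqDist (tail y) (tail s) + (∑ (tail y) - + card (tail s)))
        ≡⟨ cong₂ _+_ eq Eq ⟩
      + 2 * h + + 2 * H
        ≡⟨ *-distribˡ-+ (+ 2) h H ⟨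
      + 2 * (h + H) ∎)
    where
    open ≡-Reasoning
    regroup : ∀ y₀ s₀ E Y S →
      (y₀ - s₀) * (y₀ - s₀) + E + (y₀ + Y - (s₀ + S)) ≡
      ((y₀ - s₀) * (y₀ - s₀) + (y₀ - s₀)) + (E + (Y - S))
    regroup = solve-∀

  -- From u² ≥ - u for integers. When Σ y = m - t and card s = m the bound is t, which exceeds w in
  -- the cases of interest.
  sqDist-lower : (y : Vector ℤ n) (s : Vector Bool n) → + card s - ∑ y ≤ sqDist y s
  sqDist-lower {n} y s = subst (_≤ sqDist y s) (simplify (∑ y) (+ card s) (+ n))
    (∑-≥-linear (- + 1) (+ 1) 0ℤ 0ℤ y (𝟙 ∘ s) (const 0ℤ) _ refl (∑𝟙≡card s) (∑-zeros {n})
      λ i → by-difference (0≤u²+u (y i - 𝟙 (s i))) (pointwise (y i) (𝟙 (s i))))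
    where
    simplify : ∀ Y S n → - + 1 * Y + + 1 * S + 0ℤ * 0ℤ + 0ℤ * n ≡ S - Y
    simplify = solve-∀
    pointwise : ∀ y s → (y - s) * (y - s) - (- + 1 * y + + 1 * s + 0ℤ * 0ℤ + 0ℤ)
                ≡ (y - s) * (y - s) + (y - s)
    pointwise = solve-∀

  ∣-of-ℤ : ∀ {a g} → + a ≡ + 2 * g → 2 ℕ.∣ a
  ∣-of-ℤ {a} {g} eq = ℕ.divides ∣ g ∣ (trans (cong ∣_∣ eq) (trans (abs-* (+ 2) g) (ℕ.*-comm 2 ∣ g ∣)))

  -- Necessity for integral data with 0 ≤ t < n

  module _ .{{_ : NonZero n}} (1≤m : 1 ℕ.≤ m) (2m≤n : 2 ℕ.* m ℕ.≤ n)
    (y : Vector ℤ n) (t : ℕ) (t<n : t ℕ.< n) (∑y : ∑ y ≡ + m - + t)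
    (H : ∀ s → card s ≡ m → ∃[ k ] 1 ℕ.≤ k × k ℕ.≤ m ×
         + n * (sqDist y s - + 2 * + k) ≡ + t * + t)
    where

    private
      instance
        +n-pos : Positive (+ n)
        +n-pos = positive (+<+ (ℕ.>-nonZero⁻¹ n))

      s₀ : ∃[ s ] s ⊆ᵇ const true × card s ≡ m
      s₀ = subset-⊆ {n} (const true) (subst (m ℕ.≤_) (sym (card-full {n}))
        (ℕ.≤-trans (ℕ.m≤m+n m (m ℕ.+ 0)) 2m≤n))

      0≤v : ∀ v → + n * v ≡ + t * + t → 0ℤ ≤ v
      0≤v v eq = *-cancelˡ-≤-pos 0ℤ v (+ n)
        (subst₂ _≤_ (sym (*-zeroʳ (+ n))) (sym eq) (0≤* {+ t} {+ t} (+≤+ z≤n) (+≤+ z≤n)))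

      -- n times E(s) - 2 k is t² for every support, so E(s) - 2 k is one and the same nonnegative
      -- integer w. Its parity follows from `sqDist-parity` at a single support.
      quotient : ∃[ w ] Admissible n t w ×
                 (∀ s → card s ≡ m → ∃[ k ] 1 ℕ.≤ k × k ℕ.≤ m × sqDist y s ≡ + w + + 2 * + k)
      quotient with s , _ , ∣s∣ ← s₀ with k , _ , _ , eq ← H s ∣s∣ =
        w , admissible n*w≡ (∣-of-ℤ {t ℕ.+ w} {g} g≡) , λ s′ ∣s′∣ →
        let k′ , 1≤ , ≤m , eq′ = H s′ ∣s′∣ in k′ , 1≤ , ≤m ,
          trans (add-back (sqDist y s′) (+ 2 * + k′))
                (cong (_+ + 2 * + k′) (*-cancelˡ-≡ (+ n) _ (+ w) (trans eq′ (sym eqw))))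
        where
        add-back : ∀ a b → a ≡ a - b + b
        add-back = solve-∀
        w = ∣ sqDist y s - + 2 * + k ∣
        v≡ : sqDist y s - + 2 * + k ≡ + w
        v≡ = sym (0≤i⇒+∣i∣≡i (0≤v _ eq))
        eqw : + n * + w ≡ + t * + t
        eqw = trans (cong (+ n *_) (sym v≡)) eq
        n*w≡ : n ℕ.* w ≡ t ℕ.* t
        n*w≡ = +-injective (trans (pos-* n w) (trans eqw (sym (pos-* t t))))
        h = proj₁ (sqDist-parity y s)
        g = h - + k + + t
        regroup : ∀ m t E k → E + (m - t - m) + + 2 * (- k + t) ≡ t + (E - + 2 * k)
        regroup = solve-∀
        g≡ : + (t ℕ.+ w) ≡ + 2 * g
        g≡ = begin
          + t + + w ≡⟨ cong (λ v → + t + v) v≡ ⟨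
          + t + (sqDist y s - + 2 * + k) ≡⟨ regroup (+ m) (+ t) (sqDist y s) (+ k) ⟨
          sqDist y s + (+ m - + t - + m) + + 2 * (- + k + + t)
            ≡⟨ cong₂ (λ a b → sqDist y s + (a - + b) + + 2 * (- + k + + t)) (sym ∑y) (sym ∣s∣) ⟩
          sqDist y s + (∑ y - + card s) + + 2 * (- + k + + t)
            ≡⟨ cong (_+ + 2 * (- + k + + t)) (proj₂ (sqDist-parity y s)) ⟩
          + 2 * h + + 2 * (- + k + + t) ≡⟨ *-distribˡ-+ (+ 2) h (- + k + + t) ⟨
          + 2 * (h + (- + k + + t)) ≡⟨ cong (+ 2 *_) (+-assoc h (- + k) (+ t)) ⟨
          + 2 * g ∎
          where open ≡-Reasoning

    n₀<n×3n₀≤4m+w₀ : n₀ n ℕ.< n ×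
      (∀ {w₀} → Admissible n (n₀ n) w₀ → 3 ℕ.* n₀ n ℕ.≤ 4 ℕ.* m ℕ.+ w₀)
    n₀<n×3n₀≤4m+w₀ with w , adm@(admissible nw≡t² _) , bounds ← quotient =
      ℕ.≤-<-trans n₀≤t t<n , λ {w₀} (admissible nw₀≡n₀² _) → drop‿+≤+
        (subst₂ _≤_ (sym (pos-* 3 (n₀ n))) (cong (_+ + w₀) (sym (pos-* 4 m)))
          (*-cancelˡ-≤-pos _ _ (+ n) (by-difference
            -- Monotonicity of 3 t - t²/n without division: n times the difference of its values at
            -- t and r = n₀ is (t - r)(3 n - t - r), and the last factor is (n - t) + (n - r) + n.
            (n ⊛ gap (3t≤4m+w y t w 2m≤n w≤t ∑y far near w<t)
              ⊕ 0≤* (gap (+≤+ n₀≤t)) (gap (+≤+ (ℕ.<⇒≤ t<n)) ⊕ gap (+≤+ (ℕ.<⇒≤ n₀<n)) ⊕ +≤+ {n = n} z≤n))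
            (eq (+ n) (+ m) (+ t) (+ n₀ n) (ℤ² w t nw≡t²) (ℤ² w₀ (n₀ n) nw₀≡n₀²)))))
      where
      t² = t ℕ.* t
      w≤t : w ℕ.≤ t
      w≤t = ℕ.*-cancelˡ-≤ n (subst (ℕ._≤ n ℕ.* t) (sym nw≡t²) (ℕ.*-monoˡ-≤ t (ℕ.<⇒≤ t<n)))

      far : ∀ s → card s ≡ m → + w + + 2 ≤ sqDist y s
      far s ∣s∣ with k , 1≤k , _ , eq ← bounds s ∣s∣ =
        subst (+ w + + 2 ≤_) (sym eq) (+-monoʳ-≤ (+ w) (*-monoˡ-≤-nonNeg (+ 2) (+≤+ 1≤k)))

      near : ∀ s → card s ≡ m → sqDist y s ≤ + w + + 2 * + m
      near s ∣s∣ with k , _ , k≤m , eq ← bounds s ∣s∣ =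
        subst (_≤ _) (sym eq) (+-monoʳ-≤ (+ w) (*-monoˡ-≤-nonNeg (+ 2) (+≤+ k≤m)))

      instance
        t-nonZero : NonZero t
        t-nonZero = ℕ.≢-nonZero (t≢0 y t w 2m≤n w≤t ∑y far near)

      -- The strict bound n w = t² < n t needs t nonzero; `t≢0` was obtained from the weak bound
      -- alone.
      w<t : w ℕ.< t
      w<t = ℕ.*-cancelˡ-< n w t (subst (ℕ._< n ℕ.* t) (sym nw≡t²) (ℕ.*-monoˡ-< t t<n))

      n₀≤t : n₀ n ℕ.≤ t
      n₀≤t = ℕ.∣⇒≤ (admissible⇒n₀∣ n adm)

      n₀<n : n₀ n ℕ.< n
      n₀<n = ℕ.≤-<-trans n₀≤t t<n

      ℤ² : ∀ a b → n ℕ.* a ≡ b ℕ.* b → + n * + a ≡ + b * + b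
      ℤ² a b eq = trans (sym (pos-* n a)) (trans (cong +_ eq) (pos-* b b))

      eq : ∀ n m t r {w w₀} → n * w ≡ t * t → n * w₀ ≡ r * r →
        n * (+ 4 * m + w₀) - n * (+ 3 * r) ≡
        n * (+ 4 * m + w - + 3 * t) + (t - r) * ((n - t) + (n - r) + n)
      eq n m t r {w} {w₀} nw nw₀ = trans (expand₁ n m r w₀) (trans (cong (λ v → + 4 * (n * m) + v - + 3 * (n * r)) nw₀)
        (trans (expand₂ n m t r) (sym (trans (expand₃ n m t r w) (cong (λ v → + 4 * (n * m) + v - + 3 * (n * t) + (t - r) * ((n - t) + (n - r) + n)) nw)))))
        where
        expand₁ : ∀ n m r w₀ → n * (+ 4 * m + w₀) - n * (+ 3 * r) ≡ + 4 * (n * m) + n * w₀ - + 3 * (n * r)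
        expand₁ = solve-∀
        expand₂ : ∀ n m t r → + 4 * (n * m) + r * r - + 3 * (n * r) ≡
          + 4 * (n * m) + t * t - + 3 * (n * t) + (t - r) * ((n - t) + (n - r) + n)
        expand₂ = solve-∀
        expand₃ : ∀ n m t r w → n * (+ 4 * m + w - + 3 * t) + (t - r) * ((n - t) + (n - r) + n) ≡
          + 4 * (n * m) + n * w - + 3 * (n * t) + (t - r) * ((n - t) + (n - r) + n)
        expand₃ = solve-∀

  -- Sufficiency: E(s) - w is an even number from 2 to 2 m

  module _ (y : Vector ℤ n) (s : Vector Bool n) (t w : ℕ) (2∣t+w : 2 ℕ.∣ t ℕ.+ w)
    (∑y : ∑ y ≡ + m - + t) (∣s∣ : card s ≡ m) (w<E : + w < sqDist y s) (E≤ : sqDist y s ≤ + w + + 2 * + m)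
    where

    private
      -- Here E(s) - t = 2 h and t + w = 2 g, hence E(s) = w + 2 (h + g - w).
      h g c : ℤ
      h = proj₁ (sqDist-parity y s)
      g = + ℕ.quotient 2∣t+w
      c = h + g - + w

      E≡ : sqDist y s ≡ + w + + 2 * c
      E≡ = begin
        sqDist y s ≡⟨ isolate (sqDist y s) (+ m) (+ t) (+ w) ⟩
        sqDist y s + (+ m - + t - + m) + (+ t + + w) - + w
          ≡⟨ cong₂ (λ a b → sqDist y s + (a - b) + (+ t + + w) - + w) (sym ∑y) (cong +_ (sym ∣s∣)) ⟩
        sqDist y s + (∑ y - + card s) + (+ t + + w) - + w
          ≡⟨ cong₂ (λ a b → a + b - + w) (proj₂ (sqDist-parity y s))
               (trans (cong +_ (ℕ._∣_.equality 2∣t+w)) (pos-* (ℕ.quotient 2∣t+w) 2)) ⟩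
        + 2 * h + g * + 2 - + w ≡⟨ collect h g (+ w) ⟩
        + w + + 2 * c ∎
        where
        open ≡-Reasoning
        isolate : ∀ E m t w → E ≡ E + (m - t - m) + (t + w) - w
        isolate = solve-∀
        collect : ∀ h g w → + 2 * h + g * + 2 - w ≡ w + + 2 * (h + g - w)
        collect = solve-∀

    sqDist≡w+2k : ∃[ k ] 1 ℕ.≤ k × k ℕ.≤ m × sqDist y s ≡ + w + + 2 * + k
    sqDist≡w+2k = go c E≡
      where
      0<2c : ∀ c → sqDist y s ≡ + w + + 2 * c → 0ℤ < + 2 * c
      0<2c c eq = suc[i]≤j⇒i<j (by-difference (gap (i<j⇒suc[i]≤j w<E))
        (trans (shift (+ w) c) (cong (_- (1ℤ + + w)) (sym eq))))
        where
        shift : ∀ w c → + 2 * c - 1ℤ ≡ w + + 2 * c - (1ℤ + w)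
        shift = solve-∀

      2c≤2m : ∀ c → sqDist y s ≡ + w + + 2 * c → + 2 * c ≤ + 2 * + m
      2c≤2m c eq = by-difference (gap E≤) (trans (shift (+ m) (+ w) c) (cong (λ e → + w + + 2 * + m - e) (sym eq)))
        where
        shift : ∀ m w c → + 2 * m - + 2 * c ≡ w + + 2 * m - (w + + 2 * c)
        shift = solve-∀

      go : ∀ c → sqDist y s ≡ + w + + 2 * c → ∃[ k ] 1 ℕ.≤ k × k ℕ.≤ m × sqDist y s ≡ + w + + 2 * + k
      go c eq with *-cancelˡ-<-nonNeg {0ℤ} {c} (+ 2) (0<2c c eq) | *-cancelˡ-≤-pos c (+ m) (+ 2) (2c≤2m c eq)
      go (+ k) eq | +<+ 1≤k | +≤+ k≤m = k , 1≤k , k≤m , eq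

  -- Distances between two vertices

  hamming : Vector Bool n → Vector Bool n → ℕ
  hamming {zero}  r s = 0
  hamming {suc n} r s with r zero | s zero
  ... | true  | true  = hamming (tail r) (tail s)
  ... | true  | false = suc (hamming (tail r) (tail s))
  ... | false | true  = suc (hamming (tail r) (tail s))
  ... | false | false = hamming (tail r) (tail s)

  sqDist-𝟙 : (r s : Vector Bool n) → sqDist (𝟙 ∘ r) s ≡ + hamming r s
  sqDist-𝟙 {zero}  r s = refl
  sqDist-𝟙 {suc n} r s with r zero | s zero
  ... | true  | true  = trans (+-identityˡ _) (sqDist-𝟙 (tail r) (tail s))
  ... | true  | false = cong (λ i → 1ℤ + i) (sqDist-𝟙 (tail r) (tail s))
  ... | false | true  = cong (λ i → 1ℤ + i) (sqDist-𝟙 (tail r) (tail s))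
  ... | false | false = trans (+-identityˡ _) (sqDist-𝟙 (tail r) (tail s))

  hamming-≤ : (r s : Vector Bool n) → hamming r s ℕ.≤ card r ℕ.+ card s
  hamming-≤ {zero}  r s = z≤n
  hamming-≤ {suc n} r s with r zero | s zero
  ... | true  | true  = ℕ.m≤n⇒m≤1+n (ℕ.≤-trans (hamming-≤ (tail r) (tail s)) (ℕ.+-monoʳ-≤ (card (tail r)) (ℕ.n≤1+n _)))
  ... | true  | false = s≤s (hamming-≤ (tail r) (tail s))
  ... | false | true  = subst (suc (hamming (tail r) (tail s)) ℕ.≤_) (sym (ℕ.+-suc (card (tail r)) (card (tail s))))
    (s≤s (hamming-≤ (tail r) (tail s)))
  ... | false | false = hamming-≤ (tail r) (tail s)

  hamming≡0⇒≗ : (r s : Vector Bool n) → hamming r s ≡ 0 → r ≗ s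
  hamming≡0⇒≗ {suc n} r s eq i with r zero in r₀ | s zero in s₀
  hamming≡0⇒≗ r s eq zero    | true  | true  = trans r₀ (sym s₀)
  hamming≡0⇒≗ r s eq (suc i) | true  | true  = hamming≡0⇒≗ (tail r) (tail s) eq i
  hamming≡0⇒≗ r s eq zero    | false | false = trans r₀ (sym s₀)
  hamming≡0⇒≗ r s eq (suc i) | false | false = hamming≡0⇒≗ (tail r) (tail s) eq i

  ≗⇒hamming≡0 : (r s : Vector Bool n) → r ≗ s → hamming r s ≡ 0
  ≗⇒hamming≡0 {zero}  r s r≗s = refl
  ≗⇒hamming≡0 {suc n} r s r≗s with r zero | s zero | r≗s zero
  ... | true  | true  | _ = ≗⇒hamming≡0 (tail r) (tail s) (r≗s ∘ suc)
  ... | false | false | _ = ≗⇒hamming≡0 (tail r) (tail s) (r≗s ∘ suc)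

  -- Starting from two equal vectors, each prepended exchange of `true , false` against
  -- `false , true` adds 2 to the distance and 1 to both cardinalities. It uses up two coordinates,
  -- which is why m + k of them are required.
  hamming-attained : ∀ n m k → k ℕ.≤ m → m ℕ.+ k ℕ.≤ n →
    ∃₂ λ (r s : Vector Bool n) → card r ≡ m × card s ≡ m × hamming r s ≡ 2 ℕ.* k
  hamming-attained n m zero _ m≤n
    with s , _ , ∣s∣ ← subset-⊆ {n} (const true) (subst (m ℕ.≤_) (sym (card-full {n})) (subst (ℕ._≤ n) (ℕ.+-identityʳ m) m≤n))
    = s , s , ∣s∣ , ∣s∣ , ≗⇒hamming≡0 s s (λ _ → refl)
  hamming-attained n (suc m) (suc k) (s≤s k≤m) ≤n with n | subst (ℕ._≤ n) (cong suc (ℕ.+-suc m k)) ≤n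
  ... | suc (suc n) | s≤s (s≤s ≤n) with r , s , ∣r∣ , ∣s∣ , eq ← hamming-attained n m k k≤m ≤n
    = true ∷ᵥ false ∷ᵥ r , false ∷ᵥ true ∷ᵥ s , cong suc ∣r∣ , cong suc ∣s∣
    , trans (cong (2 ℕ.+_) eq) (cong suc (sym (ℕ.+-suc k (k ℕ.+ 0))))

  card-cong : {r s : Vector Bool n} → r ≗ s → card r ≡ card s
  card-cong {zero}          r≗s = refl
  card-cong {suc n} {r} {s} r≗s = cong₂ (λ b c → (if b then suc else id) c) (r≗s zero) (card-cong (r≗s ∘ suc))

  card-not : (s : Vector Bool n) → card s ℕ.+ card (not ∘ s) ≡ n
  card-not {zero}  s = refl
  card-not {suc n} s with s zero
  ... | true  = cong suc (card-not (tail s))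
  ... | false = trans (ℕ.+-suc (card (tail s)) _) (cong suc (card-not (tail s)))

  card-remove : (s : Vector Bool n) (i : Fin n) → s i ≡ true → suc (card (updateAt s i (const false))) ≡ card s
  card-remove {suc n} s zero    s₀ with true ← s zero = refl
  card-remove {suc n} s (suc i) sᵢ with s zero
  ... | true  = cong suc (card-remove (tail s) i sᵢ)
  ... | false = card-remove (tail s) i sᵢ

  -- Two vertices are the case t = w = 0 of `sqDist≡w+2k`, with y the indicator vector of `r`.
  hamming-distinct : (r s : Vector Bool n) → card r ≡ m → card s ≡ m → ¬ r ≗ s →
                     ∃[ k ] 1 ℕ.≤ k × k ℕ.≤ m × sqDist (𝟙 ∘ r) s ≡ + 2 * + k
  hamming-distinct {m = m} r s ∣r∣ ∣s∣ r≢s =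
    let k , 1≤k , k≤m , eq = sqDist≡w+2k (𝟙 ∘ r) s 0 0 (2 ℕ.∣0)
          (trans (∑𝟙≡card r) (trans (cong +_ ∣r∣) (sym (+-identityʳ (+ m))))) ∣s∣
          (subst (0ℤ <_) (sym (sqDist-𝟙 r s)) (+<+ (ℕ.n≢0⇒n>0 (r≢s ∘ hamming≡0⇒≗ r s))))
          (subst₂ _≤_ (sym (sqDist-𝟙 r s)) (trans (pos-* 2 m) (sym (+-identityˡ (+ 2 * + m))))
            (+≤+ (ℕ.≤-trans (hamming-≤ r s) (ℕ.≤-reflexive (cong₂ ℕ._+_ ∣r∣ (trans ∣s∣ (sym (ℕ.+-identityʳ m))))))))
    in k , 1≤k , k≤m , trans eq (+-identityˡ (+ 2 * + k))

  ∑-neg𝟙 : (β : Vector Bool n) → ∑ (λ i → - 𝟙 (not (β i))) ≡ + card β - + n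
  ∑-neg𝟙 {n} β = trans (∑-neg (𝟙 ∘ not ∘ β)) (trans (cong -_ (∑𝟙≡card (not ∘ β)))
    (trans (isolate (+ card β) (+ card (not ∘ β))) (cong (λ c → + card β - + c) (card-not β))))
    where
    isolate : ∀ a b → - b ≡ a - (a + b)
    isolate = solve-∀

  module _ (t w : ℕ) (β : Vector Bool n) where

    private
      -- The form of `split-pointwise`, now as an upper bound: for y equal to 0 or -1 it is exact
      -- except where y = -1 lies off the support. So the inequality found necessary is also what
      -- `near-below` requires.
      square-≤ : ∀ b c → (- 𝟙 (not b) - 𝟙 c) * (- 𝟙 (not b) - 𝟙 c) ≤ - + 3 * - 𝟙 (not b) + + 1 * 𝟙 c + 0ℤ * 0ℤ + 0ℤ
      square-≤ true  true  = ≤-refl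
      square-≤ true  false = ≤-refl
      square-≤ false true  = ≤-refl
      square-≤ false false = +≤+ (s≤s z≤n)

      square-≤′ : ∀ b c → (𝟙 b - 𝟙 c) * (𝟙 b - 𝟙 c) ≤ + 1 * 𝟙 b + + 1 * 𝟙 c + 0ℤ * 0ℤ + 0ℤ
      square-≤′ true  true  = +≤+ z≤n
      square-≤′ true  false = ≤-refl
      square-≤′ false true  = ≤-refl
      square-≤′ false false = ≤-refl

    near-below : 3 ℕ.* t ℕ.≤ 4 ℕ.* m ℕ.+ w → ∑ (λ i → - 𝟙 (not (β i))) ≡ + m - + t →
      ∀ s → card s ≡ m → sqDist (λ i → - 𝟙 (not (β i))) s ≤ + w + + 2 * + m
    near-below {m} 3t≤4m+w ∑y s ∣s∣ = ≤-trans
      (∑-≤-linear (- + 3) (+ 1) 0ℤ 0ℤ (λ i → - 𝟙 (not (β i))) (𝟙 ∘ s) (const 0ℤ) _ ∑y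
        (trans (∑𝟙≡card s) (cong +_ ∣s∣)) (∑-zeros {n}) λ i → square-≤ (β i) (s i))
      (by-difference (gap (subst₂ _≤_ (pos-* 3 t) (cong (_+ + w) (pos-* 4 m)) (+≤+ 3t≤4m+w))) (eq (+ m) (+ t) (+ w) (+ n)))
      where
      eq : ∀ m t w n → w + + 2 * m - (- + 3 * (m - t) + + 1 * m + 0ℤ * 0ℤ + 0ℤ * n) ≡ + 4 * m + w - + 3 * t
      eq = solve-∀

    -- For a 0/1 vector y, E(s) is at most the total number of ones, (m - t) + m, so the upper bound
    -- is automatic.
    near-above : ∑ (𝟙 ∘ β) ≡ + m - + t → ∀ s → card s ≡ m → sqDist (𝟙 ∘ β) s ≤ + w + + 2 * + m
    near-above {m} ∑y s ∣s∣ = ≤-trans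
      (∑-≤-linear (+ 1) (+ 1) 0ℤ 0ℤ (𝟙 ∘ β) (𝟙 ∘ s) (const 0ℤ) _ ∑y
        (trans (∑𝟙≡card s) (cong +_ ∣s∣)) (∑-zeros {n}) λ i → square-≤′ (β i) (s i))
      (by-difference (+≤+ {n = t} z≤n ⊕ +≤+ {n = w} z≤n) (eq (+ m) (+ t) (+ w) (+ n)))
      where
      eq : ∀ m t w n → w + + 2 * m - (+ 1 * (m - t) + + 1 * m + 0ℤ * 0ℤ + 0ℤ * n) ≡ t + w
      eq = solve-∀

open IntegerVectors

-- Squared distances over a commutative ring with a map from ℤ

module RingVectors {c ℓ} (R : CommutativeRing c ℓ)
  (ι : ℤ.+-*-rawRing ACR.-Raw-AlmostCommutative⟶ ACR.fromCommutativeRing R) where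

  open import Defs using (n₀)
  open CommutativeRing R hiding (zero)
  open RawMonoidDefinitions +-rawMonoid using (sum)
  open ACR._-Raw-AlmostCommutative⟶_ ι renaming (⟦_⟧ to fromℤ)
  open import Relation.Binary.Reasoning.Setoid setoid
  open ℤSolver using (solve-∀)

  private
    fromℤ-≟ : ∀ i j → Maybe (fromℤ i ≈ fromℤ j)
    fromℤ-≟ i j with i ℤ.≟ j
    ... | yes ≡.refl = just refl
    ... | no _       = nothing

  open RingSolver ℤ.+-*-rawRing (ACR.fromCommutativeRing R) ι fromℤ-≟
    using (solve; con; _:=_; _:+_; _:*_; _:-_; :-_)

  private variable
    n m : ℕ

  sum-cong : {f g : Vector Carrier n} → (∀ i → f i ≈ g i) → sum f ≈ sum g
  sum-cong {zero}  f≈g = refl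
  sum-cong {suc n} f≈g = +-cong (f≈g zero) (sum-cong (f≈g ∘ suc))

  normSq : Vector Carrier n → Carrier
  normSq u = sum λ i → u i * u i

  normSq-cong : {u v : Vector Carrier n} → (∀ i → u i ≈ v i) → normSq u ≈ normSq v
  normSq-cong u≈v = sum-cong λ i → *-cong (u≈v i) (u≈v i)

  distSq : Vector Carrier n → Vector Carrier n → Carrier
  distSq u v = normSq λ i → u i - v i

  distSq-cong : {u u′ v v′ : Vector Carrier n} → (∀ i → u i ≈ u′ i) → (∀ i → v i ≈ v′ i) →
                distSq u v ≈ distSq u′ v′
  distSq-cong u≈u′ v≈v′ = normSq-cong λ i → +-cong (u≈u′ i) (-‿cong (v≈v′ i))

  distSq-sym : (u v : Vector Carrier n) → distSq u v ≈ distSq v u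
  distSq-sym u v = sum-cong λ i → swap (u i) (v i)
    where
    swap : ∀ a b → (a - b) * (a - b) ≈ (b - a) * (b - a)
    swap = solve 2 (λ a b → (a :- b) :* (a :- b) := (b :- a) :* (b :- a)) refl

  sum-shift : ∀ a (y : Vector ℤ n) → sum (λ i → a + fromℤ (y i)) ≈ fromℤ (+ n) * a + fromℤ (∑ y)
  sum-shift {zero}  a y = trans (sym 0-homo) (solve 1 (λ a → con 0ℤ := con 0ℤ :* a :+ con 0ℤ) refl a)
  sum-shift {suc n} a y = begin
    a + fromℤ (y zero) + sum (λ i → a + fromℤ (y (suc i)))
      ≈⟨ +-congˡ (sum-shift a (tail y)) ⟩
    a + fromℤ (y zero) + (fromℤ (+ n) * a + fromℤ (∑ (tail y)))
      ≈⟨ solve 4 (λ a y₀ n Y → a :+ y₀ :+ (n :* a :+ Y) := (con 1ℤ :+ n) :* a :+ (y₀ :+ Y)) refl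
           a (fromℤ (y zero)) (fromℤ (+ n)) (fromℤ (∑ (tail y))) ⟩
    (fromℤ 1ℤ + fromℤ (+ n)) * a + (fromℤ (y zero) + fromℤ (∑ (tail y)))
      ≈⟨ +-cong (*-congʳ (+-homo 1ℤ (+ n))) (+-homo (y zero) (∑ (tail y))) ⟨
    fromℤ (+ suc n) * a + fromℤ (∑ y) ∎

  normSq-shift : ∀ a (u : Vector ℤ n) → normSq (λ i → a + fromℤ (u i)) ≈
    fromℤ (+ n) * (a * a) + fromℤ (+ 2) * (a * fromℤ (∑ u)) + fromℤ (∑ λ i → u i ℤ.* u i)
  normSq-shift {zero}  a u = trans (sym 0-homo) (solve 1
    (λ a → con 0ℤ := con 0ℤ :* (a :* a) :+ con (+ 2) :* (a :* con 0ℤ) :+ con 0ℤ) refl a)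
  normSq-shift {suc n} a u = begin
    (a + fromℤ u₀) * (a + fromℤ u₀) + normSq (λ i → a + fromℤ (u (suc i)))
      ≈⟨ +-congˡ (normSq-shift a (tail u)) ⟩
    (a + fromℤ u₀) * (a + fromℤ u₀)
      + (fromℤ (+ n) * (a * a) + fromℤ (+ 2) * (a * fromℤ U) + fromℤ E)
      ≈⟨ solve 5 (λ a u₀ n U E →
           (a :+ u₀) :* (a :+ u₀) :+ (n :* (a :* a) :+ con (+ 2) :* (a :* U) :+ E) :=
           (con 1ℤ :+ n) :* (a :* a) :+ con (+ 2) :* (a :* (u₀ :+ U)) :+ (u₀ :* u₀ :+ E)) refl
           a (fromℤ u₀) (fromℤ (+ n)) (fromℤ U) (fromℤ E) ⟩
    (fromℤ 1ℤ + fromℤ (+ n)) * (a * a) + fromℤ (+ 2) * (a * (fromℤ u₀ + fromℤ U))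
      + (fromℤ u₀ * fromℤ u₀ + fromℤ E)
      ≈⟨ +-cong (+-cong (*-congʳ (+-homo 1ℤ (+ n))) (*-congˡ (*-congˡ (+-homo u₀ U))))
                (trans (+-homo (u₀ ℤ.* u₀) E) (+-congʳ (*-homo u₀ u₀))) ⟨
    fromℤ (+ suc n) * (a * a) + fromℤ (+ 2) * (a * fromℤ (∑ u)) + fromℤ (u₀ ℤ.* u₀ ℤ.+ E) ∎
    where
    u₀ = u zero
    U  = ∑ (tail u)
    E  = ∑ λ i → tail u i ℤ.* tail u i

  vertex : Vector Bool n → Vector Carrier n
  vertex s i = fromℤ (𝟙 (s i))

  -- The cross term collapses because n a = t, leaving n a² - 2 a t = - a t.
  distSq-vertex : ∀ {a t m} {x : Vector Carrier n} (y : Vector ℤ n) (s : Vector Bool n) →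
    (∀ i → x i ≈ a + fromℤ (y i)) → fromℤ (+ n) * a ≈ fromℤ t →
    ∑ y ≡ m ℤ.- t → ∑ (𝟙 ∘ s) ≡ m →
    distSq x (vertex s) ≈ fromℤ (sqDist y s) - a * fromℤ t
  distSq-vertex {n} {a} {t} {m} {x} y s x≈ na≈t ∑y ∑s = begin
    distSq x (vertex s)
      ≈⟨ normSq-cong (λ i → begin
           x i - fromℤ (𝟙 (s i))                  ≈⟨ +-congʳ (x≈ i) ⟩
           a + fromℤ (y i) - fromℤ (𝟙 (s i))      ≈⟨ +-assoc _ _ _ ⟩
           a + (fromℤ (y i) - fromℤ (𝟙 (s i)))    ≈⟨ +-congˡ (+-congˡ (-‿homo (𝟙 (s i)))) ⟨
           a + (fromℤ (y i) + fromℤ (ℤ.- 𝟙 (s i))) ≈⟨ +-congˡ (+-homo (y i) (ℤ.- 𝟙 (s i))) ⟨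
           a + fromℤ (y i ℤ.- 𝟙 (s i))            ∎) ⟩
    normSq (λ i → a + fromℤ (y i ℤ.- 𝟙 (s i)))
      ≈⟨ normSq-shift a (λ i → y i ℤ.- 𝟙 (s i)) ⟩
    fromℤ (+ n) * (a * a) + fromℤ (+ 2) * (a * fromℤ (∑ (λ i → y i ℤ.- 𝟙 (s i)))) + fromℤ E
      ≈⟨ +-congʳ (+-cong (trans (sym (*-assoc _ a a)) (*-congʳ na≈t)) (*-congˡ (*-congˡ
           (trans (reflexive (≡.cong fromℤ ∑u≡-t)) (-‿homo t))))) ⟩
    fromℤ t * a + fromℤ (+ 2) * (a * - fromℤ t) + fromℤ E
      ≈⟨ solve 3 (λ a t E → t :* a :+ con (+ 2) :* (a :* :- t) :+ E := E :- a :* t) refl a (fromℤ t) (fromℤ E) ⟩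
    fromℤ E - a * fromℤ t ∎
    where
    E = sqDist y s
    cancel : ∀ m t → m ℤ.- t ℤ.- m ≡ ℤ.- t
    cancel = solve-∀
    ∑u≡-t : ∑ (λ i → y i ℤ.- 𝟙 (s i)) ≡ ℤ.- t
    ∑u≡-t = ≡.trans (∑-minus y (𝟙 ∘ s)) (≡.trans (≡.cong₂ ℤ._-_ ∑y ∑s) (cancel m t))

  -- Only one coordinate changes, and x² - (x - 1)² = 2 x - 1.
  distSq-remove : (x : Vector Carrier n) (s : Vector Bool n) (i : Fin n) → s i ≡ true →
    distSq x (vertex (updateAt s i (const false))) ≈
    distSq x (vertex s) + (fromℤ (+ 2) * x i - 1#)
  distSq-remove {suc n} x s zero s₀ = begin
    (x zero - fromℤ 0ℤ) * (x zero - fromℤ 0ℤ) + F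
      ≈⟨ solve 2 (λ x F → (x :- con 0ℤ) :* (x :- con 0ℤ) :+ F :=
           (x :- con 1ℤ) :* (x :- con 1ℤ) :+ F :+ (con (+ 2) :* x :- con 1ℤ)) refl (x zero) F ⟩
    (x zero - fromℤ 1ℤ) * (x zero - fromℤ 1ℤ) + F + (fromℤ (+ 2) * x zero - fromℤ 1ℤ)
      ≈⟨ +-cong (reflexive (≡.cong (λ b → (x zero - fromℤ (𝟙 b)) * (x zero - fromℤ (𝟙 b)) + F) (≡.sym s₀)))
                (+-congˡ (-‿cong 1-homo)) ⟩
    (x zero - fromℤ (𝟙 (s zero))) * (x zero - fromℤ (𝟙 (s zero))) + F + (fromℤ (+ 2) * x zero - 1#) ∎
    where
    F = distSq (tail x) (vertex (tail s))
  distSq-remove {suc n} x s (suc i) sᵢ =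
    trans (+-congˡ (distSq-remove (tail x) (tail s) i sᵢ)) (sym (+-assoc _ _ _))

  fromℤ-minus : ∀ i j → fromℤ (i ℤ.- j) ≈ fromℤ i - fromℤ j
  fromℤ-minus i j = trans (+-homo i (ℤ.- j)) (+-congˡ (-‿homo j))

  sum-shifted : ∀ {a t m} {x : Vector Carrier n} (y : Vector ℤ n) → (∀ i → x i ≈ a + fromℤ (y i)) →
    fromℤ (+ n) * a ≈ fromℤ t → ∑ y ≡ m ℤ.- t → sum x ≈ fromℤ m
  sum-shifted {n} {a} {t} {m} {x} y x≈ na≈t ∑y = begin
    sum x                                 ≈⟨ sum-cong x≈ ⟩
    sum (λ i → a + fromℤ (y i))           ≈⟨ sum-shift a y ⟩
    fromℤ (+ n) * a + fromℤ (∑ y)         ≈⟨ +-cong na≈t (reflexive (≡.cong fromℤ ∑y)) ⟩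
    fromℤ t + fromℤ (m ℤ.- t)             ≈⟨ +-homo t (m ℤ.- t) ⟨
    fromℤ (t ℤ.+ (m ℤ.- t))               ≈⟨ reflexive (≡.cong fromℤ (cancel t m)) ⟩
    fromℤ m                               ∎
    where
    cancel : ∀ t m → t ℤ.+ (m ℤ.- t) ≡ m
    cancel = solve-∀

  distSq-vertex≈ : ∀ {a t m w d} {x : Vector Carrier n} (y : Vector ℤ n) (s : Vector Bool n) →
    (∀ i → x i ≈ a + fromℤ (y i)) → fromℤ (+ n) * a ≈ fromℤ t → a * fromℤ t ≈ fromℤ w →
    ∑ y ≡ + m ℤ.- t → card s ≡ m → sqDist y s ≡ w ℤ.+ d →
    distSq x (vertex s) ≈ fromℤ d
  distSq-vertex≈ {n} {a} {t} {m} {w} {d} {x} y s x≈ na≈t at≈w ∑y ∣s∣ E≡ = begin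
    distSq x (vertex s)     ≈⟨ distSq-vertex y s x≈ na≈t ∑y (≡.trans (∑𝟙≡card s) (≡.cong +_ ∣s∣)) ⟩
    fromℤ (sqDist y s) - a * fromℤ t    ≈⟨ +-cong (reflexive (≡.cong fromℤ E≡)) (-‿cong at≈w) ⟩
    fromℤ (w ℤ.+ d) - fromℤ w           ≈⟨ fromℤ-minus (w ℤ.+ d) w ⟨
    fromℤ (w ℤ.+ d ℤ.- w)               ≈⟨ reflexive (≡.cong fromℤ (cancel w d)) ⟩
    fromℤ d                             ∎
    where
    cancel : ∀ w d → w ℤ.+ d ℤ.- w ≡ d
    cancel = solve-∀

  module _ {x : Vector Carrier n} (r : Vector Bool n) (∣r∣ : card r ≡ m) (x≈r : ∀ i → x i ≈ vertex r i) where

    private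
      -- A vertex is the shifted vector with a = t = w = 0, so the general formulas apply to it.
      x≈0+r : ∀ i → x i ≈ 0# + fromℤ (𝟙 (r i))
      x≈0+r i = trans (x≈r i) (sym (+-identityˡ _))
      n*0≈0 : fromℤ (+ n) * 0# ≈ fromℤ 0ℤ
      n*0≈0 = trans (zeroʳ _) (sym 0-homo)
      ∑r : ∑ (𝟙 ∘ r) ≡ + m ℤ.- 0ℤ
      ∑r = ≡.trans (∑𝟙≡card r) (≡.trans (≡.cong +_ ∣r∣) (≡.sym (ℤ.+-identityʳ (+ m))))

    sum-vertex : sum x ≈ fromℤ (+ m)
    sum-vertex = sum-shifted (𝟙 ∘ r) x≈0+r n*0≈0 ∑r

    distSq-vertices : ∀ {d} s → card s ≡ m → sqDist (𝟙 ∘ r) s ≡ d →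
                      distSq x (vertex s) ≈ fromℤ d
    distSq-vertices {d} s ∣s∣ E≡d = distSq-vertex≈ (𝟙 ∘ r) s x≈0+r n*0≈0
      (trans (zeroˡ _) (sym 0-homo)) ∑r ∣s∣ (≡.trans E≡d (≡.sym (ℤ.+-identityˡ d)))

  module _ (recip : ∀ k .{{_ : NonZero k}} → ∃[ r ] r * fromℤ (+ k) ≈ 1#)
           (fromℤ-injective : ∀ {i j} → fromℤ i ≈ fromℤ j → i ≡ j) where

    fromℤ-cancel : ∀ k .{{_ : NonZero k}} {x y} → fromℤ (+ k) * x ≈ fromℤ (+ k) * y → x ≈ y
    fromℤ-cancel k {x} {y} kx≈ky with r , rk≈1 ← recip k = begin
      x                      ≈⟨ trans (*-congʳ rk≈1) (*-identityˡ x) ⟨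
      r * fromℤ (+ k) * x    ≈⟨ *-assoc r _ x ⟩
      r * (fromℤ (+ k) * x)  ≈⟨ *-congˡ kx≈ky ⟩
      r * (fromℤ (+ k) * y)  ≈⟨ *-assoc r _ y ⟨
      r * fromℤ (+ k) * y    ≈⟨ trans (*-congʳ rk≈1) (*-identityˡ y) ⟩
      y                      ∎

    private
      -- Multiplication by n removes the non-integral a, since n a t = t². What remains is an
      -- equation between images of integers, which injectivity of `fromℤ` transfers to ℤ.
      integral⇒condition : ∀ {n m} .{{_ : NonZero n}} → 1 ℕ.≤ m → 2 ℕ.* m ℕ.≤ n →
        ∀ {x : Vector Carrier n} {a} (y : Vector ℤ n) t → (∀ i → x i ≈ a + fromℤ (y i)) →
        fromℤ (+ n) * a ≈ fromℤ (+ t) → t ℕ.< n → ∑ y ≡ + m ℤ.- + t →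
        (∀ s → card s ≡ m → ∃[ k ] 1 ℕ.≤ k × k ℕ.≤ m ×
           distSq x (vertex s) ≈ fromℤ (+ 2 ℤ.* + k)) →
        n₀ n ℕ.< n × (∀ {w₀} → Admissible n (n₀ n) w₀ → 3 ℕ.* n₀ n ℕ.≤ 4 ℕ.* m ℕ.+ w₀)
      integral⇒condition {n} {m} 1≤m 2m≤n {x} {a} y t x≈ na≈t t<n ∑y D =
        n₀<n×3n₀≤4m+w₀ 1≤m 2m≤n y t t<n ∑y H
        where
        H : ∀ s → card s ≡ m → ∃[ k ] 1 ℕ.≤ k × k ℕ.≤ m ×
            + n ℤ.* (sqDist y s ℤ.- + 2 ℤ.* + k) ≡ + t ℤ.* + t
        H s ∣s∣ with k , 1≤k , k≤m , Dₛ ← D s ∣s∣ = k , 1≤k , k≤m , fromℤ-injective (begin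
          fromℤ (+ n ℤ.* (E ℤ.- d))           ≈⟨ *-homo (+ n) (E ℤ.- d) ⟩
          fromℤ (+ n) * fromℤ (E ℤ.- d)       ≈⟨ *-congˡ (fromℤ-minus E d) ⟩
          fromℤ (+ n) * (fromℤ E - fromℤ d)
            ≈⟨ *-congˡ (+-congˡ (-‿cong (trans (sym Dₛ)
                 (distSq-vertex y s x≈ na≈t ∑y (≡.trans (∑𝟙≡card s) (≡.cong +_ ∣s∣)))))) ⟩
          fromℤ (+ n) * (fromℤ E - (fromℤ E - a * fromℤ (+ t)))
            ≈⟨ solve 4 (λ n e a t → n :* (e :- (e :- a :* t)) := n :* a :* t) refl _ (fromℤ E) a (fromℤ (+ t)) ⟩
          fromℤ (+ n) * a * fromℤ (+ t)       ≈⟨ *-congʳ na≈t ⟩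
          fromℤ (+ t) * fromℤ (+ t)           ≈⟨ *-homo (+ t) (+ t) ⟨
          fromℤ (+ t ℤ.* + t)                 ∎)
          where
          E = sqDist y s
          d = + 2 ℤ.* + k

    module _ (1≤m : 1 ℕ.≤ m) (2m≤n : 2 ℕ.* m ℕ.≤ suc n) (x : Vector Carrier (suc n))
      (sum-x : sum x ≈ fromℤ (+ m))
      (D : ∀ s → card s ≡ m → ∃[ k ] 1 ℕ.≤ k × k ℕ.≤ m ×
           distSq x (vertex s) ≈ fromℤ (+ 2 ℤ.* + k)) where

      private
        N = suc n
        x₀ = x zero

        -- Dropping i or 0 from a common (m+1)-subset gives two m-subsets whose squared
        -- distances from x differ by 2 (xᵢ - x₀).
        difference : ∀ i → ∃[ y ] x i ≈ x₀ + fromℤ y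
        difference i
          -- The set containing 0 and i has at most two elements, and 2 ≤ m + 1 ≤ 2 m ≤ n by 1 ≤ m.
          with s , ⊆s , ∣s∣ ← subset-⊇ {k = suc m} (updateAt (updateAt (const false) zero (const true)) i (const true))
                 (ℕ.≤-trans (card-add _ i) (s≤s (ℕ.≤-trans (card-add {N} (const false) zero)
                   (ℕ.≤-trans (s≤s (ℕ.≤-reflexive (card-∅ {N}))) 1≤m))))
                 (ℕ.≤-trans (ℕ.+-mono-≤ 1≤m (ℕ.≤-reflexive (≡.sym (ℕ.+-identityʳ m)))) 2m≤n)
          with sᵢ ← ⊆s i (updateAt-updates i (updateAt (const false) zero (const true)))
             | s₀ ← ⊆s zero (add-⊇ (updateAt (const false) zero (const true)) i zero ≡.refl)
          with k  , _ , _ , Dᵢ ← D (updateAt s i (const false)) (ℕ.suc-injective (≡.trans (card-remove s i sᵢ) ∣s∣))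
             | k₀ , _ , _ , D₀ ← D (updateAt s zero (const false)) (ℕ.suc-injective (≡.trans (card-remove s zero s₀) ∣s∣))
          = + k ℤ.- + k₀ , fromℤ-cancel 2 (begin
            fromℤ (+ 2) * x i
              ≈⟨ solve 4 (λ u v F o → con (+ 2) :* u := F :+ (con (+ 2) :* u :- o) :- (F :+ (con (+ 2) :* v :- o)) :+ con (+ 2) :* v)
                   refl (x i) x₀ F 1# ⟩
            F + (fromℤ (+ 2) * x i - 1#) - (F + (fromℤ (+ 2) * x₀ - 1#)) + fromℤ (+ 2) * x₀
              ≈⟨ +-congʳ (+-cong (trans (sym (distSq-remove x s i sᵢ)) Dᵢ)
                                 (-‿cong (trans (sym (distSq-remove x s zero s₀)) D₀))) ⟩
            fromℤ (+ 2 ℤ.* + k) - fromℤ (+ 2 ℤ.* + k₀) + fromℤ (+ 2) * x₀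
              ≈⟨ +-congʳ (fromℤ-minus (+ 2 ℤ.* + k) (+ 2 ℤ.* + k₀)) ⟨
            fromℤ (+ 2 ℤ.* + k ℤ.- + 2 ℤ.* + k₀) + fromℤ (+ 2) * x₀
              ≈⟨ +-congʳ (trans (reflexive (≡.cong fromℤ (factor (+ k) (+ k₀)))) (*-homo (+ 2) (+ k ℤ.- + k₀))) ⟩
            fromℤ (+ 2) * fromℤ (+ k ℤ.- + k₀) + fromℤ (+ 2) * x₀
              ≈⟨ trans (+-comm _ _) (sym (distribˡ (fromℤ (+ 2)) x₀ (fromℤ (+ k ℤ.- + k₀)))) ⟩
            fromℤ (+ 2) * (x₀ + fromℤ (+ k ℤ.- + k₀)) ∎)
          where
          F = distSq x (vertex s)
          factor : ∀ k k₀ → + 2 ℤ.* k ℤ.- + 2 ℤ.* k₀ ≡ + 2 ℤ.* (k ℤ.- k₀)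
          factor = solve-∀

        y : Vector ℤ N
        y = proj₁ ∘ difference

        -- T is the integer n x₀. Moving its quotient by n from x₀ into the integral part replaces n
        -- x₀ by the remainder t, which lies in [0 , n).
        T q : ℤ
        T = + m ℤ.- ∑ y
        q = T /ℕ N

        t : ℕ
        t = T %ℕ N

        T≡ : T ≡ + t ℤ.+ q ℤ.* + N
        T≡ = a≡a%ℕn+[a/ℕn]*n T N

        Nx₀≈T : fromℤ (+ N) * x₀ ≈ fromℤ T
        Nx₀≈T = begin
          fromℤ (+ N) * x₀  ≈⟨ solve 2 (λ u v → u := u :+ v :- v) refl _ (fromℤ (∑ y)) ⟩
          fromℤ (+ N) * x₀ + fromℤ (∑ y) - fromℤ (∑ y)
            ≈⟨ +-congʳ (trans (sym (sum-shift x₀ y)) (trans (sum-cong (sym ∘ proj₂ ∘ difference)) sum-x)) ⟩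
          fromℤ (+ m) - fromℤ (∑ y) ≈⟨ fromℤ-minus (+ m) (∑ y) ⟨
          fromℤ T ∎

        a : Carrier
        a = x₀ - fromℤ q

        y′ : Vector ℤ N
        y′ i = q ℤ.+ y i

        x≈ : ∀ i → x i ≈ a + fromℤ (y′ i)
        x≈ i = begin
          x i                                  ≈⟨ proj₂ (difference i) ⟩
          x₀ + fromℤ (y i)                     ≈⟨ solve 3 (λ u v w → u :+ v := u :- w :+ (w :+ v)) refl x₀ (fromℤ (y i)) (fromℤ q) ⟩
          a + (fromℤ q + fromℤ (y i))          ≈⟨ +-congˡ (+-homo q (y i)) ⟨
          a + fromℤ (y′ i)                     ∎

        Na≈t : fromℤ (+ N) * a ≈ fromℤ (+ t)
        Na≈t = begin
          fromℤ (+ N) * (x₀ - fromℤ q)                 ≈⟨ solve 3 (λ n u v → n :* (u :- v) := n :* u :- v :* n) refl _ x₀ (fromℤ q) ⟩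
          fromℤ (+ N) * x₀ - fromℤ q * fromℤ (+ N)     ≈⟨ +-cong Nx₀≈T (-‿cong (sym (*-homo q (+ N)))) ⟩
          fromℤ T - fromℤ (q ℤ.* + N)                  ≈⟨ fromℤ-minus T (q ℤ.* + N) ⟨
          fromℤ (T ℤ.- q ℤ.* + N)                      ≈⟨ reflexive (≡.cong fromℤ (≡.trans (≡.cong (ℤ._- q ℤ.* + N) T≡) (cancel (+ t) (q ℤ.* + N)))) ⟩
          fromℤ (+ t)                                  ∎
          where
          cancel : ∀ a b → a ℤ.+ b ℤ.- b ≡ a
          cancel = solve-∀

        ∑y′ : ∑ y′ ≡ + m ℤ.- + t
        ∑y′ = ≡.trans (∑-const-+ q y) (≡.trans (isolate (+ m) (∑ y) (+ t) (q ℤ.* + N))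
          (≡.trans (≡.cong (λ z → + m ℤ.- + t ℤ.+ (+ t ℤ.+ q ℤ.* + N ℤ.- z)) T≡) (cancel (+ m) (+ t) (q ℤ.* + N))))
          where
          isolate : ∀ m Y t p → p ℤ.+ Y ≡ m ℤ.- t ℤ.+ (t ℤ.+ p ℤ.- (m ℤ.- Y))
          isolate = solve-∀
          cancel : ∀ m t p → m ℤ.- t ℤ.+ (t ℤ.+ p ℤ.- (t ℤ.+ p)) ≡ m ℤ.- t
          cancel = solve-∀

      extension⇒condition : n₀ N ℕ.< N ×
        (∀ {w₀} → Admissible N (n₀ N) w₀ → 3 ℕ.* n₀ N ℕ.≤ 4 ℕ.* m ℕ.+ w₀)
      extension⇒condition = integral⇒condition 1≤m 2m≤n y′ t x≈ Na≈t (n%ℕd<d T N) ∑y′ D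

-- Distances to the vertices, with square roots and sign kept abstract

module VertexDistances {c ℓ p} (R : CommutativeRing c ℓ)
  (ι : ℤ.+-*-rawRing ACR.-Raw-AlmostCommutative⟶ ACR.fromCommutativeRing R)
  (recip : ∀ k .{{_ : NonZero k}} → ∃[ r ] CommutativeRing._≈_ R
    (CommutativeRing._*_ R r (ACR._-Raw-AlmostCommutative⟶_.⟦_⟧ ι (+ k))) (CommutativeRing.1# R))
  (fromℤ-injective : ∀ {i j} → CommutativeRing._≈_ R (ACR._-Raw-AlmostCommutative⟶_.⟦_⟧ ι i)
    (ACR._-Raw-AlmostCommutative⟶_.⟦_⟧ ι j) → i ≡ j)
  (NonNeg : CommutativeRing.Carrier R → Set p)
  (√ : ℕ → CommutativeRing.Carrier R)
  (√-nonNeg : ∀ k → NonNeg (√ k))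
  (√*√≈ : ∀ k → CommutativeRing._≈_ R (CommutativeRing._*_ R (√ k) (√ k))
    (ACR._-Raw-AlmostCommutative⟶_.⟦_⟧ ι (+ k)))
  where

  open RingVectors R ι public
  open CommutativeRing R hiding (zero)
  open RawMonoidDefinitions +-rawMonoid using (sum)
  open ACR._-Raw-AlmostCommutative⟶_ ι using () renaming (⟦_⟧ to fromℤ)
  open import Defs using (n₀)
  open ℤSolver using (solve-∀)

  private variable
    n m k : ℕ

  record IsVertex (m : ℕ) (x : Vector Carrier n) : Set ℓ where
    constructor isVertex
    field
      ones      : Vector Bool n
      card-ones : card ones ≡ m
      x≈ones    : ∀ i → x i ≈ vertex ones i

  -- The counterpart of `IsDistance` over the abstract ring.
  record Dist (x y : Vector Carrier n) (d : Carrier) : Set (p ⊔ ℓ) where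
    constructor mkDist
    field
      nonNeg : NonNeg d
      square : d * d ≈ distSq x y

  Distinct : (x y : Vector Carrier n) → Set ℓ
  Distinct x y = ¬ (∀ i → x i ≈ y i)

  Dist-sym : ∀ {x y : Vector Carrier n} {d} → Dist x y d → Dist y x d
  Dist-sym {x = x} {y} (mkDist 0≤d d²) = mkDist 0≤d (trans d² (distSq-sym x y))

  Dist-resp : ∀ {x x′ y y′ : Vector Carrier n} {d} → (∀ i → x i ≈ x′ i) → (∀ i → y i ≈ y′ i) →
              Dist x y d → Dist x′ y′ d
  Dist-resp x≈x′ y≈y′ (mkDist 0≤d d²) = mkDist 0≤d (trans d² (distSq-cong x≈x′ y≈y′))

  radius : Vector Carrier m
  radius j = √ (2 ℕ.* suc (toℕ j))

  2*suc-injective : {i j : Fin m} → fromℤ (+ (2 ℕ.* suc (toℕ i))) ≈ fromℤ (+ (2 ℕ.* suc (toℕ j))) → i ≡ j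
  2*suc-injective eq =
    Fin.toℕ-injective (ℕ.suc-injective (ℕ.*-cancelˡ-≡ _ _ 2 (ℤ.+-injective (fromℤ-injective eq))))

  radius-injective : {i j : Fin m} → radius i ≈ radius j → i ≡ j
  radius-injective {i = i} {j} eq = 2*suc-injective
    (trans (sym (√*√≈ (2 ℕ.* suc (toℕ i)))) (trans (*-cong eq eq) (√*√≈ (2 ℕ.* suc (toℕ j)))))

  Dist-radius : ∀ {x y : Vector Carrier n} → ∃[ k ] 1 ℕ.≤ k × k ℕ.≤ m × distSq x y ≈ fromℤ (+ 2 ℤ.* + k) →
                ∃[ j ] Dist x y (radius {m} j)
  Dist-radius (suc k , _ , k<m , eq) = fromℕ< k<m , mkDist (√-nonNeg (2 ℕ.* suc (toℕ (fromℕ< k<m))))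
    (trans (√*√≈ (2 ℕ.* suc (toℕ (fromℕ< k<m))))
      (trans (reflexive (≡.cong fromℤ (≡.trans (ℤ.pos-* 2 (suc (toℕ (fromℕ< k<m))))
        (≡.cong (λ k → + 2 ℤ.* + suc k) (Fin.toℕ-fromℕ< k<m))))) (sym eq)))

  vertex-isVertex : (s : Vector Bool n) → card s ≡ m → IsVertex m (vertex s)
  vertex-isVertex s ∣s∣ = isVertex s ∣s∣ λ _ → refl

  isVertex-resp : {x y : Vector Carrier n} → (∀ i → x i ≈ y i) → IsVertex m y → IsVertex m x
  isVertex-resp x≈y (isVertex s ∣s∣ y≈s) = isVertex s ∣s∣ λ i → trans (x≈y i) (y≈s i)

  isVertex⇒sum : {x : Vector Carrier n} → IsVertex m x → sum x ≈ fromℤ (+ m)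
  isVertex⇒sum (isVertex s ∣s∣ x≈s) = sum-vertex s ∣s∣ x≈s

  vertex-injective : (r s : Vector Bool n) → (∀ i → vertex r i ≈ vertex s i) → r ≗ s
  vertex-injective r s eq i = 𝟙-injective (r i) (s i) (fromℤ-injective (eq i))
    where
    𝟙-injective : ∀ b c → 𝟙 b ≡ 𝟙 c → b ≡ c
    𝟙-injective true  true  _ = ≡.refl
    𝟙-injective false false _ = ≡.refl

  vertices-distance : {x y : Vector Carrier n} → IsVertex m x → IsVertex m y → Distinct x y →
                      ∃[ j ] Dist x y (radius {m} j)
  vertices-distance {m = m} {x} {y} (isVertex r ∣r∣ x≈r) (isVertex s ∣s∣ y≈s) x≢y =
    let k , 1≤k , k≤m , eq = hamming-distinct r s ∣r∣ ∣s∣ λ r≗s → x≢y λ i →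
          trans (x≈r i) (trans (reflexive (≡.cong (fromℤ ∘ 𝟙) (r≗s i))) (sym (y≈s i)))
        j , xsd = Dist-radius {m = m} {x} {vertex s} (k , 1≤k , k≤m , distSq-vertices r ∣r∣ x≈r s ∣s∣ eq)
    in j , Dist-resp (λ _ → refl) (sym ∘ y≈s) xsd

  module _ (2m≤n : 2 ℕ.* m ℕ.≤ n) where

    distSq-attained : (j : Fin m) → ∃₂ λ (x y : Vector Carrier n) → IsVertex m x × IsVertex m y × Distinct x y ×
                      distSq x y ≈ fromℤ (+ (2 ℕ.* suc (toℕ j)))
    distSq-attained j =
      let r , s , ∣r∣ , ∣s∣ , eq = hamming-attained n m (suc (toℕ j)) (Fin.toℕ<n j)
            (ℕ.≤-trans (ℕ.+-monoʳ-≤ m (ℕ.≤-trans (Fin.toℕ<n j) (ℕ.≤-reflexive (≡.sym (ℕ.+-identityʳ m))))) 2m≤n)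
      in vertex r , vertex s , vertex-isVertex r ∣r∣ , vertex-isVertex s ∣s∣
       , (λ r≈s → contradiction (≡.trans (≡.sym eq) (≗⇒hamming≡0 r s (vertex-injective r s r≈s))) λ ())
       , distSq-vertices r ∣r∣ (λ _ → refl) s ∣s∣ (≡.trans (sqDist-𝟙 r s) (≡.cong +_ eq))

    radius-attained : (j : Fin m) → ∃₂ λ (x y : Vector Carrier n) → IsVertex m x × IsVertex m y × Distinct x y ×
                      Dist x y (radius j)
    radius-attained j = let x , y , vx , vy , x≢y , eq = distSq-attained j in
      x , y , vx , vy , x≢y , mkDist (√-nonNeg (2 ℕ.* suc (toℕ j))) (trans (√*√≈ (2 ℕ.* suc (toℕ j))) (sym eq))

    module _ (d : Vector Carrier m)
      (realised : ∀ {x y : Vector Carrier n} → IsVertex m x → IsVertex m y → Distinct x y → ∃[ i ] Dist x y (d i))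
      where

      private
        index : ∀ j → ∃[ i ] d i * d i ≈ fromℤ (+ (2 ℕ.* suc (toℕ j)))
        index j = let x , y , vx , vy , x≢y , eq = distSq-attained j
                      i , xyd = realised vx vy x≢y
                  in i , trans (Dist.square xyd) eq

        -- The values 2 , 4 , ... , 2 m are distinct, so they use distinct entries of `d`. An
        -- injective self-map of `Fin m` is onto, which leaves no entry for any other distance.
        index-injective : Injective _≡_ _≡_ (proj₁ ∘ index)
        index-injective {j} {j′} eq = 2*suc-injective (trans (sym (proj₂ (index j)))
          (trans (reflexive (≡.cong (λ i → d i * d i) eq)) (proj₂ (index j′))))

      -- The m distances of the vertices already exhaust d.
      distances-exhausted : ∀ i → ∃[ k ] 1 ℕ.≤ k × k ℕ.≤ m × d i * d i ≈ fromℤ (+ 2 ℤ.* + k)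
      distances-exhausted i =
        let j , eq = injective⇒hit index-injective i
        in suc (toℕ j) , s≤s z≤n , Fin.toℕ<n j ,
           trans (reflexive (≡.cong (λ i → d i * d i) (≡.sym eq)))
             (trans (proj₂ (index j)) (reflexive (≡.cong fromℤ (ℤ.pos-* 2 (suc (toℕ j))))))

  extension⇒bounds : .{{_ : NonZero n}} → 1 ℕ.≤ m → 2 ℕ.* m ℕ.≤ n → {x : Vector Carrier n} (d : Vector Carrier m) →
    (∀ {x y : Vector Carrier n} → IsVertex m x → IsVertex m y → Distinct x y → ∃[ i ] Dist x y (d i)) →
    (∀ {y} → IsVertex m y → Distinct x y → ∃[ i ] Dist x y (d i)) →
    ¬ IsVertex m x → sum x ≈ fromℤ (+ m) →
    n₀ n ℕ.< n × (∀ {w} → Admissible n (n₀ n) w → 3 ℕ.* n₀ n ℕ.≤ 4 ℕ.* m ℕ.+ w)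
  extension⇒bounds {n = suc _} 1≤m 2m≤n {x} d realised realised-x ¬vx sum-x =
    extension⇒condition recip fromℤ-injective 1≤m 2m≤n x sum-x λ s ∣s∣ →
      let i , xsd = realised-x (vertex-isVertex s ∣s∣) (λ x≈s → ¬vx (isVertex-resp x≈s (vertex-isVertex s ∣s∣)))
          k , 1≤k , k≤m , eq = distances-exhausted 2m≤n d realised i
      in k , 1≤k , k≤m , trans (sym (Dist.square xsd)) eq

  -- States a = t/n and w = t²/n without division in the ring.
  record Centre (n t w : ℕ) (a : Carrier) : Set ℓ where
    constructor mkCentre
    field
      na≈t : fromℤ (+ n) * a ≈ fromℤ (+ t)
      at≈w : a * fromℤ (+ t) ≈ fromℤ (+ w)

  record IsTranslate (a : Carrier) (i : ℤ) (z : Carrier) : Set ℓ where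
    constructor mkTranslate
    field
      z≈ : z ≈ a + fromℤ i

  record Shifted (a : Carrier) (y : Vector ℤ n) (x : Vector Carrier n) : Set ℓ where
    constructor mkShifted
    field
      x≈ : ∀ i → x i ≈ a + fromℤ (y i)

  shifted : ∀ {a} {y : Vector ℤ n} {x z : Vector Carrier n} →
            (∀ i → x i ≈ z i) → (∀ i → IsTranslate a (y i) (z i)) → Shifted a y x
  shifted x≈z tr = mkShifted λ i → trans (x≈z i) (IsTranslate.z≈ (tr i))

  module _ {t w : ℕ} (adm : Admissible n t w) {a : Carrier} (centre : Centre n t w a)
    {x : Vector Carrier n} (y : Vector ℤ n) (shifted : Shifted a y x)
    (∑y : ∑ y ≡ + m ℤ.- + t) (w<t : w ℕ.< t)
    (near : ∀ s → card s ≡ m → sqDist y s ℤ.≤ + w ℤ.+ + 2 ℤ.* + m)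
    where

    open Centre centre
    open Shifted shifted

    private
      far : ∀ s → card s ≡ m → + w ℤ.< sqDist y s
      far s ∣s∣ = ℤ.<-≤-trans (ℤ.+<+ w<t) (≡.subst (ℤ._≤ sqDist y s)
        (≡.trans (≡.cong₂ (λ a b → + a ℤ.- b) ∣s∣ ∑y) (cancel (+ m) (+ t))) (sqDist-lower y s))
        where
        cancel : ∀ m t → m ℤ.- (m ℤ.- t) ≡ t
        cancel = solve-∀

      distSq-to : ∀ s → card s ≡ m → ∃[ k ] 1 ℕ.≤ k × k ℕ.≤ m × distSq x (vertex s) ≈ fromℤ (+ 2 ℤ.* + k)
      distSq-to s ∣s∣ =
        let k , 1≤k , k≤m , eq = sqDist≡w+2k y s t w (Admissible.parity adm) ∑y ∣s∣ (far s ∣s∣) (near s ∣s∣)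
        in k , 1≤k , k≤m , distSq-vertex≈ y s x≈ na≈t at≈w ∑y ∣s∣ eq

    point-sum : sum x ≈ fromℤ (+ m)
    point-sum = sum-shifted y x≈ na≈t ∑y

    -- A vertex has squared distance 0 from itself, whereas the squared distance from `x` to any
    -- vertex is 2 k with k ≥ 1.
    point-∉ : ¬ IsVertex m x
    point-∉ (isVertex r ∣r∣ x≈r) =
      let k , 1≤k , _ , eq = distSq-to r ∣r∣
      in 0≢2*k 1≤k (fromℤ-injective (trans (sym (distSq-vertices r ∣r∣ x≈r r ∣r∣ (≡.trans (sqDist-𝟙 r r)
           (≡.cong +_ (≗⇒hamming≡0 r r λ _ → ≡.refl))))) eq))
      where
      0≢2*k : ∀ {k} → 1 ℕ.≤ k → + 0 ≢ + 2 ℤ.* + k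
      0≢2*k (s≤s _) ()

    point-distance : ∀ {z} → IsVertex m z → ∃[ j ] Dist x z (radius {m} j)
    point-distance (isVertex s ∣s∣ z≈s) =
      let j , xsd = Dist-radius {m = m} {x} {vertex s} (distSq-to s ∣s∣)
      in j , Dist-resp (λ _ → refl) (sym ∘ z≈s) xsd

open ≡ using (refl; sym; trans)

-- The real numbers: ring structure, embedding of ℤ, and square roots

module Reals where

  open import Defs
  open import Data.Rational.Base using (∣_∣)
  open ℕSolver using (solve-∀)
  open ℤSolver using () renaming (solve-∀ to solve-∀ᶻ)

  -- `_/_` reduces to lowest terms. Passing to unnormalised rationals turns the comparisons that
  -- follow into cross-multiplication in ℤ.
  toℚᵘ-/ : ∀ i b .{{_ : NonZero b}} → toℚᵘ (i / b) ℚᵘ.≃ (i ℚᵘ./ b)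
  toℚᵘ-/ i (suc b) = ℚ.toℚᵘ-fromℚᵘ (mkℚᵘ i b)

  /-≡ : ∀ i j b d .{{_ : NonZero b}} .{{_ : NonZero d}} → i ℤ.* + d ≡ j ℤ.* + b → i / b ≡ j / d
  /-≡ i j (suc b) (suc d) eq = ℚ.fromℚᵘ-cong {mkℚᵘ i b} {mkℚᵘ j d} (*≡* eq)

  /-≤ : ∀ i j b d .{{_ : NonZero b}} .{{_ : NonZero d}} → i ℤ.* + d ℤ.≤ j ℤ.* + b → i / b ℚ.≤ j / d
  /-≤ i j b@(suc _) d@(suc _) le = ℚ.toℚᵘ-cancel-≤
    (ℚᵘ.≤-respˡ-≃ (ℚᵘ.≃-sym (toℚᵘ-/ i b)) (ℚᵘ.≤-respʳ-≃ (ℚᵘ.≃-sym (toℚᵘ-/ j d)) (*≤* le)))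

  /-≤⁻¹ : ∀ i j b d .{{_ : NonZero b}} .{{_ : NonZero d}} → i / b ℚ.≤ j / d → i ℤ.* + d ℤ.≤ j ℤ.* + b
  /-≤⁻¹ i j b@(suc _) d@(suc _) le = ℚᵘ.drop-*≤*
    (ℚᵘ.≤-respˡ-≃ (toℚᵘ-/ i b) (ℚᵘ.≤-respʳ-≃ (toℚᵘ-/ j d) (ℚ.toℚᵘ-mono-≤ le)))

  /-< : ∀ i j b d .{{_ : NonZero b}} .{{_ : NonZero d}} → i ℤ.* + d ℤ.< j ℤ.* + b → i / b ℚ.< j / d
  /-< i j b@(suc _) d@(suc _) le = ℚ.toℚᵘ-cancel-<
    (ℚᵘ.<-respˡ-≃ (ℚᵘ.≃-sym (toℚᵘ-/ i b)) (ℚᵘ.<-respʳ-≃ (ℚᵘ.≃-sym (toℚᵘ-/ j d)) (*<* le)))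

  /-+ : ∀ i j b d .{{_ : NonZero b}} .{{_ : NonZero d}} →
        i / b ℚ.+ j / d ≡ _/_ (i ℤ.* + d ℤ.+ j ℤ.* + b) (b ℕ.* d) {{ℕ.m*n≢0 b d}}
  /-+ i j b@(suc _) d@(suc _) = ℚ.toℚᵘ-injective (ℚᵘ.≃-trans (ℚ.toℚᵘ-homo-+ (i / b) (j / d))
    (ℚᵘ.≃-trans (ℚᵘ.+-cong (toℚᵘ-/ i b) (toℚᵘ-/ j d)) (ℚᵘ.≃-sym (toℚᵘ-/ _ (b ℕ.* d)))))

  /-* : ∀ i j b d .{{_ : NonZero b}} .{{_ : NonZero d}} →
        (i / b) ℚ.* (j / d) ≡ _/_ (i ℤ.* j) (b ℕ.* d) {{ℕ.m*n≢0 b d}}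
  /-* i j b@(suc _) d@(suc _) = ℚ.toℚᵘ-injective (ℚᵘ.≃-trans (ℚ.toℚᵘ-homo-* (i / b) (j / d))
    (ℚᵘ.≃-trans (ℚᵘ.*-cong (toℚᵘ-/ i b) (toℚᵘ-/ j d)) (ℚᵘ.≃-sym (toℚᵘ-/ _ (b ℕ.* d)))))

  /-neg : ∀ i → ℚ.- (i / 1) ≡ (ℤ.- i) / 1
  /-neg i = ℚ.toℚᵘ-injective (ℚᵘ.≃-trans (ℚ.toℚᵘ-homo‿- (i / 1))
    (ℚᵘ.≃-trans (ℚᵘ.-‿cong (toℚᵘ-/ i 1)) (ℚᵘ.≃-sym (toℚᵘ-/ (ℤ.- i) 1))))

  /1-+ : ∀ i j → (i ℤ.+ j) / 1 ≡ i / 1 ℚ.+ j / 1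
  /1-+ i j = sym (trans (/-+ i j 1 1) (cong (_/ 1) (cong₂ ℤ._+_ (ℤ.*-identityʳ i) (ℤ.*-identityʳ j))))

  /1-* : ∀ i j → (i ℤ.* j) / 1 ≡ (i / 1) ℚ.* (j / 1)
  /1-* i j = sym (/-* i j 1 1)

  /1-injective : ∀ {i j} → i / 1 ≡ j / 1 → i ≡ j
  /1-injective {i} {j} eq = ℤ.≤-antisym (half i j (ℚ.≤-reflexive eq)) (half j i (ℚ.≤-reflexive (sym eq)))
    where
    half : ∀ i j → i / 1 ℚ.≤ j / 1 → i ℤ.≤ j
    half i j le = subst₂ ℤ._≤_ (ℤ.*-identityʳ i) (ℤ.*-identityʳ j) (/-≤⁻¹ i j 1 1 le)

  n*[i/n] : ∀ i n .{{_ : NonZero n}} → (+ n / 1) ℚ.* (i / n) ≡ i / 1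
  n*[i/n] i n = trans (/-* (+ n) i 1 n) (/-≡ (+ n ℤ.* i) i (1 ℕ.* n) 1 {{ℕ.m*n≢0 1 n}}
    (trans (ℤ.*-identityʳ _) (trans (ℤ.*-comm (+ n) i) (cong (λ k → i ℤ.* + k) (sym (ℕ.*-identityˡ n))))))

  -- _≃_ computes to a function type, so that x and y cannot be inferred from
  -- x ≃ y; wrapping it restores inference.
  infix 4 _≈_
  record _≈_ (x y : ℝ) : Set where
    constructor wrap
    field unwrap : x ≃ y

  open _≈_ public

  pointwise : ∀ {x y} → (∀ k → seq x k ≡ seq y k) → x ≈ y
  pointwise {x} {y} eq = wrap λ ε 0<ε → 0 , λ k _ →
    subst (λ q → ∣ seq x k ℚ.- q ∣ ℚ.< ε) (eq k) (∣p-p∣<ε (seq x k) 0<ε)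

  ≈-refl : ∀ {x} → x ≈ x
  ≈-refl {x} = pointwise λ _ → refl

  ≈-sym : ∀ {x y} → x ≈ y → y ≈ x
  ≈-sym {x} {y} (wrap p) = wrap λ ε 0<ε → let N , h = p ε 0<ε in
    N , λ k N≤k → subst (ℚ._< ε) (∣p-q∣≡∣q-p∣ (seq x k) (seq y k)) (h k N≤k)

  ≈-trans : ∀ {x y z} → x ≈ y → y ≈ z → x ≈ z
  ≈-trans {x} {y} {z} (wrap p) (wrap q) = wrap (S.trans {x} {y} {z} p q)
    where
    module S = Setoid ≃-setoid

  +-cong : ∀ {x x′ y y′} → x ≈ x′ → y ≈ y′ → x + y ≈ x′ + y′
  +-cong {x} {x′} {y} {y′} (wrap p) (wrap q) = wrap λ ε 0<ε →
    let M , h = p (½ ℚ.* ε) (0<½* 0<ε)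
        N , i = q (½ ℚ.* ε) (0<½* 0<ε)
    in M ℕ.⊔ N , λ k ≤k → halves (seq x k ℚ.- seq x′ k) (seq y k ℚ.- seq y′ k)
      (interchange (seq x k) (seq x′ k) (seq y k) (seq y′ k))
      (h k (ℕ.m⊔n≤o⇒m≤o M N ≤k)) (i k (ℕ.m⊔n≤o⇒n≤o M N ≤k))
    where
    open ℚSolver.+-*-Solver
    interchange : ∀ a b c d → (a ℚ.- b) ℚ.+ (c ℚ.- d) ≡ (a ℚ.+ c) ℚ.- (b ℚ.+ d)
    interchange = solve 4 (λ a b c d → (a :- b) :+ (c :- d) := (a :+ c) :- (b :+ d)) refl

  *-cong : ∀ {x x′ y y′} → x ≈ x′ → y ≈ y′ → x * y ≈ x′ * y′
  *-cong {x} {x′} {y} {y′} (wrap p) (wrap q) = wrap λ ε 0<ε →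
    let A , K , 0<A , x<A = bounded x
        B , L , 0<B , y<B = bounded y′
        module X = Scale 0<A 0<ε
        module Y = Scale 0<B 0<ε
        M , h = q X.δ X.0<δ
        N , i = p Y.δ Y.0<δ
        KL = K ℕ.⊔ L
        MN = M ℕ.⊔ N
    in KL ℕ.⊔ MN , λ k ≤k →
      let k≥KL = ℕ.m⊔n≤o⇒m≤o KL MN ≤k
          k≥MN = ℕ.m⊔n≤o⇒n≤o KL MN ≤k
      in halves (seq x k ℚ.* (seq y k ℚ.- seq y′ k)) (seq y′ k ℚ.* (seq x k ℚ.- seq x′ k))
        (leibniz (seq x k) (seq x′ k) (seq y k) (seq y′ k))
        (X.small (seq x k) _ (x<A k (ℕ.m⊔n≤o⇒m≤o K L k≥KL)) (h k (ℕ.m⊔n≤o⇒m≤o M N k≥MN)))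
        (Y.small (seq y′ k) _ (y<B k (ℕ.m⊔n≤o⇒n≤o K L k≥KL)) (i k (ℕ.m⊔n≤o⇒n≤o M N k≥MN)))
    where
    open ℚSolver.+-*-Solver
    leibniz : ∀ a b c d → a ℚ.* (c ℚ.- d) ℚ.+ d ℚ.* (a ℚ.- b) ≡ a ℚ.* c ℚ.- b ℚ.* d
    leibniz = solve 4 (λ a b c d → a :* (c :- d) :+ d :* (a :- b) := a :* c :- b :* d) refl

  -‿cong : ∀ {x x′} → x ≈ x′ → - x ≈ - x′
  -‿cong {x} {x′} (wrap p) = wrap λ ε 0<ε → let N , h = p ε 0<ε in N , λ k ≤k →
    subst (ℚ._< ε) (trans (sym (ℚ.∣-p∣≡∣p∣ (seq x k ℚ.- seq x′ k))) (cong ∣_∣ (ℚ.neg-distrib-+ (seq x k) (ℚ.- seq x′ k)))) (h k ≤k)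

  ℝ-commutativeRing : CommutativeRing 0ℓ 0ℓ
  ℝ-commutativeRing = record
    { Carrier = ℝ
    ; _≈_ = _≈_
    ; _+_ = _+_
    ; _*_ = _*_
    ; -_ = -_
    ; 0# = 0ℝ
    ; 1# = 1ℝ
    ; isCommutativeRing = record
      { isRing = record
        { +-isAbelianGroup = record
          { isGroup = record
            { isMonoid = record
              { isSemigroup = record
                { isMagma = record
                  { isEquivalence = record { refl = ≈-refl ; sym = ≈-sym ; trans = ≈-trans }
                  ; ∙-cong = +-cong
                  }
                ; assoc = λ x y z → pointwise λ k → ℚ.+-assoc (seq x k) (seq y k) (seq z k)
                }
              ; identity = (λ x → pointwise λ k → ℚ.+-identityˡ (seq x k))
                         , (λ x → pointwise λ k → ℚ.+-identityʳ (seq x k))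
              }
            ; inverse = (λ x → pointwise λ k → ℚ.+-inverseˡ (seq x k))
                      , (λ x → pointwise λ k → ℚ.+-inverseʳ (seq x k))
            ; ⁻¹-cong = -‿cong
            }
          ; comm = λ x y → pointwise λ k → ℚ.+-comm (seq x k) (seq y k)
          }
        ; *-cong = *-cong
        ; *-assoc = λ x y z → pointwise λ k → ℚ.*-assoc (seq x k) (seq y k) (seq z k)
        ; *-identity = (λ x → pointwise λ k → ℚ.*-identityˡ (seq x k))
                     , (λ x → pointwise λ k → ℚ.*-identityʳ (seq x k))
        ; distrib = (λ x y z → pointwise λ k → ℚ.*-distribˡ-+ (seq x k) (seq y k) (seq z k))
                  , (λ x y z → pointwise λ k → ℚ.*-distribʳ-+ (seq x k) (seq y k) (seq z k))
        }
      ; *-comm = λ x y → pointwise λ k → ℚ.*-comm (seq x k) (seq y k)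
      }
    }

  fromℤ : ℤ → ℝ
  fromℤ i = fromℚ (i / 1)

  fromℤ-+ : ∀ i j → fromℤ (i ℤ.+ j) ≈ fromℤ i + fromℤ j
  fromℤ-+ i j = pointwise λ _ → /1-+ i j

  fromℤ-* : ∀ i j → fromℤ (i ℤ.* j) ≈ fromℤ i * fromℤ j
  fromℤ-* i j = pointwise λ _ → /1-* i j

  fromℤ-neg : ∀ i → fromℤ (ℤ.- i) ≈ - fromℤ i
  fromℤ-neg i = pointwise λ _ → sym (/-neg i)

  p≢q⇒0<∣p-q∣ : ∀ {p q} → ¬ p ≡ q → 0ℚ ℚ.< ∣ p ℚ.- q ∣
  p≢q⇒0<∣p-q∣ {p} {q} p≢q = ℚ.≰⇒> λ ≤0 → p≢q (p-q≡0⇒p≡q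
    (ℚ.∣p∣≡0⇒p≡0 _ (ℚ.≤-antisym ≤0 (ℚ.0≤∣p∣ (p ℚ.- q)))))
    where
    open ℚSolver.+-*-Solver
    p-q≡0⇒p≡q : p ℚ.- q ≡ 0ℚ → p ≡ q
    p-q≡0⇒p≡q eq = trans (solve 2 (λ p q → p := (p :- q) :+ q) refl p q)
      (trans (cong (ℚ._+ q) eq) (ℚ.+-identityˡ q))

  -- Equality of rationals is decidable, so arguing by contradiction is legitimate; the constant
  -- sequences fail to be closer than ε = |p - q|.
  fromℚ-injective : ∀ {p q} → fromℚ p ≈ fromℚ q → p ≡ q
  fromℚ-injective {p} {q} (wrap h) = decidable-stable (p ℚ.≟ q) λ p≢q →
    let N , close = h ∣ p ℚ.- q ∣ (p≢q⇒0<∣p-q∣ p≢q)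
    in ℚ.<-irrefl refl (close N ℕ.≤-refl)

  fromℤ-injective : ∀ {i j} → fromℤ i ≈ fromℤ j → i ≡ j
  fromℤ-injective eq = /1-injective (fromℚ-injective eq)

  small : ∀ c {ε} → 0ℚ ℚ.< ε → ∃[ N ] ∀ k → N ℕ.≤ k → + c / suc k ℚ.< ε
  small c {ε} 0<ε = go ε (ℚ.positive 0<ε)
    where
    go : ∀ ε → ℚ.Positive ε → ∃[ N ] ∀ k → N ℕ.≤ k → + c / suc k ℚ.< ε
    -- A positive ε with denominator `suc d` is at least 1 / `suc d`, so c / (k + 1) is below it
    -- once k ≥ c * `suc d`.
    go ε@(mkℚ +[1+ p ] d _) _ = c ℕ.* suc d , λ k N≤k → ℚ.toℚᵘ-cancel-<
      (ℚᵘ.<-respˡ-≃ (ℚᵘ.≃-sym (toℚᵘ-/ (+ c) (suc k))) (*<* (subst₂ ℤ._<_ (ℤ.pos-* c (suc d)) (ℤ.pos-* (suc p) (suc k))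
        (ℤ.+<+ (ℕ.<-≤-trans (ℕ.s≤s N≤k) (ℕ.m≤n*m (suc k) (suc p)))))))

  -- The integer square root, which grows by at most one when `M` grows by one.
  root : ∀ M → ∃[ a ] a ℕ.* a ℕ.≤ M × M ℕ.< suc a ℕ.* suc a
  root zero = 0 , ℕ.z≤n , ℕ.s≤s ℕ.z≤n
  root (suc M) with root M
  ... | a , a²≤M , M<[1+a]² with suc a ℕ.* suc a ℕ.≤? suc M
  ...   | yes ≤1+M = suc a , ≤1+M , ℕ.≤-<-trans M<[1+a]² (ℕ.*-mono-< (ℕ.n<1+n (suc a)) (ℕ.n<1+n (suc a)))
  ...   | no  ≰1+M = a , ℕ.m≤n⇒m≤1+n a²≤M , ℕ.≰⇒> ≰1+M

  square-cancel-< : ∀ {a b} → a ℕ.* a ℕ.< b ℕ.* b → a ℕ.< b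
  square-cancel-< {a} {b} a²<b² with a ℕ.<? b
  ... | yes a<b = a<b
  ... | no  a≮b = contradiction a²<b² (ℕ.≤⇒≯ (ℕ.*-mono-≤ (ℕ.≮⇒≥ a≮b) (ℕ.≮⇒≥ a≮b)))

  ∣∣-< : ∀ {p q ε} → p ℚ.< q ℚ.+ ε → q ℚ.< p ℚ.+ ε → ∣ p ℚ.- q ∣ ℚ.< ε
  ∣∣-< {p} {q} {ε} p< q< with ℚ.∣p∣≡p∨∣p∣≡-p (p ℚ.- q)
  ... | inj₁ eq = subst₂ ℚ._<_ (sym eq) (cancel q ε) (ℚ.+-monoˡ-< (ℚ.- q) p<)
    where
    open ℚSolver.+-*-Solver
    cancel : ∀ q ε → (q ℚ.+ ε) ℚ.- q ≡ ε
    cancel = solve 2 (λ q ε → (q :+ ε) :- q := ε) refl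
  ... | inj₂ eq = subst₂ ℚ._<_ (trans (sym (swap p q)) (sym eq)) (cancel p ε) (ℚ.+-monoˡ-< (ℚ.- p) q<)
    where
    open ℚSolver.+-*-Solver
    cancel : ∀ q ε → (q ℚ.+ ε) ℚ.- q ≡ ε
    cancel = solve 2 (λ q ε → (q :+ ε) :- q := ε) refl
    swap : ∀ p q → ℚ.- (p ℚ.- q) ≡ q ℚ.- p
    swap = solve 2 (λ p q → :- (p :- q) := q :- p) refl

  module Sqrt (N : ℕ) where

    private
      -- `r k` is the integer part of (k + 1) √N, so that r k / (k + 1) approximates √N from below
      -- with error less than 1 / (k + 1).
      r : ℕ → ℕ
      r k = proj₁ (root (N ℕ.* (suc k ℕ.* suc k)))

      r²≤ : ∀ k → r k ℕ.* r k ℕ.≤ N ℕ.* (suc k ℕ.* suc k)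
      r²≤ k = proj₁ (proj₂ (root (N ℕ.* (suc k ℕ.* suc k))))

      <[1+r]² : ∀ k → N ℕ.* (suc k ℕ.* suc k) ℕ.< suc (r k) ℕ.* suc (r k)
      <[1+r]² k = proj₂ (proj₂ (root (N ℕ.* (suc k ℕ.* suc k))))

      q : ℕ → ℚ
      q k = + r k / suc k

      -- Both sides are separated by √N, as r j / (j + 1) ≤ √N < (r k + 1) / (k + 1); without √N at
      -- hand the comparison is made between squares.
      cross : ∀ j k → r j ℕ.* suc k ℕ.< suc (r k) ℕ.* suc j
      cross j k = square-cancel-< (begin-strict
        (r j ℕ.* suc k) ℕ.* (r j ℕ.* suc k)        ≡⟨ rearrange (r j) (suc k) ⟩
        (r j ℕ.* r j) ℕ.* (suc k ℕ.* suc k)        ≤⟨ ℕ.*-monoˡ-≤ (suc k ℕ.* suc k) (r²≤ j) ⟩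
        N ℕ.* (suc j ℕ.* suc j) ℕ.* (suc k ℕ.* suc k)  ≡⟨ swap N (suc j ℕ.* suc j) (suc k ℕ.* suc k) ⟩
        N ℕ.* (suc k ℕ.* suc k) ℕ.* (suc j ℕ.* suc j)  <⟨ ℕ.*-monoˡ-< (suc j ℕ.* suc j) (<[1+r]² k) ⟩
        (suc (r k) ℕ.* suc (r k)) ℕ.* (suc j ℕ.* suc j) ≡⟨ rearrange (suc (r k)) (suc j) ⟨
        (suc (r k) ℕ.* suc j) ℕ.* (suc (r k) ℕ.* suc j) ∎)
        where
        open ℕ.≤-Reasoning
        rearrange : ∀ a b → (a ℕ.* b) ℕ.* (a ℕ.* b) ≡ (a ℕ.* a) ℕ.* (b ℕ.* b)
        rearrange = solve-∀
        swap : ∀ a b c → a ℕ.* b ℕ.* c ≡ a ℕ.* c ℕ.* b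
        swap = solve-∀

      q<q+ : ∀ j k → q j ℚ.< q k ℚ.+ + 1 / suc k
      q<q+ j k = subst (q j ℚ.<_) (sym (trans (/-+ (+ r k) (+ 1) (suc k) (suc k))
          (/-≡ (+ r k ℤ.* + suc k ℤ.+ + 1 ℤ.* + suc k) (+ suc (r k)) (suc k ℕ.* suc k) (suc k) (same (r k) (suc k)))))
        (/-< (+ r j) (+ suc (r k)) (suc j) (suc k)
          (subst₂ ℤ._<_ (ℤ.pos-* (r j) (suc k)) (ℤ.pos-* (suc (r k)) (suc j)) (ℤ.+<+ (cross j k))))
        where
        same : ∀ r K → (+ r ℤ.* + K ℤ.+ + 1 ℤ.* + K) ℤ.* + K ≡ + suc r ℤ.* + (K ℕ.* K)
        same r K = trans (lemma (+ r) (+ K)) (cong (+ suc r ℤ.*_) (sym (ℤ.pos-* K K)))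
          where
          lemma : ∀ r K → (r ℤ.* K ℤ.+ + 1 ℤ.* K) ℤ.* K ≡ (+ 1 ℤ.+ r) ℤ.* (K ℤ.* K)
          lemma = solve-∀ᶻ

      q²≤N : ∀ k → q k ℚ.* q k ℚ.≤ + N / 1
      q²≤N k = subst (ℚ._≤ + N / 1) (sym (/-* (+ r k) (+ r k) (suc k) (suc k)))
        (/-≤ (+ r k ℤ.* + r k) (+ N) (suc k ℕ.* suc k) 1 (subst₂ ℤ._≤_
          (trans (ℤ.pos-* (r k) (r k)) (sym (ℤ.*-identityʳ (+ r k ℤ.* + r k)))) (ℤ.pos-* N (suc k ℕ.* suc k))
          (ℤ.+≤+ (r²≤ k))))

      -- With K = k + 1 and a = r k, N K² < (a + 1)² leaves an error of at most 2 a / K², and a ≤ N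
      -- K bounds it by 2 N / K.
      N≤q²+ : ∀ k → + N / 1 ℚ.≤ q k ℚ.* q k ℚ.+ + (2 ℕ.* N) / suc k
      N≤q²+ k = subst (+ N / 1 ℚ.≤_)
        (sym (trans (cong (ℚ._+ + (2 ℕ.* N) / K) (/-* (+ a) (+ a) K K))
                    (/-+ (+ a ℤ.* + a) (+ (2 ℕ.* N)) (K ℕ.* K) K)))
        (/-≤ (+ N) (+ a ℤ.* + a ℤ.* + K ℤ.+ + (2 ℕ.* N) ℤ.* + (K ℕ.* K)) 1 (K ℕ.* K ℕ.* K)
          (subst₂ ℤ._≤_ (ℤ.pos-* N (K ℕ.* K ℕ.* K)) rhs (ℤ.+≤+ bound)))
        where
        K = suc k
        a = r k
        rhs : + (a ℕ.* a ℕ.* K ℕ.+ 2 ℕ.* N ℕ.* (K ℕ.* K)) ≡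
              (+ a ℤ.* + a ℤ.* + K ℤ.+ + (2 ℕ.* N) ℤ.* + (K ℕ.* K)) ℤ.* + 1
        rhs = sym (trans (ℤ.*-identityʳ _) (cong₂ ℤ._+_
          (trans (cong (ℤ._* + K) (sym (ℤ.pos-* a a))) (sym (ℤ.pos-* (a ℕ.* a) K)))
          (sym (ℤ.pos-* (2 ℕ.* N) (K ℕ.* K)))))
        a≤NK : a ℕ.≤ N ℕ.* K
        a≤NK = ℕ.≮⇒≥ λ NK<a → ℕ.<-irrefl refl (ℕ.<-≤-trans (ℕ.*-mono-< NK<a NK<a)
          (ℕ.≤-trans (r²≤ k) (N≤N² N)))
          where
          N≤N² : ∀ N → N ℕ.* (K ℕ.* K) ℕ.≤ (N ℕ.* K) ℕ.* (N ℕ.* K)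
          N≤N² zero      = ℕ.z≤n
          N≤N² M@(suc _) = subst (M ℕ.* (K ℕ.* K) ℕ.≤_) (rearrange M K) (ℕ.m≤n*m (M ℕ.* (K ℕ.* K)) M)
            where
            rearrange : ∀ M K → M ℕ.* (M ℕ.* (K ℕ.* K)) ≡ (M ℕ.* K) ℕ.* (M ℕ.* K)
            rearrange = solve-∀
        bound : N ℕ.* (K ℕ.* K ℕ.* K) ℕ.≤ a ℕ.* a ℕ.* K ℕ.+ 2 ℕ.* N ℕ.* (K ℕ.* K)
        bound = begin
          N ℕ.* (K ℕ.* K ℕ.* K)        ≡⟨ ℕ.*-assoc N (K ℕ.* K) K ⟨
          -- `suc a * suc a` computes to the successor of `a + a * suc a`, so strictness absorbs the
          -- 1 and leaves a² + 2 a.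
          N ℕ.* (K ℕ.* K) ℕ.* K        ≤⟨ ℕ.*-monoˡ-≤ K (ℕ.s≤s⁻¹ (<[1+r]² k)) ⟩
          (a ℕ.+ a ℕ.* suc a) ℕ.* K    ≡⟨ expand a K ⟩
          a ℕ.* a ℕ.* K ℕ.+ 2 ℕ.* a ℕ.* K      ≤⟨ ℕ.+-monoʳ-≤ (a ℕ.* a ℕ.* K) (ℕ.*-monoˡ-≤ K (ℕ.*-monoʳ-≤ 2 a≤NK)) ⟩
          a ℕ.* a ℕ.* K ℕ.+ 2 ℕ.* (N ℕ.* K) ℕ.* K ≡⟨ cong (a ℕ.* a ℕ.* K ℕ.+_) (collect N K) ⟩
          a ℕ.* a ℕ.* K ℕ.+ 2 ℕ.* N ℕ.* (K ℕ.* K) ∎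
          where
          open ℕ.≤-Reasoning
          expand : ∀ a K → (a ℕ.+ a ℕ.* suc a) ℕ.* K ≡ a ℕ.* a ℕ.* K ℕ.+ 2 ℕ.* a ℕ.* K
          expand = solve-∀
          collect : ∀ N K → 2 ℕ.* (N ℕ.* K) ℕ.* K ≡ 2 ℕ.* N ℕ.* (K ℕ.* K)
          collect = solve-∀

    -- From here on a square root is known only through its sign and its square.
    abstract
      √ : ℝ
      √ = mkℝ q λ ε 0<ε → let M , small-M = small 1 0<ε in
        M , λ j k M≤j M≤k → ∣∣-<
          (ℚ.<-trans (q<q+ j k) (ℚ.+-monoʳ-< (q k) (small-M k M≤k)))
          (ℚ.<-trans (q<q+ k j) (ℚ.+-monoʳ-< (q j) (small-M j M≤j)))

      √-nonNeg : 0ℝ ≤ √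
      √-nonNeg ε 0<ε = 0 , λ k _ → ℚ.+-mono-≤-< (/-≤ (+ 0) (+ r k) 1 (suc k)
        (subst (ℤ._≤ + r k ℤ.* + 1) (sym (ℤ.*-zeroˡ (+ suc k))) (subst (+ 0 ℤ.≤_) (ℤ.pos-* (r k) 1) (ℤ.+≤+ ℕ.z≤n)))) 0<ε

      √*√≈ : √ * √ ≈ fromℤ (+ N)
      √*√≈ = wrap λ ε 0<ε → let M , small-M = small (2 ℕ.* N) 0<ε in
        M , λ k M≤k → ∣∣-<
          (ℚ.≤-<-trans (q²≤N k) (subst (ℚ._< + N / 1 ℚ.+ ε) (ℚ.+-identityʳ (+ N / 1)) (ℚ.+-monoʳ-< (+ N / 1) 0<ε)))
          (ℚ.≤-<-trans (N≤q²+ k) (ℚ.+-monoʳ-< (q k ℚ.* q k) (small-M k M≤k)))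

  open Sqrt public

open Reals
open import Data.Nat.Base using (_∸_; _≥_; _<_; _>_)
open import Defs
open import Data.List.Relation.Binary.Permutation.Setoid.Properties ≃-setoid using () renaming (shift to ↭-shift)
open ℤSolver using (solve-∀)

private variable
  n m k : ℕ

ℤ⟶ℝ : ℤ.+-*-rawRing ACR.-Raw-AlmostCommutative⟶ ACR.fromCommutativeRing ℝ-commutativeRing
ℤ⟶ℝ = record { ⟦_⟧ = fromℤ ; +-homo = fromℤ-+ ; *-homo = fromℤ-* ; -‿homo = fromℤ-neg
             ; 0-homo = ≈-refl ; 1-homo = ≈-refl }

-- Stated with the projections of the ring, as comparing them with _*_ on Cauchy
-- sequences by unfolding is expensive.
fromℤ-recip : ∀ k .{{_ : NonZero k}} → ∃[ r ] CommutativeRing._≈_ ℝ-commutativeRing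
  (CommutativeRing._*_ ℝ-commutativeRing r (ACR._-Raw-AlmostCommutative⟶_.⟦_⟧ ℤ⟶ℝ (+ k)))
  (CommutativeRing.1# ℝ-commutativeRing)
fromℤ-recip k = fromℚ (+ 1 / k) ,
  pointwise λ _ → trans (ℚ.*-comm (+ 1 / k) (+ k / 1)) (n*[i/n] (+ 1) k)

open VertexDistances ℝ-commutativeRing ℤ⟶ℝ fromℤ-recip fromℤ-injective (0ℝ ≤_) √ √-nonNeg √*√≈ public

-- Permuted block vectors as Boolean labellings; finiteness of J̃

trues : List Bool → ℕ
trues []           = 0
trues (true  ∷ bs) = suc (trues bs)
trues (false ∷ bs) = trues bs

trues-replicate : ∀ r s → trues (replicate r true ++ replicate s false ++ []) ≡ r
trues-replicate zero    zero    = refl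
trues-replicate zero    (suc s) = trues-replicate zero s
trues-replicate (suc r) s       = cong suc (trues-replicate r s)

module _ (a b : ℝ) where

  select : Bool → ℝ
  select β = if β then a else b

  private
    Labels : List ℝ → List Bool → Set
    Labels = Pointwise (λ x β → x ≈ select β)

    -- One cannot count the entries equal to `a` by testing them. Instead the labels of the block
    -- list are carried back along the permutation, which preserves the number of `true`; this also
    -- covers the case of equal values `a` and `b`.
    labels-pull : ∀ {xs ys bs} → Permutation _≃_ xs ys → Labels ys bs →
                  ∃[ bs′ ] Labels xs bs′ × trues bs′ ≡ trues bs
    labels-pull (Permutation.refl eqs) ls = _ , go eqs ls , refl
      where
      go : ∀ {xs ys bs} → Pointwise _≃_ xs ys → Labels ys bs → Labels xs bs
      go []         []       = []
      go (eq ∷ eqs) (l ∷ ls) = ≈-trans (wrap eq) l ∷ go eqs ls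
    labels-pull (Permutation.prep eq p) (_∷_ {y = β} l ls) with bs , ls′ , ≡t ← labels-pull p ls =
      β ∷ bs , ≈-trans (wrap eq) l ∷ ls′ , cong-∷ β ≡t
      where
      cong-∷ : ∀ β {bs bs′} → trues bs ≡ trues bs′ → trues (β ∷ bs) ≡ trues (β ∷ bs′)
      cong-∷ true  = cong suc
      cong-∷ false = id
    labels-pull (Permutation.swap eq₁ eq₂ p) (_∷_ {y = β} l (_∷_ {y = γ} l′ ls))
      with bs , ls′ , ≡t ← labels-pull p ls =
      γ ∷ β ∷ bs , ≈-trans (wrap eq₁) l′ ∷ ≈-trans (wrap eq₂) l ∷ ls′ , swap-∷ β γ ≡t
      where
      swap-∷ : ∀ β γ {bs bs′} → trues bs ≡ trues bs′ → trues (γ ∷ β ∷ bs) ≡ trues (β ∷ γ ∷ bs′)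
      swap-∷ true  true  eq = cong (2 ℕ.+_) eq
      swap-∷ true  false eq = cong suc eq
      swap-∷ false true  eq = cong suc eq
      swap-∷ false false eq = eq
    labels-pull (Permutation.trans p q) ls =
      let bs  , ls′  , eq  = labels-pull q ls
          bs′ , ls″ , eq′ = labels-pull p ls′
      in bs′ , ls″ , trans eq′ eq

    labels-blocks : ∀ r s → Labels (replicate r a ++ replicate s b ++ []) (replicate r true ++ replicate s false ++ [])
    labels-blocks zero    zero    = []
    labels-blocks zero    (suc s) = ≈-refl ∷ labels-blocks zero s
    labels-blocks (suc r) s       = ≈-refl ∷ labels-blocks r s

    labels⇒vector : (x : Point n) {bs : List Bool} → Labels (toList x) bs →
                    ∃[ s ] (∀ i → x i ≈ select (s i)) × card s ≡ trues bs
    labels⇒vector {zero}  x [] = (λ ()) , (λ ()) , refl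
    labels⇒vector {suc n} x (_∷_ {y = β} l ls) with s , x≈ , ∣s∣ ← labels⇒vector (tail x) ls =
      β ∷ᵥ s , (λ { zero → l ; (suc i) → x≈ i }) , cong-card β
      where
      cong-card : ∀ β → card (β ∷ᵥ s) ≡ trues (β ∷ _)
      cong-card true  = cong suc ∣s∣
      cong-card false = ∣s∣

  ᴾ⇒labelling : ∀ {r s} {x : Point n} → x ∈ ((a , r) ∷ (b , s) ∷ []) ᴾ →
                ∃[ β ] (∀ i → x i ≈ select (β i)) × card β ≡ r
  ᴾ⇒labelling {r = r} {s} {x} p =
    let bs , ls , eq = labels-pull p (labels-blocks r s)
        β , x≈ , ∣β∣ = labels⇒vector x ls
    in β , x≈ , trans ∣β∣ (trans eq (trues-replicate r s))

  labelling⇒ᴾ : (x : Point n) (β : Vector Bool n) → (∀ i → x i ≈ select (β i)) →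
                x ∈ ((a , card β) ∷ (b , card (not ∘ β)) ∷ []) ᴾ
  labelling⇒ᴾ {zero}  x β x≈ = Permutation.refl []
  labelling⇒ᴾ {suc n} x β x≈ with β zero | x≈ zero
  ... | true  | x₀≈a = Permutation.prep (unwrap {x zero} {a} x₀≈a) (labelling⇒ᴾ (tail x) (tail β) (x≈ ∘ suc))
  -- A leading `b` has to be moved past the whole block of `a`.
  ... | false | x₀≈b = Permutation.trans
    (Permutation.prep (unwrap {x zero} {b} x₀≈b) (labelling⇒ᴾ (tail x) (tail β) (x≈ ∘ suc)))
    (Permutation.sym (λ {x} {y} p → unwrap {y} {x} (≈-sym {x} {y} (wrap {x} {y} p)))
      (↭-shift {b} {b} (unwrap {b} {b} (≈-refl {b})) (replicate (card (tail β)) a)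
        (replicate (card (not ∘ tail β)) b ++ [])))

  labelling⇒ᴾ′ : ∀ {r s} (x : Point n) (β : Vector Bool n) → (∀ i → x i ≈ select (β i)) →
                 card β ≡ r → r ℕ.+ s ≡ n → x ∈ ((a , r) ∷ (b , s) ∷ []) ᴾ
  labelling⇒ᴾ′ x β x≈ refl r+s≡n =
    subst (λ s → x ∈ ((a , card β) ∷ (b , s) ∷ []) ᴾ)
      (ℕ.+-cancelˡ-≡ (card β) _ _ (trans (card-not β) (sym r+s≡n)))
      (labelling⇒ᴾ x β x≈)

select-01 : ∀ β → select 1ℝ 0ℝ β ≡ fromℤ (𝟙 β)
select-01 true  = refl
select-01 false = refl

J̃⇒isVertex : {x : Point n} → x ∈ J̃ n m → IsVertex m x
J̃⇒isVertex {x = x} p =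
  let s , x≈ , ∣s∣ = ᴾ⇒labelling 1ℝ 0ℝ {x = x} p
  in isVertex s ∣s∣ λ i → subst (x i ≈_) (select-01 (s i)) (x≈ i)

isVertex⇒J̃ : m ℕ.≤ n → {x : Point n} → IsVertex m x → x ∈ J̃ n m
isVertex⇒J̃ m≤n {x} (isVertex s ∣s∣ x≈) = labelling⇒ᴾ′ 1ℝ 0ℝ x s
  (λ i → subst (x i ≈_) (sym (select-01 (s i))) (x≈ i)) ∣s∣ (ℕ.m+[n∸m]≡n m≤n)

allBits : ∀ n → List (Vector Bool n)
allBits zero    = (λ ()) ∷ []
allBits (suc n) = map (true ∷ᵥ_) (allBits n) ++ map (false ∷ᵥ_) (allBits n)

-- Vectors are functions, so the enumeration is complete up to pointwise equality; `card-cong` and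
-- the setoid of points respect it.
allBits-complete : (s : Vector Bool n) → Any (s ≗_) (allBits n)
allBits-complete {zero}  s = here λ ()
allBits-complete {suc n} s with s zero in s₀
... | true  = Any.++⁺ˡ (Any.map⁺ (Any.map (λ eq → λ { zero → s₀ ; (suc i) → eq i }) (allBits-complete (tail s))))
... | false = Any.++⁺ʳ _ (Any.map⁺ (Any.map (λ eq → λ { zero → s₀ ; (suc i) → eq i }) (allBits-complete (tail s))))

vertices : ∀ n m → List (Point n)
vertices n m = map vertex (filter (λ s → card s ℕ.≟ m) (allBits n))

J̃-finite : ∀ {n m} → m ℕ.≤ n → (x : Point n) → x ∈ J̃ n m ⇔ Any (x ≋_) (vertices n m)
J̃-finite {n} {m} m≤n x = mk⇔ to from
  where
  to : x ∈ J̃ n m → Any (x ≋_) (vertices n m)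
  to p =
    let isVertex s ∣s∣ x≈ = J̃⇒isVertex {m = m} {x = x} p
        s′ , s′∈ , s≗s′ = find (allBits-complete s)
    in Any.map⁺ (lose (∈-filter⁺ (λ s → card s ℕ.≟ m) s′∈ (trans (sym (card-cong s≗s′)) ∣s∣))
      λ i → unwrap {x i} {vertex s′ i} (subst (λ β → x i ≈ fromℤ (𝟙 β)) (s≗s′ i) (x≈ i)))

  from : Any (x ≋_) (vertices n m) → x ∈ J̃ n m
  from p =
    let s , s∈ , x≋ = find (Any.map⁻ p)
    in isVertex⇒J̃ m≤n {x} (isVertex s (proj₂ (∈-filter⁻ (λ s → card s ℕ.≟ m) {xs = allBits n} s∈))
         λ i → wrap {x i} {vertex s i} (x≋ i))

-- J̃ and its one-point extensions as distance sets

sum-squares≈distSq : ∀ {n} (x y : Point n) → sum (λ i → (x i - y i) * (x i - y i)) ≈ distSq x y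
sum-squares≈distSq x y = sum-cong {f = λ i → (x i - y i) * (x i - y i)} λ i → pointwise λ k → refl

distance⇒Dist : ∀ {n} {x y : Point n} {d} → IsDistance {n} x y d → Dist x y d
distance⇒Dist {x = x} {y} {d} (0≤d , eq) = mkDist 0≤d
  (≈-trans {d * d} {sum (λ i → (x i - y i) * (x i - y i))} {distSq x y}
    (wrap {d * d} {sum (λ i → (x i - y i) * (x i - y i))} eq) (sum-squares≈distSq x y))

Dist⇒distance : ∀ {n} {x y : Point n} {d} → Dist x y d → IsDistance {n} x y d
Dist⇒distance {x = x} {y} {d} (mkDist 0≤d eq) = 0≤d , unwrap {d * d} {sum (λ i → (x i - y i) * (x i - y i))}
  (≈-trans {d * d} {distSq x y} {sum (λ i → (x i - y i) * (x i - y i))} eq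
    (≈-sym {sum (λ i → (x i - y i) * (x i - y i))} {distSq x y} (sum-squares≈distSq x y)))

≋⇒≈ : ∀ {n} {x y : Point n} → x ≋ y → ∀ i → x i ≈ y i
≋⇒≈ {x = x} {y} x≋y i = wrap {x i} {y i} (x≋y i)

≈⇒≋ : ∀ {n} {x y : Point n} → (∀ i → x i ≈ y i) → x ≋ y
≈⇒≋ {x = x} {y} x≈y i = unwrap {x i} {y i} (x≈y i)

≉⇒Distinct : ∀ {n} {x y : Point n} → ¬ (x ≋ y) → Distinct x y
≉⇒Distinct {x = x} {y} x≢y x≈y = x≢y (≈⇒≋ {x = x} {y} x≈y)

Distinct⇒≉ : ∀ {n} {x y : Point n} → Distinct x y → ¬ (x ≋ y)
Distinct⇒≉ {x = x} {y} x≢y x≋y = x≢y (≋⇒≈ {x = x} {y} x≋y)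

sum≈⇒∈Hyperplane : ∀ {n m} {x : Point n} → sum x ≈ fromℤ (+ m) → x ∈ Hyperplane n m
sum≈⇒∈Hyperplane {m = m} {x} eq = unwrap {sum x} {fromℤ (+ m)} eq

∈Hyperplane⇒sum≈ : ∀ {n m} {x : Point n} → x ∈ Hyperplane n m → sum x ≈ fromℤ (+ m)
∈Hyperplane⇒sum≈ {m = m} {x} eq = wrap {sum x} {fromℤ (+ m)} eq

radius-injective′ : ∀ {m} {i j : Fin m} → radius i ≃ radius j → i ≡ j
radius-injective′ {m} {i} {j} eq = radius-injective {m} {i} {j} (wrap {radius i} {radius j} eq)

distance : ∀ {n m} {x y : Point n} → ∃[ j ] Dist x y (radius {m} j) → ∃[ j ] IsDistance {n} x y (radius {m} j)
distance {n} {m} {x} {y} (j , xyd) = j , Dist⇒distance {n} {x} {y} {radius j} xyd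

module _ {n m : ℕ} (m≤n : m ℕ.≤ n) (2m≤n : 2 ℕ.* m ℕ.≤ n) where

  J̃⊆Hyperplane : J̃ n m ⊆ Hyperplane n m
  J̃⊆Hyperplane {x} x∈ = sum≈⇒∈Hyperplane {n} {m} {x} (isVertex⇒sum {x = x} (J̃⇒isVertex {m = m} {x = x} x∈))

  attained : (X : PointSet n) → J̃ n m ⊆ X → ∀ j → ∃₂ λ x y → x ∈ X × y ∈ X × ¬ (x ≋ y) × IsDistance {n} x y (radius {m} j)
  attained X J̃⊆X j = go (radius-attained 2m≤n j)
    where
    go : (∃₂ λ x y → IsVertex m x × IsVertex m y × Distinct x y × Dist x y (radius {m} j)) →
         ∃₂ λ x y → x ∈ X × y ∈ X × ¬ (x ≋ y) × IsDistance {n} x y (radius {m} j)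
    go (x , y , vx , vy , x≢y , xyd) = x , y , J̃⊆X {x} (isVertex⇒J̃ m≤n vx) , J̃⊆X {y} (isVertex⇒J̃ m≤n vy)
      , Distinct⇒≉ {x = x} {y} x≢y , Dist⇒distance {n} {x} {y} {radius j} xyd

  J̃-isDistanceSet : IsDistanceSet m (J̃ n m)
  J̃-isDistanceSet = (vertices n m , J̃-finite m≤n) , radius , radius-injective′
    , attained (J̃ n m) (λ {x} x∈ → x∈)
    , λ x y x∈ y∈ x≢y → distance {n} {m} {x} {y} (vertices-distance (J̃⇒isVertex {m = m} {x = x} x∈)
        (J̃⇒isVertex {m = m} {x = y} y∈) (≉⇒Distinct {x = x} {y} x≢y))

  module _ (x : Point n) (sum-x : sum x ≈ fromℤ (+ m)) (¬vx : ¬ IsVertex m x)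
    (distance-x : ∀ {z} → IsVertex m z → ∃[ j ] Dist x z (radius {m} j)) where

    -- The added set is the class of `x` under `≋`, so distances from `x` are transported to all its
    -- representatives; two representatives are never distinct.
    canBeAdded : CanBeAdded n m x
    canBeAdded = sum≈⇒∈Hyperplane {n} {m} {x} sum-x , (λ x∈ → ¬vx (J̃⇒isVertex {m = m} {x = x} x∈))
      , (x ∷ vertices n m , λ y → mk⇔ (to y) (from y)) , radius , radius-injective′
      , attained (J̃ n m ∪ (_≋ x)) inj₁ , distances
      where
      X : PointSet n
      X = J̃ n m ∪ (_≋ x)

      to : ∀ y → y ∈ X → Any (y ≋_) (x ∷ vertices n m)
      to y (inj₁ y∈) = there (Equivalence.to (J̃-finite m≤n y) y∈)
      to y (inj₂ y≋x) = here y≋x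

      from : ∀ y → Any (y ≋_) (x ∷ vertices n m) → y ∈ X
      from y (here y≋x) = inj₂ y≋x
      from y (there y∈) = inj₁ (Equivalence.from (J̃-finite m≤n y) y∈)

      from-x : ∀ {y z} → y ≋ x → z ∈ J̃ n m → ∃[ j ] Dist y z (radius {m} j)
      from-x {y} {z} y≋x z∈ = go (distance-x (J̃⇒isVertex {m = m} {x = z} z∈))
        where
        go : ∃[ j ] Dist x z (radius {m} j) → ∃[ j ] Dist y z (radius {m} j)
        go (j , xzd) = j , Dist-resp (λ i → ≈-sym {y i} {x i} (≋⇒≈ {x = y} {x} y≋x i)) (λ i → ≈-refl {z i}) xzd

      flip : ∀ {y z} → ∃[ j ] Dist z y (radius {m} j) → ∃[ j ] Dist y z (radius {m} j)
      flip (j , zyd) = j , Dist-sym zyd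

      distances : ∀ y z → y ∈ X → z ∈ X → ¬ (y ≋ z) → ∃[ j ] IsDistance {n} y z (radius {m} j)
      distances y z (inj₁ y∈) (inj₁ z∈) y≢z = proj₂ (proj₂ (proj₂ (proj₂ J̃-isDistanceSet))) y z y∈ z∈ y≢z
      distances y z (inj₁ y∈) (inj₂ z≋x) y≢z = distance {n} {m} {y} {z} (flip {y} {z} (from-x {z} {y} z≋x y∈))
      distances y z (inj₂ y≋x) (inj₁ z∈) y≢z = distance {n} {m} {y} {z} (from-x {y} {z} y≋x z∈)
      distances y z (inj₂ y≋x) (inj₂ z≋x) y≢z = ⊥-elim (y≢z (≈⇒≋ {x = y} {z} λ i →
        ≈-trans {y i} {x i} {z i} (≋⇒≈ {x = y} {x} y≋x i) (≈-sym {z i} {x i} (≋⇒≈ {x = z} {x} z≋x i))))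

-- The condition in ℕ, and the points that can be added

square/n : ∀ n r w .{{_ : NonZero n}} → n ℕ.* w ≡ r ℕ.* r → + (r ℕ.^ 2) / n ≡ + w / 1
square/n n r w nw≡r² = /-≡ (+ (r ℕ.^ 2)) (+ w) n 1 (begin
  + (r ℕ.^ 2) ℤ.* + 1   ≡⟨ ℤ.*-identityʳ (+ (r ℕ.^ 2)) ⟩
  + (r ℕ.^ 2)           ≡⟨ cong (λ k → + (r ℕ.* k)) (ℕ.*-identityʳ r) ⟩
  + (r ℕ.* r)           ≡⟨ cong +_ (trans (sym nw≡r²) (ℕ.*-comm n w)) ⟩
  + (w ℕ.* n)           ≡⟨ ℤ.pos-* w n ⟩
  + w ℤ.* + n           ∎)
  where open ≡.≡-Reasoning

-- Since r²/n is the integer w, the rational inequality has integral terms; moving w to the right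
-- side avoids subtraction.
bound⇔ : ∀ n r w m .{{_ : NonZero n}} → n ℕ.* w ≡ r ℕ.* r →
  (+ (3 ℕ.* r) / 1 ℚ.- + (r ℕ.^ 2) / n ℚ.≤ + (4 ℕ.* m) / 1) ⇔ (3 ℕ.* r ℕ.≤ 4 ℕ.* m ℕ.+ w)
bound⇔ n r w m nw≡r² = mk⇔ to from
  where
  a = + (3 ℕ.* r)
  b = + (4 ℕ.* m)

  lhs : a / 1 ℚ.- + (r ℕ.^ 2) / n ≡ (a ℤ.- + w) / 1
  lhs = trans (cong (λ q → a / 1 ℚ.- q) (square/n n r w nw≡r²))
    (trans (cong (a / 1 ℚ.+_) (/-neg (+ w))) (sym (/1-+ a (ℤ.- + w))))

  to : a / 1 ℚ.- + (r ℕ.^ 2) / n ℚ.≤ b / 1 → 3 ℕ.* r ℕ.≤ 4 ℕ.* m ℕ.+ w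
  to le = ℤ.drop‿+≤+ (by-difference (gap (subst₂ ℤ._≤_ (ℤ.*-identityʳ (a ℤ.- + w)) (ℤ.*-identityʳ b)
    (/-≤⁻¹ (a ℤ.- + w) b 1 1 (subst (ℚ._≤ b / 1) lhs le)))) (shift a b (+ w)))
    where
    shift : ∀ a b w → b ℤ.+ w ℤ.- a ≡ b ℤ.- (a ℤ.- w)
    shift = solve-∀

  from : 3 ℕ.* r ℕ.≤ 4 ℕ.* m ℕ.+ w → a / 1 ℚ.- + (r ℕ.^ 2) / n ℚ.≤ b / 1
  from le = subst (ℚ._≤ b / 1) (sym lhs) (/-≤ (a ℤ.- + w) b 1 1
    (subst₂ ℤ._≤_ (sym (ℤ.*-identityʳ (a ℤ.- + w))) (sym (ℤ.*-identityʳ b))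
      (by-difference (gap (ℤ.+≤+ le)) (shift a b (+ w)))))
    where
    shift : ∀ a b w → b ℤ.- (a ℤ.- w) ≡ b ℤ.+ w ℤ.- a
    shift = solve-∀

below-value : ∀ p b → IsTranslate (fromℚ p) (ℤ.- 𝟙 (not b)) (select (fromℚ p) (fromℚ (ℚ.- 1ℚ ℚ.+ p)) b)
below-value p true  = mkTranslate (pointwise λ k → sym (ℚ.+-identityʳ p))
below-value p false = mkTranslate (pointwise λ k → ℚ.+-comm (ℚ.- 1ℚ) p)

above-value : ∀ p b → IsTranslate (fromℚ p) (𝟙 b) (select (fromℚ (1ℚ ℚ.+ p)) (fromℚ p) b)
above-value p true  = mkTranslate (pointwise λ k → ℚ.+-comm 1ℚ p)
above-value p false = mkTranslate (pointwise λ k → sym (ℚ.+-identityʳ p))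

select-same : ∀ a b → select a a b ≈ a
select-same a true  = ≈-refl {a}
select-same a false = ≈-refl {a}

∸-≡ : ∀ {a b} → b ℕ.≤ a → + (a ∸ b) ≡ + a ℤ.- + b
∸-≡ {a} {b} b≤a = trans (add-sub (+ (a ∸ b)) (+ b)) (cong (λ k → + k ℤ.- + b) (ℕ.m∸n+n≡m b≤a))
  where
  add-sub : ∀ u v → u ≡ u ℤ.+ v ℤ.- v
  add-sub = solve-∀

centre-of : ∀ {n r w} .{{_ : NonZero n}} → n ℕ.* w ≡ r ℕ.* r → Centre n r w (fromℚ (+ r / n))
centre-of {n} {r} {w} nw≡r² = mkCentre (pointwise λ _ → n*[i/n] (+ r) n) (pointwise λ _ → trans (/-* (+ r) (+ r) n 1)
  (trans (/-≡ (+ r ℤ.* + r) (+ (r ℕ.^ 2)) (n ℕ.* 1) n {{ℕ.m*n≢0 n 1}} (cong₂ ℤ._*_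
    (trans (sym (ℤ.pos-* r r)) (cong (λ k → + (r ℕ.* k)) (sym (ℕ.*-identityʳ r))))
    (cong +_ (sym (ℕ.*-identityʳ n)))))
  (square/n n r w nw≡r²)))

module _ {m n r w : ℕ} (2m≤n : 2 ℕ.* m ℕ.≤ n) (adm : Admissible n r w) (0<r : 0 ℕ.< r) (r<n : r ℕ.< n)
  (p : ℚ) (centre : Centre n r w (fromℚ p)) where

  private
    m≤n : m ℕ.≤ n
    m≤n = ℕ.≤-trans (ℕ.m≤m+n m (m ℕ.+ 0)) 2m≤n

    w<r : w ℕ.< r
    w<r = ℕ.*-cancelˡ-< n w r (subst (ℕ._< n ℕ.* r) (sym (Admissible.square adm))
      (ℕ.*-monoˡ-< r {{ℕ.>-nonZero 0<r}} r<n))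

    addable : (x : Point n) (y : Vector ℤ n) → Shifted (fromℚ p) y x →
      ∑ y ≡ + m ℤ.- + r → (∀ s → card s ≡ m → sqDist y s ℤ.≤ + w ℤ.+ + 2 ℤ.* + m) → CanBeAdded n m x
    addable x y x≈ ∑y near = canBeAdded m≤n 2m≤n x
      (point-sum adm centre {x} y x≈ ∑y w<r near)
      (point-∉ adm centre {x} y x≈ ∑y w<r near)
      (point-distance adm centre {x} y x≈ ∑y w<r near)

    below-shifted : (β : Vector Bool n) (x : Point n) → (∀ i → x i ≈ select (fromℚ p) (fromℚ (ℚ.- 1ℚ ℚ.+ p)) (β i)) →
                    Shifted (fromℚ p) (λ i → ℤ.- 𝟙 (not (β i))) x
    below-shifted β x x≈ = shifted {n} {fromℚ p} {λ i → ℤ.- 𝟙 (not (β i))} {x}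
      {λ i → select (fromℚ p) (fromℚ (ℚ.- 1ℚ ℚ.+ p)) (β i)} x≈ (λ i → below-value p (β i))

    above-shifted : (β : Vector Bool n) (x : Point n) → (∀ i → x i ≈ select (fromℚ (1ℚ ℚ.+ p)) (fromℚ p) (β i)) →
                    Shifted (fromℚ p) (𝟙 ∘ β) x
    above-shifted β x x≈ = shifted {n} {fromℚ p} {𝟙 ∘ β} {x}
      {λ i → select (fromℚ (1ℚ ℚ.+ p)) (fromℚ p) (β i)} x≈ (λ i → above-value p (β i))

    -- Label `false` marks the coordinates lowered by 1. There are r - m of them, so the integral
    -- part sums to m - r.
    below : m ℕ.≤ r → 3 ℕ.* r ℕ.≤ 4 ℕ.* m ℕ.+ w → (β : Vector Bool n) → card β ≡ n ∸ r ℕ.+ m →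
            (x : Point n) → (∀ i → x i ≈ select (fromℚ p) (fromℚ (ℚ.- 1ℚ ℚ.+ p)) (β i)) → CanBeAdded n m x
    below m≤r 3r≤ β ∣β∣ x x≈ = addable x (λ i → ℤ.- 𝟙 (not (β i))) (below-shifted β x x≈) ∑y (near-below r w β 3r≤ ∑y)
      where
      cancel : ∀ n r m → n ℤ.- r ℤ.+ m ℤ.- n ≡ m ℤ.- r
      cancel = solve-∀
      ∑y : ∑ (λ i → ℤ.- 𝟙 (not (β i))) ≡ + m ℤ.- + r
      ∑y = trans (∑-neg𝟙 β) (trans (cong (λ k → + k ℤ.- + n) ∣β∣)
        (trans (cong (λ k → k ℤ.+ + m ℤ.- + n) (∸-≡ (ℕ.<⇒≤ r<n))) (cancel (+ n) (+ r) (+ m))))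

    above : r ℕ.≤ m → (β : Vector Bool n) → card β ≡ m ∸ r →
            (x : Point n) → (∀ i → x i ≈ select (fromℚ (1ℚ ℚ.+ p)) (fromℚ p) (β i)) → CanBeAdded n m x
    above r≤m β ∣β∣ x x≈ = addable x (𝟙 ∘ β) (above-shifted β x x≈) ∑y (near-above r w β ∑y)
      where
      ∑y : ∑ (𝟙 ∘ β) ≡ + m ℤ.- + r
      ∑y = trans (∑𝟙≡card β) (trans (cong +_ ∣β∣) (∸-≡ r≤m))

    below-card : m ℕ.≤ r → (n ∸ r ℕ.+ m) ℕ.+ (r ∸ m) ≡ n
    below-card m≤r = trans (ℕ.+-assoc (n ∸ r) m (r ∸ m))
      (trans (cong (n ∸ r ℕ.+_) (ℕ.m+[n∸m]≡n m≤r)) (ℕ.m∸n+n≡m (ℕ.<⇒≤ r<n)))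

  addable-below : m ℕ.≤ r → 3 ℕ.* r ℕ.≤ 4 ℕ.* m ℕ.+ w → (x : Point n) →
    x ∈ ((fromℚ p , n ∸ r ℕ.+ m) ∷ (fromℚ (ℚ.- 1ℚ ℚ.+ p) , r ∸ m) ∷ []) ᴾ → CanBeAdded n m x
  addable-below m≤r 3r≤ x x∈ =
    let β , x≈ , ∣β∣ = ᴾ⇒labelling (fromℚ p) (fromℚ (ℚ.- 1ℚ ℚ.+ p)) {r = n ∸ r ℕ.+ m} {s = r ∸ m} {x = x} x∈ in below m≤r 3r≤ β ∣β∣ x x≈

  addable-above : r ℕ.≤ m → (x : Point n) →
    x ∈ ((fromℚ (1ℚ ℚ.+ p) , m ∸ r) ∷ (fromℚ p , n ℕ.+ r ∸ m) ∷ []) ᴾ → CanBeAdded n m x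
  addable-above r≤m x x∈ =
    let β , x≈ , ∣β∣ = ᴾ⇒labelling (fromℚ (1ℚ ℚ.+ p)) (fromℚ p) {r = m ∸ r} {s = n ℕ.+ r ∸ m} {x = x} x∈ in above r≤m β ∣β∣ x x≈

  -- One block is the same list as two blocks of which the second is empty. The point is the
  -- boundary case of `above` with no coordinate raised, so the labels read off are replaced by
  -- `const false`.
  addable-equal : m ≡ r → (x : Point n) → x ∈ ((fromℚ p , n) ∷ []) ᴾ → CanBeAdded n m x
  addable-equal m≡r x x∈ =
    let β , x≈ , _ = ᴾ⇒labelling (fromℚ p) (fromℚ p) {r = n} {s = 0} {x = x} x∈
    in above (ℕ.≤-reflexive (sym m≡r)) (const false) (trans (card-∅ {n}) (sym (ℕ.m≤n⇒m∸n≡0 (ℕ.≤-reflexive m≡r)))) x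
         λ i → ≈-trans {x i} {select (fromℚ p) (fromℚ p) (β i)} {fromℚ p} (x≈ i) (select-same (fromℚ p) (β i))

  private
    exists-below : m ℕ.≤ r → 3 ℕ.* r ℕ.≤ 4 ℕ.* m ℕ.+ w → ∃[ x ] CanBeAdded n m x
    exists-below m≤r 3r≤ =
      let β , _ , ∣β∣ = subset-⊆ {n} {n ∸ r ℕ.+ m} (const true) (ℕ.≤-trans (ℕ.m≤m+n _ (r ∸ m))
            (ℕ.≤-reflexive (trans (below-card m≤r) (sym (card-full {n})))))
          x = λ i → select (fromℚ p) (fromℚ (ℚ.- 1ℚ ℚ.+ p)) (β i)
      in x , below m≤r 3r≤ β ∣β∣ x λ i → ≈-refl {x i}

    exists-above : r ℕ.≤ m → ∃[ x ] CanBeAdded n m x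
    exists-above r≤m =
      let β , _ , ∣β∣ = subset-⊆ {n} {m ∸ r} (const true) (ℕ.≤-trans (ℕ.m∸n≤m m r)
            (ℕ.≤-trans m≤n (ℕ.≤-reflexive (sym (card-full {n})))))
          x = λ i → select (fromℚ (1ℚ ℚ.+ p)) (fromℚ p) (β i)
      in x , above r≤m β ∣β∣ x λ i → ≈-refl {x i}

  addable-exists : 3 ℕ.* r ℕ.≤ 4 ℕ.* m ℕ.+ w → ∃[ x ] CanBeAdded n m x
  addable-exists 3r≤ = [ (λ m≤r → exists-below m≤r 3r≤) , exists-above ]′ (ℕ.≤-total m r)

-- Maximality and the extension condition

canBeAdded⇒¬maximal : ∀ {n m} → m ℕ.≤ n → 2 ℕ.* m ℕ.≤ n → ∃[ x ] CanBeAdded n m x → ¬ IsMaximalIn (Hyperplane n m) m (J̃ n m)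
canBeAdded⇒¬maximal {n} {m} m≤n 2m≤n (x , x∈H , x∉J̃ , Y-isDistanceSet) (_ , _ , maximal) =
  maximal (J̃ n m ∪ (_≋ x) , (λ {y} → Y⊆H y) , Y-isDistanceSet , inj₁ , λ (Y⊆J̃ , _) →
    x∉J̃ (Y⊆J̃ {x} (inj₂ (≈⇒≋ {x = x} {x} λ i → ≈-refl {x i}))))
  where
  Y⊆H : ∀ y → y ∈ J̃ n m ∪ (_≋ x) → y ∈ Hyperplane n m
  Y⊆H y (inj₁ y∈) = J̃⊆Hyperplane m≤n 2m≤n {y} y∈
  Y⊆H y (inj₂ y≋x) = sum≈⇒∈Hyperplane {n} {m} {y} (≈-trans {sum y} {sum x} {fromℤ (+ m)}
    (sum-cong {n} {y} {x} (≋⇒≈ {x = y} {x} y≋x)) (∈Hyperplane⇒sum≈ {n} {m} {x} x∈H))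

-- Double negation commutes with quantification over a finite list. This stands in for deciding
-- which points are vertices.
¬¬-all : ∀ {n m} (l : List (Point n)) → (∀ y → Any (y ≋_) l → ¬ ¬ IsVertex m y) → ¬ ¬ (∀ y → Any (y ≋_) l → IsVertex m y)
¬¬-all []      h k = k λ y ()
¬¬-all {n} {m} (z ∷ l) h k = h z (here (≈⇒≋ {x = z} {z} λ i → ≈-refl {z i})) λ vz →
  ¬¬-all l (λ y y∈ → h y (there y∈)) λ all → k (extend vz all)
  where
  extend : IsVertex m z → (∀ y → Any (y ≋_) l → IsVertex m y) → ∀ y → Any (y ≋_) (z ∷ l) → IsVertex m y
  extend vz all y (here y≋z) = isVertex-resp (≋⇒≈ {x = y} {z} y≋z) vz
  extend vz all y (there y∈) = all y y∈

-- A strictly larger Y need not have a point provably outside J̃, but Y is finite, so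
-- not having one would make Y ⊆ J̃ up to double negation.
no-extension⇒maximal : ∀ {n m} .{{_ : NonZero n}} → 1 ℕ.≤ m → 2 ℕ.* m ℕ.≤ n →
  ¬ (n₀ n ℕ.< n × (∀ {w} → Admissible n (n₀ n) w → 3 ℕ.* n₀ n ℕ.≤ 4 ℕ.* m ℕ.+ w)) →
  IsMaximalIn (Hyperplane n m) m (J̃ n m)
no-extension⇒maximal {n} {m} 1≤m 2m≤n ¬bounds =
  (λ {x} → J̃⊆Hyperplane m≤n 2m≤n {x}) , J̃-isDistanceSet m≤n 2m≤n , no-extension
  where
  m≤n : m ℕ.≤ n
  m≤n = ℕ.≤-trans (ℕ.m≤m+n m (m ℕ.+ 0)) 2m≤n

  no-extension : ¬ (∃[ Y ] (Y ⊆ Hyperplane n m × IsDistanceSet m Y × J̃ n m ⊆ Y × ¬ (Y ≐ J̃ n m)))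
  no-extension (Y , Y⊆H , ((l , l-lists) , d , _ , _ , distances) , J̃⊆Y , Y≢J̃) =
    ¬¬-all l (λ y y∈ → member y (Equivalence.from (l-lists y) y∈)) λ all →
      Y≢J̃ ((λ {y} y∈ → isVertex⇒J̃ m≤n {y} (all y (Equivalence.to (l-lists y) y∈))) , λ {y} → J̃⊆Y {y})
    where
    realised : ∀ {y z} → y ∈ Y → z ∈ Y → Distinct y z → ∃[ i ] Dist y z (d i)
    realised {y} {z} y∈ z∈ y≢z = go (distances y z y∈ z∈ (Distinct⇒≉ {x = y} {z} y≢z))
      where
      go : ∃[ i ] IsDistance {n} y z (d i) → ∃[ i ] Dist y z (d i)
      go (i , yzd) = i , distance⇒Dist {n} {y} {z} {d i} yzd

    vertex∈Y : ∀ {y} → IsVertex m y → y ∈ Y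
    vertex∈Y {y} vy = J̃⊆Y {y} (isVertex⇒J̃ m≤n {y} vy)

    member : ∀ y → y ∈ Y → ¬ ¬ IsVertex m y
    member y y∈ ¬vy = ¬bounds (extension⇒bounds {n} {m} 1≤m 2m≤n {y} d
      (λ {u} {v} vu vv → realised {u} {v} (vertex∈Y {u} vu) (vertex∈Y {v} vv))
      (λ {v} vv → realised {y} {v} y∈ (vertex∈Y {v} vv))
      ¬vy (∈Hyperplane⇒sum≈ {n} {m} {y} (Y⊆H {y} y∈)))

extensionCondition⇒bound : ∀ n m .{{_ : NonZero n}} → ExtensionCondition n m →
  3 ℕ.* n₀ n ℕ.≤ 4 ℕ.* m ℕ.+ proj₁ (n₀-admissible n)
extensionCondition⇒bound n m (_ , le) = Equivalence.to
  (bound⇔ n (n₀ n) (proj₁ (n₀-admissible n)) m (Admissible.square (proj₂ (n₀-admissible n)))) le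

bounds⇒extensionCondition : ∀ n m .{{_ : NonZero n}} →
  n₀ n ℕ.< n × (∀ {w} → Admissible n (n₀ n) w → 3 ℕ.* n₀ n ℕ.≤ 4 ℕ.* m ℕ.+ w) → ExtensionCondition n m
bounds⇒extensionCondition n m (r<n , bound) = r<n , Equivalence.from
  (bound⇔ n (n₀ n) (proj₁ (n₀-admissible n)) m (Admissible.square (proj₂ (n₀-admissible n))))
  (bound (proj₂ (n₀-admissible n)))

-- Refuting maximality yields the condition only up to double negation; as a comparison of naturals
-- and rationals it is decidable, which removes the double negation.
extensionCondition? : ∀ n m .{{_ : NonZero n}} → Dec (ExtensionCondition n m)
extensionCondition? n m = (n₀ n ℕ.<? n) ×-dec (_ ℚ.≤? _)

theorem1 : (m n : ℕ) → .{{_ : NonZero n}} → m ≥ 1 → n ≥ 2 ℕ.* m →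
    ((¬ IsMaximalIn (Hyperplane n m) m (J̃ n m)) ⇔ ExtensionCondition n m)
    × (ExtensionCondition n m →
        (m < n₀ n → (x : Point n) →
          x ∈ ((fromℚ (+ n₀ n / n) , n ∸ n₀ n ℕ.+ m)
             ∷ (fromℚ (ℚ.- 1ℚ ℚ.+ + n₀ n / n) , n₀ n ∸ m)
             ∷ []) ᴾ →
          CanBeAdded n m x)
      × (m ≡ n₀ n → (x : Point n) →
          x ∈ ((fromℚ (+ m / n) , n) ∷ []) ᴾ →
          CanBeAdded n m x)
      × (m > n₀ n → (x : Point n) →
          x ∈ ((fromℚ (1ℚ ℚ.+ + n₀ n / n) , m ∸ n₀ n)
             ∷ (fromℚ (+ n₀ n / n) , n ℕ.+ n₀ n ∸ m)
             ∷ []) ᴾ →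
          CanBeAdded n m x))
theorem1 m n 1≤m 2m≤n =
    mk⇔ (λ ¬maximal → decidable-stable (extensionCondition? n m) λ ¬condition →
          ¬maximal (no-extension⇒maximal {n} {m} 1≤m 2m≤n (¬condition ∘ bounds⇒extensionCondition n m)))
        (λ condition → canBeAdded⇒¬maximal {n} {m} m≤n 2m≤n
          (addable-exists {m} {n} 2m≤n adm (0<n₀ n) (proj₁ condition) p centre (extensionCondition⇒bound n m condition)))
  , λ condition →
      (λ m<n₀ → addable-below {m} {n} 2m≤n adm (0<n₀ n) (proj₁ condition) p centre (ℕ.<⇒≤ m<n₀) (extensionCondition⇒bound n m condition))
    , (λ m≡n₀ x x∈ → addable-equal {m} {n} 2m≤n adm (0<n₀ n) (proj₁ condition) p centre m≡n₀ x
        (subst (λ k → x ∈ ((fromℚ (+ k / n) , n) ∷ []) ᴾ) m≡n₀ x∈))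
    , (λ m>n₀ → addable-above {m} {n} 2m≤n adm (0<n₀ n) (proj₁ condition) p centre (ℕ.<⇒≤ m>n₀))
  where
  p : ℚ
  p = + n₀ n / n

  adm : Admissible n (n₀ n) (proj₁ (n₀-admissible n))
  adm = proj₂ (n₀-admissible n)

  centre : Centre n (n₀ n) (proj₁ (n₀-admissible n)) (fromℚ p)
  centre = centre-of (Admissible.square adm)

  m≤n : m ℕ.≤ n
  m≤n = ℕ.≤-trans (ℕ.m≤m+n m (m ℕ.+ 0)) 2m≤n
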